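{- There is an absolute constant $C>0$ such that for every real $m\times n$ matrix $A$ of rank $r$, \[ \operatorname{detlb}A\le\gamma_2(A)\le C\log r\cdot\operatorname{detlb}A . \]
   Context: $\operatorname{detlb}A=\max_k\max_B|\det B|^{1/k}$, where $B$ ranges over all $k\times k$ submatrices of $A$ (any choice of $k$ rows and $k$ columns). For a real $m\times n$ matrix $A$, $\gamma_2(A)=\min\{\|B\|_{2\to\infty}\|C\|_{1\to2}: A=BC\}$, where the minimum is over all factorizations $A=BC$ into real matrices, $\|B\|_{2\to\infty}$ is the largest Euclidean norm of a row of $B$, and $\|C\|_{1\to2}$ is the largest Euclidean norm of a column of $C$.
   Formalization: The upper bound is asserted only for rank r ≥ 2, since for r = 1 it fails (A = [1] gives γ₂ = detlb = 1 but log 1 = 0) and for r = 0 log r is undefined; the lower bound is stated for every matrix. -}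

module Defs where

open import Algebra.Bundles using (CommutativeRing; Semiring)
import Algebra.Definitions.RawSemiring as RawSemiringDefs
import Algebra.Properties.Semiring.Sum as SemiringSum
open import Axiom.ExcludedMiddle using (ExcludedMiddle)
open import Data.Empty using (⊥-elim)
open import Data.Fin.Base as Fin using (Fin; zero; suc; toℕ; punchIn)
open import Data.Nat.Base as ℕ using (ℕ; zero; suc; _!)
open import Data.Product.Base using (Σ; ∃; _×_; _,_; proj₁; proj₂)
open import Data.Sum.Base using (_⊎_; inj₁; inj₂)
open import Level using (0ℓ) renaming (suc to lsuc)
open import Relation.Binary.Core using (Rel)
open import Relation.Binary.Definitions using (tri<; tri≈; tri>)
open import Relation.Binary.Structures using (IsStrictTotalOrder)
open import Relation.Nullary using (¬_; Dec; yes; no)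

-- The real numbers, given (classically: up to unique isomorphism) as a
-- Dedekind-complete ordered field.  A supremum is described positively, by
-- "everything below s is exceeded by a member of S"; together with decidable
-- trichotomy this yields the excluded middle (see `em` below), so the axioms
-- describe the classical reals.
record CompleteOrderedField : Set (lsuc 0ℓ) where
  field
    commutativeRing : CommutativeRing 0ℓ 0ℓ
  open CommutativeRing commutativeRing public renaming (zero to *-zero)
  infix 4 _<_
  infix 8 _⁻¹
  field
    _<_                : Rel Carrier 0ℓ
    isStrictTotalOrder : IsStrictTotalOrder _≈_ _<_
    0<1                : 0# < 1#
    +-monoʳ-<          : ∀ x {y z} → y < z → x + y < x + z
    *-pos              : ∀ {x y} → 0# < x → 0# < y → 0# < x * y
    _⁻¹                : Carrier → Carrier
    -- 0# ⁻¹ is unspecified.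
    *-inverseʳ         : ∀ x → ¬ (x ≈ 0#) → x * x ⁻¹ ≈ 1#

  infix 4 _≤_
  _≤_ : Rel Carrier 0ℓ
  x ≤ y = x < y ⊎ x ≈ y

  UpperBound : (Carrier → Set) → Carrier → Set
  UpperBound S b = ∀ x → S x → x ≤ b

  IsSup : (Carrier → Set) → Carrier → Set
  IsSup S s = UpperBound S s × (∀ y → y < s → ∃ λ x → S x × y < x)

  field
    complete : (S : Carrier → Set) → ∃ S → ∃ (UpperBound S) → ∃ (IsSup S)

module RealMatrices (ℝ : CompleteOrderedField) where

  open CompleteOrderedField ℝ public
  open IsStrictTotalOrder isStrictTotalOrder using (compare; _<?_; <-respˡ-≈; <-respʳ-≈; irrefl)
    renaming (trans to <-trans)
  open SemiringSum semiring public using (sum)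
  open RawSemiringDefs (Semiring.rawSemiring semiring) public using (_^_) renaming (_×_ to _·_)

  fromℕ : ℕ → Carrier
  fromℕ n = n · 1#

  em : ExcludedMiddle 0ℓ
  em {P} = decide (complete S (0# , inj₁ refl) (1# , bound))
    where
    S : Carrier → Set
    S x = x ≈ 0# ⊎ (x ≈ 1# × P)

    bound : UpperBound S 1#
    bound x (inj₁ x≈0)       = inj₁ (<-respˡ-≈ (sym x≈0) 0<1)
    bound x (inj₂ (x≈1 , _)) = inj₂ x≈1

    extract : (∃ λ x → S x × 0# < x) → P
    extract (x , inj₁ x≈0 , 0<x)   = ⊥-elim (irrefl (sym x≈0) 0<x)
    extract (x , inj₂ (_ , p) , _) = p

    positive : ∀ {s} → 1# ≤ s → 0# < s
    positive (inj₁ 1<s) = <-trans 0<1 1<s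
    positive (inj₂ 1≈s) = <-respʳ-≈ 1≈s 0<1

    decide : ∃ (IsSup S) → Dec P
    decide (s , ub , approx) with 0# <? s
    ... | yes 0<s = yes (extract (approx 0# 0<s))
    ... | no  0≮s = no λ p → 0≮s (positive (ub 1# (inj₂ (refl , p))))

  -- Totalised by the value 0 on sets that are empty or unbounded above.
  sup : (Carrier → Set) → Carrier
  sup S with em {∃ S × ∃ (UpperBound S)}
  ... | yes (ne , bd) = proj₁ (complete S ne bd)
  ... | no  _         = 0#

  sup-isSup : ∀ S → ∃ S → ∃ (UpperBound S) → IsSup S (sup S)
  sup-isSup S ne bd with em {∃ S × ∃ (UpperBound S)}
  ... | yes (ne′ , bd′) = proj₂ (complete S ne′ bd′)
  ... | no  ¬p          = ⊥-elim (¬p (ne , bd))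

  -- ⨆ over a finite inhabited I is a maximum; over an empty I it is 0.
  ⨆ : {I : Set} → (I → Carrier) → Carrier
  ⨆ f = sup λ x → ∃ λ i → x ≈ f i

  ⨅ : {I : Set} → (I → Carrier) → Carrier
  ⨅ f = - ⨆ (λ i → - f i)

  ∣_∣ : Carrier → Carrier
  ∣ x ∣ with compare x 0#
  ... | tri< _ _ _ = - x
  ... | tri≈ _ _ _ = x
  ... | tri> _ _ _ = x

  -- The k-th root of a ≥ 0, for k ≥ 1.
  root : ℕ → Carrier → Carrier
  root k a = sup λ y → 0# ≤ y × y ^ k ≤ a

  _⟶_ : (ℕ → Carrier) → Carrier → Set
  s ⟶ l = ∀ ε → 0# < ε → ∃ λ N → ∀ n → N ℕ.≤ n → ∣ s n - l ∣ < ε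

  expPartialSum : Carrier → ℕ → Carrier
  expPartialSum x n = sum {n} λ k → x ^ toℕ k * fromℕ (toℕ k !) ⁻¹

  IsExp : Carrier → Carrier → Set
  IsExp x e = expPartialSum x ⟶ e

  -- The natural logarithm of x > 0: the largest y with exp y ≤ x.
  log : Carrier → Carrier
  log x = sup λ y → ∃ λ e → IsExp y e × e ≤ x

  Vec : ℕ → Set
  Vec n = Fin n → Carrier

  Matrix : ℕ → ℕ → Set
  Matrix m n = Fin m → Fin n → Carrier

  _≋_ : ∀ {m n} → Matrix m n → Matrix m n → Set
  A ≋ B = ∀ i j → A i j ≈ B i j

  _⊗_ : ∀ {m p n} → Matrix m p → Matrix p n → Matrix m n
  (B ⊗ C) i j = sum λ l → B i l * C l j

  column : ∀ {m n} → Matrix m n → Fin n → Vec m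
  column A j i = A i j

  -- Laplace expansion along the first row.
  det : ∀ {n} → Matrix n n → Carrier
  det {zero}  _ = 1#
  det {suc n} A =
    sum λ j → (- 1#) ^ toℕ j * (A zero j * det λ i l → A (suc i) (punchIn j l))

  StrictlyIncreasing : ∀ {k n} → (Fin k → Fin n) → Set
  StrictlyIncreasing f = ∀ i j → i Fin.< j → f i Fin.< f j

  Choice : ℕ → ℕ → Set
  Choice k n = Σ (Fin k → Fin n) StrictlyIncreasing

  submatrix : ∀ {k m n} → Matrix m n → Choice k m → Choice k n → Matrix k k
  submatrix A (f , _) (g , _) i j = A (f i) (g j)

  LinearlyIndependent : ∀ {s m} → (Fin s → Vec m) → Set
  LinearlyIndependent {s} v =
    ∀ (c : Vec s) → (∀ i → sum (λ j → c j * v j i) ≈ 0#) → ∀ j → c j ≈ 0#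

  IndependentColumns : ∀ {m n} → Matrix m n → ℕ → Set
  IndependentColumns {n = n} A s =
    ∃ λ (c : Choice s n) → LinearlyIndependent λ j → column A (proj₁ c j)

  HasRank : ∀ {m n} → Matrix m n → ℕ → Set
  HasRank A r = IndependentColumns A r × (∀ s → IndependentColumns A s → s ℕ.≤ r)

  ‖_‖₂ : ∀ {n} → Vec n → Carrier
  ‖ v ‖₂ = root 2 (sum λ i → v i ^ 2)

  ‖_‖₂→∞ : ∀ {m n} → Matrix m n → Carrier
  ‖ B ‖₂→∞ = ⨆ λ i → ‖ B i ‖₂

  ‖_‖₁→₂ : ∀ {m n} → Matrix m n → Carrier
  ‖ C ‖₁→₂ = ⨆ λ j → ‖ column C j ‖₂

  -- Submatrices have size k = suc k′ ≥ 1.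
  detlb : ∀ {m n} → Matrix m n → Carrier
  detlb {m} {n} A =
    ⨆ {Σ ℕ λ k′ → Choice (suc k′) m × Choice (suc k′) n}
      λ (k′ , rows , cols) → root (suc k′) ∣ det (submatrix A rows cols) ∣

  -- Factorizations through ℝᵖ for every p.
  Factorization : ∀ {m n} → Matrix m n → Set
  Factorization {m} {n} A =
    Σ ℕ λ p → Σ (Matrix m p) λ B → Σ (Matrix p n) λ C → A ≋ (B ⊗ C)

  -- The minimum over all factorizations is attained, so it is the infimum.
  γ₂ : ∀ {m n} → Matrix m n → Carrier
  γ₂ A = ⨅ {Factorization A} λ (_ , B , C , _) → ‖ B ‖₂→∞ * ‖ C ‖₁→₂

{-# OPTIONS --safe #-}
module Submission where

open import Defs
open import Algebra.Solver.Ring.AlmostCommutativeRing using (fromCommutativeRing; _-Raw-AlmostCommutative⟶_)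
open import Data.Empty using (⊥; ⊥-elim)
open import Data.Fin.Base as Fin using (Fin; zero; suc; toℕ; punchIn; splitAt; join; _↑ˡ_; _↑ʳ_)
import Data.Fin.Properties as Finₚ
open import Data.Integer.Base as ℤ using (ℤ; +_; -[1+_])
import Data.Integer.Properties as ℤₚ
open import Data.Maybe.Base as Maybe using (Maybe)
open import Data.Nat.Base as ℕ using (ℕ; zero; suc; _!)
import Data.Nat.Properties as ℕₚ
open import Data.Product.Base using (Σ; ∃; _×_; _,_; proj₁; proj₂)
open import Data.Sum.Base as Sum using (_⊎_; inj₁; inj₂; [_,_]′)
open import Data.Unit.Base using (⊤; tt)
open import Data.Vec.Functional using (_∷_; insertAt; removeAt; head; tail)
open import Data.Vec.Functional.Properties using (insertAt-lookup; insertAt-punchIn; insertAt-removeAt)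
open import Function.Base using (_∘_)
open import Relation.Binary.Bundles using (StrictPartialOrder)
open import Relation.Binary.Definitions using (tri<; tri≈; tri>)
open import Relation.Binary.PropositionalEquality.Core as ≡ using (_≡_; _≗_)
open import Relation.Binary.Structures using (IsStrictTotalOrder)
open import Relation.Nullary using (¬_; Dec; yes; no; ¬?; _×-dec_; decidable-stable)
open import Relation.Nullary.Decidable using (dec⇒maybe)

-- Lower bound.  If A = BC then a k × k submatrix is a product B′C′ of k rows of B and k columns of C, and
-- Cauchy–Binet, Cauchy–Schwarz and Hadamard give det(B′C′)² ≤ det(B′B′ᵀ) det(C′ᵀC′) ≤ ∏‖bᵢ‖² ∏‖cⱼ‖² ≤ (‖B‖‖C‖)²ᵏ.
--
-- Upper bound.  The achievable vectors (‖bᵢ‖² , ‖cⱼ‖²) form a convex set, so by a minimax argument it is enough to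
-- find, for all positive weights p, q, a factorization whose weighted average of these squared norms is at most
-- O(log r) detlb A.  Put M = √p A √q, α = Σp, β = Σq.  On a k-dimensional subspace with orthonormal basis X where
-- ‖Mx‖ ≥ σ‖x‖ one has σ²ᵏ ≤ det((MX)ᵀ(MX)) ≤ Σ (k × k minors of M)² ≤ (detlb A)²ᵏ (αβ)ᵏ / k!², so σ is at most
-- 4 detlb A √(αβ) / k, and σ = 0 for k > r.  Removing successively a direction of each k-dimensional subspace which M
-- (almost) shrinks by that factor writes M as a sum of rank-one matrices of total size at most 4 detlb A √(αβ) H_r,
-- where H_r is the harmonic number, of order log r.
--
-- Sums over k-element subsets are replaced throughout by sums over all functions Fin k → Fin p, which only
-- introduces factors k!.

-- Splitting off directions controls only sums of squared norms, whereas `γ₂` asks for maxima; the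
-- minimax step is the passage from every weighted average to the maximum. Weights enter as square
-- roots because a squared norm is what a weight multiplies. There are no eigenvalues or singular
-- values here. Their role is taken by one determinant inequality: a quadratic form that is at least
-- t times the squared norm has determinant at least t^k, so a small determinant forces a direction
-- in which the form is small. Nothing is shown to be attained: minima are replaced by near-minima,
-- each σ is enlarged by a positive ε (which also makes it positive beyond the rank), and the final
-- bound is proved up to every ε. Constants: k^k ≤ 4^k k! turns k! into k and yields the 4 in 4
-- detlb A √(αβ) / k. A direction with factor σ costs σ in each of the two factors, and 2 √(αβ) ≤ α
-- + β, so the weighted average is at most 4 detlb A · H_r. Finally H_r ≤ 4 log r for r ≥ 2, which
-- gives C = 16. For r = 1 the logarithm is 0, so there the upper bound would fail.

module _ (ℝ : CompleteOrderedField) where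

  open RealMatrices ℝ
  import Algebra.Properties.Ring ring as Ringₚ
  import Algebra.Properties.Semiring.Mult.TCOptimised semiring as Mult
  open Ringₚ using (-0#≈0#)
  import Relation.Binary.Reasoning.Setoid setoid as ≈R

  -- Integer coefficients for the ring solver

  private
    -- With the optimised multiple, `+ 1` denotes `1#` and `+ 2` denotes `1# + 1#` on the nose, so
    -- solver constants match the numerals of the proof definitionally.
    ⟦_⟧ : ℤ → Carrier
    ⟦ + n ⟧      = n Mult.× 1#
    ⟦ -[1+ n ] ⟧ = - (suc n Mult.× 1#)

    ⟦⟧-neg : ∀ i → ⟦ ℤ.- i ⟧ ≈ - ⟦ i ⟧
    ⟦⟧-neg (+ zero)  = sym Ringₚ.-0#≈0#
    ⟦⟧-neg (+ suc n) = refl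
    ⟦⟧-neg -[1+ n ]  = sym (Ringₚ.-‿involutive _)

    cancel-1+ : ∀ x y z → (z + x) - (z + y) ≈ x - y
    cancel-1+ x y z = begin
      (z + x) + - (z + y)      ≈⟨ +-congˡ (Ringₚ.-‿+-comm z y) ⟨
      (z + x) + (- z + - y)    ≈⟨ +-congʳ (+-comm z x) ⟩
      (x + z) + (- z + - y)    ≈⟨ +-assoc x z _ ⟩
      x + (z + (- z + - y))    ≈⟨ +-congˡ (+-assoc z _ _) ⟨
      x + ((z + - z) + - y)    ≈⟨ +-congˡ (+-congʳ (-‿inverseʳ z)) ⟩
      x + (0# + - y)           ≈⟨ +-congˡ (+-identityˡ _) ⟩
      x - y                    ∎
      where open ≈R

    ⟦⟧-⊖ : ∀ m n → ⟦ m ℤ.⊖ n ⟧ ≈ (m Mult.× 1#) - (n Mult.× 1#)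
    ⟦⟧-⊖ m zero          = sym (trans (+-congˡ Ringₚ.-0#≈0#) (+-identityʳ _))
    ⟦⟧-⊖ zero (suc n)    = sym (+-identityˡ _)
    ⟦⟧-⊖ (suc m) (suc n) rewrite ℤₚ.[1+m]⊖[1+n]≡m⊖n m n =
      trans (⟦⟧-⊖ m n) (trans (sym (cancel-1+ _ _ 1#))
        (+-cong (sym (Mult.1+× m 1#)) (-‿cong (sym (Mult.1+× n 1#)))))

    ⟦⟧-+ : ∀ i j → ⟦ i ℤ.+ j ⟧ ≈ ⟦ i ⟧ + ⟦ j ⟧
    ⟦⟧-+ (+ m)    (+ n)    = Mult.×-homo-+ 1# m n
    ⟦⟧-+ (+ m)    -[1+ n ] = ⟦⟧-⊖ m (suc n)
    ⟦⟧-+ -[1+ m ] (+ n)    = trans (⟦⟧-⊖ n (suc m)) (+-comm _ _)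
    ⟦⟧-+ -[1+ m ] -[1+ n ] =
      trans (reflexive (≡.cong (λ k → - (suc k Mult.× 1#)) (≡.sym (ℕₚ.+-suc m n))))
        (trans (-‿cong (Mult.×-homo-+ 1# (suc m) (suc n))) (sym (Ringₚ.-‿+-comm _ _)))

    ⟦⟧-*⁺ : ∀ m j → ⟦ + m ℤ.* j ⟧ ≈ ⟦ + m ⟧ * ⟦ j ⟧
    ⟦⟧-*⁺ m (+ n) rewrite ≡.sym (ℤₚ.pos-* m n) = Mult.×1-homo-* m n
    ⟦⟧-*⁺ m -[1+ n ] rewrite ≡.sym (ℤₚ.neg-distribʳ-* (+ m) (+ suc n)) | ≡.sym (ℤₚ.pos-* m (suc n)) =
      trans (⟦⟧-neg (+ (m ℕ.* suc n))) (trans (-‿cong (Mult.×1-homo-* m (suc n))) (Ringₚ.-‿distribʳ-* _ _))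

    ⟦⟧-* : ∀ i j → ⟦ i ℤ.* j ⟧ ≈ ⟦ i ⟧ * ⟦ j ⟧
    ⟦⟧-* (+ m)    j = ⟦⟧-*⁺ m j
    ⟦⟧-* -[1+ m ] j rewrite ≡.sym (ℤₚ.neg-distribˡ-* (+ suc m) j) =
      trans (⟦⟧-neg (+ suc m ℤ.* j)) (trans (-‿cong (⟦⟧-*⁺ (suc m) j)) (Ringₚ.-‿distribˡ-* _ _))

    ℤ⟶ℝ : ℤ.+-*-rawRing -Raw-AlmostCommutative⟶ fromCommutativeRing commutativeRing
    ℤ⟶ℝ = record
      { ⟦_⟧ = ⟦_⟧ ; +-homo = ⟦⟧-+ ; *-homo = ⟦⟧-* ; -‿homo = ⟦⟧-neg ; 0-homo = refl ; 1-homo = refl }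

    ⟦⟧-≟ : ∀ i j → Maybe (⟦ i ⟧ ≈ ⟦ j ⟧)
    ⟦⟧-≟ i j = Maybe.map (λ e → reflexive (≡.cong ⟦_⟧ e)) (dec⇒maybe (i ℤₚ.≟ j))

  open import Algebra.Solver.Ring ℤ.+-*-rawRing (fromCommutativeRing commutativeRing) ℤ⟶ℝ
    ⟦⟧-≟
    using (solve; _:=_; _:+_; _:*_; _:-_; :-_; _:^_; con; Polynomial)

  :0 :1 :2 : ∀ {n} → Polynomial n
  :0 = con (+ 0)
  :1 = con (+ 1)
  :2 = con (+ 2)

  open IsStrictTotalOrder isStrictTotalOrder
    using (compare; <-respˡ-≈; <-respʳ-≈; irrefl; isStrictPartialOrder)
    renaming (trans to <-trans; asym to <-asym; _≟_ to _≈?_)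
  open import Algebra.Properties.Semiring.Sum semiring
    using (∑-distrib-+; ∑-comm; *-distribˡ-sum; *-distribʳ-sum)
    renaming (sum-cong-≋ to sum-cong)
  open import Algebra.Properties.Semiring.Exp semiring using (^-congˡ)
  open import Algebra.Properties.CommutativeSemiring.Exp commutativeSemiring using (^-distrib-*)
  open import Algebra.Properties.Semiring.Mult semiring using (×-homo-+; ×1-homo-*)

  -- Arithmetic in an ordered field

  strictPartialOrder : StrictPartialOrder _ _ _
  strictPartialOrder = record { isStrictPartialOrder = isStrictPartialOrder }

  import Relation.Binary.Reasoning.StrictPartialOrder strictPartialOrder as ≤R

  ≤-refl : ∀ {x} → x ≤ x
  ≤-refl = inj₂ refl

  ≤-reflexive : ∀ {x y} → x ≈ y → x ≤ y
  ≤-reflexive = inj₂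

  <⇒≤ : ∀ {x y} → x < y → x ≤ y
  <⇒≤ = inj₁

  ≤-trans : ∀ {x y z} → x ≤ y → y ≤ z → x ≤ z
  ≤-trans {x} {y} {z} p q = begin x ≤⟨ p ⟩ y ≤⟨ q ⟩ z ∎ where open ≤R

  <-≤-trans : ∀ {x y z} → x < y → y ≤ z → x < z
  <-≤-trans {x} {y} {z} p q = begin-strict x <⟨ p ⟩ y ≤⟨ q ⟩ z ∎ where open ≤R

  ≤-<-trans : ∀ {x y z} → x ≤ y → y < z → x < z
  ≤-<-trans {x} {y} {z} p q = begin-strict x ≤⟨ p ⟩ y <⟨ q ⟩ z ∎ where open ≤R

  ≤-respˡ-≈ : ∀ {x y z} → x ≈ y → x ≤ z → y ≤ z
  ≤-respˡ-≈ e p = ≤-trans (inj₂ (sym e)) p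

  ≤-respʳ-≈ : ∀ {x y z} → x ≈ y → z ≤ x → z ≤ y
  ≤-respʳ-≈ e p = ≤-trans p (inj₂ e)

  ≤⇒≯ : ∀ {x y} → x ≤ y → ¬ (y < x)
  ≤⇒≯ p q = irrefl refl (≤-<-trans p q)

  ≮⇒≥ : ∀ {x y} → ¬ (x < y) → y ≤ x
  ≮⇒≥ {x} {y} ¬p with compare x y
  ... | tri< p _ _ = ⊥-elim (¬p p)
  ... | tri≈ _ e _ = inj₂ (sym e)
  ... | tri> _ _ q = inj₁ q

  ≤-antisym : ∀ {x y} → x ≤ y → y ≤ x → x ≈ y
  ≤-antisym (inj₂ e) q = e
  ≤-antisym (inj₁ p) q = ⊥-elim (≤⇒≯ q p)

  ≤-total : ∀ x y → x ≤ y ⊎ y ≤ x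
  ≤-total x y with compare x y
  ... | tri< p _ _ = inj₁ (inj₁ p)
  ... | tri≈ _ e _ = inj₁ (inj₂ e)
  ... | tri> _ _ q = inj₂ (inj₁ q)

  <-by : ∀ {x y d} → y - x ≈ d → 0# < d → x < y
  <-by {x} {y} {d} e p = <-respˡ-≈ (+-identityʳ x)
    (<-respʳ-≈ (solve 2 (λ x y → x :+ (y :- x) := y) refl x y)
      (+-monoʳ-< x (<-respʳ-≈ (sym e) p)))

  ≤-by : ∀ {x y d} → y - x ≈ d → 0# ≤ d → x ≤ y
  ≤-by e (inj₁ p) = inj₁ (<-by e p)
  ≤-by {x} {y} {d} e (inj₂ p) = inj₂ (sym (Ringₚ.x∙y⁻¹≈ε⇒x≈y y x (trans e (sym p))))

  0<y-x : ∀ {x y} → x < y → 0# < y - x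
  0<y-x {x} {y} p = <-respˡ-≈ (-‿inverseˡ x) (<-respʳ-≈ (+-comm (- x) y) (+-monoʳ-< (- x) p))

  0≤y-x : ∀ {x y} → x ≤ y → 0# ≤ y - x
  0≤y-x (inj₁ p) = inj₁ (0<y-x p)
  0≤y-x {x} {y} (inj₂ e) = inj₂ (sym (trans (+-congʳ (sym e)) (-‿inverseʳ x)))

  +-mono-<-≤ : ∀ {x y u v} → x < y → u ≤ v → x + u < y + v
  +-mono-<-≤ {x} {y} {u} {v} p q = <-≤-trans
    (<-by (solve 3 (λ x y u → (y :+ u) :- (x :+ u) := y :- x) refl x y u) (0<y-x p))
    (≤-by (solve 3 (λ y u v → (y :+ v) :- (y :+ u) := v :- u) refl y u v) (0≤y-x q))

  +-mono-≤ : ∀ {x y u v} → x ≤ y → u ≤ v → x + u ≤ y + v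
  +-mono-≤ {x} {y} {u} {v} (inj₁ p) q = inj₁ (+-mono-<-≤ p q)
  +-mono-≤ {x} {y} {u} {v} (inj₂ e) q = ≤-respˡ-≈ (+-congʳ (sym e))
    (≤-by (solve 3 (λ y u v → (y :+ v) :- (y :+ u) := v :- u) refl y u v) (0≤y-x q))

  +-nonneg : ∀ {x y} → 0# ≤ x → 0# ≤ y → 0# ≤ x + y
  +-nonneg p q = ≤-respˡ-≈ (+-identityˡ 0#) (+-mono-≤ p q)

  +-pos-nonneg : ∀ {x y} → 0# < x → 0# ≤ y → 0# < x + y
  +-pos-nonneg p q = <-respˡ-≈ (+-identityˡ 0#) (+-mono-<-≤ p q)

  +-pos : ∀ {x y} → 0# < x → 0# < y → 0# < x + y
  +-pos p q = +-pos-nonneg p (inj₁ q)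

  x≤x+y : ∀ {x y} → 0# ≤ y → x ≤ x + y
  x≤x+y {x} {y} p = ≤-by (solve 2 (λ x y → (x :+ y) :- x := y) refl x y) p

  y≤x+y : ∀ {x y} → 0# ≤ x → y ≤ x + y
  y≤x+y {x} {y} p = ≤-by (solve 2 (λ x y → (x :+ y) :- y := x) refl x y) p

  *-nonneg : ∀ {x y} → 0# ≤ x → 0# ≤ y → 0# ≤ x * y
  *-nonneg (inj₁ p) (inj₁ q) = inj₁ (*-pos p q)
  *-nonneg {x} {y} (inj₂ e) q = inj₂ (trans (sym (zeroˡ y)) (*-congʳ e))
  *-nonneg {x} {y} (inj₁ p) (inj₂ e) = inj₂ (trans (sym (zeroʳ x)) (*-congˡ e))

  neg-pos : ∀ {x} → x < 0# → 0# < - x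
  neg-pos {x} p = <-respʳ-≈ (+-identityˡ _) (0<y-x p)

  neg-mono-≤ : ∀ {x y} → x ≤ y → - y ≤ - x
  neg-mono-≤ {x} {y} p = ≤-by (solve 2 (λ x y → :- x :- :- y := y :- x) refl x y) (0≤y-x p)

  x≉0⇒0<x² : ∀ {x} → ¬ (x ≈ 0#) → 0# < x * x
  x≉0⇒0<x² {x} n with compare x 0#
  ... | tri< p _ _ = <-respʳ-≈ (solve 1 (λ x → :- x :* :- x := x :* x) refl x) (*-pos (neg-pos p) (neg-pos p))
  ... | tri≈ _ e _ = ⊥-elim (n e)
  ... | tri> _ _ p = *-pos p p

  0≤x² : ∀ x → 0# ≤ x * x
  0≤x² x with x ≈? 0#
  ... | yes e = inj₂ (sym (trans (*-congʳ e) (zeroˡ x)))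
  ... | no n  = inj₁ (x≉0⇒0<x² n)

  x²≤0⇒x≈0 : ∀ {x} → x * x ≤ 0# → x ≈ 0#
  x²≤0⇒x≈0 {x} p with x ≈? 0#
  ... | yes e = e
  ... | no n  = ⊥-elim (≤⇒≯ p (x≉0⇒0<x² n))

  0<x⇒x≉0 : ∀ {x} → 0# < x → ¬ (x ≈ 0#)
  0<x⇒x≉0 p e = irrefl (sym e) p

  0≤1 : 0# ≤ 1#
  0≤1 = inj₁ 0<1

  2# : Carrier
  2# = 1# + 1#

  0<2 : 0# < 2#
  0<2 = +-pos 0<1 0<1

  *-monoˡ-≤ : ∀ {c x y} → 0# ≤ c → x ≤ y → c * x ≤ c * y
  *-monoˡ-≤ {c} {x} {y} p q =
    ≤-by (solve 3 (λ c x y → c :* y :- c :* x := c :* (y :- x)) refl c x y) (*-nonneg p (0≤y-x q))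

  *-monoʳ-≤ : ∀ {c x y} → 0# ≤ c → x ≤ y → x * c ≤ y * c
  *-monoʳ-≤ {c} {x} {y} p q = ≤-respˡ-≈ (*-comm c x) (≤-respʳ-≈ (*-comm c y) (*-monoˡ-≤ p q))

  *-monoˡ-< : ∀ {c x y} → 0# < c → x < y → c * x < c * y
  *-monoˡ-< {c} {x} {y} p q =
    <-by (solve 3 (λ c x y → c :* y :- c :* x := c :* (y :- x)) refl c x y) (*-pos p (0<y-x q))

  *-mono-≤ : ∀ {x y u v} → 0# ≤ x → x ≤ y → 0# ≤ u → u ≤ v → x * u ≤ y * v
  *-mono-≤ p q r s = ≤-trans (*-monoˡ-≤ p s) (*-monoʳ-≤ (≤-trans r s) q)

  *-cancelˡ-≤ : ∀ {c x y} → 0# < c → c * x ≤ c * y → x ≤ y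
  *-cancelˡ-≤ p q = ≮⇒≥ λ r → ≤⇒≯ q (*-monoˡ-< p r)

  *-inverse : ∀ {x} → 0# < x → x * x ⁻¹ ≈ 1#
  *-inverse p = *-inverseʳ _ (0<x⇒x≉0 p)

  ⁻¹-pos : ∀ {x} → 0# < x → 0# < x ⁻¹
  ⁻¹-pos {x} p with compare (x ⁻¹) 0#
  ... | tri> _ _ q = q
  ... | tri≈ _ e _ = ⊥-elim (irrefl (trans (sym (zeroʳ x)) (trans (*-congˡ (sym e)) (*-inverse p))) 0<1)
  ... | tri< q _ _ = ⊥-elim (<-asym 0<1 (<-by
    (trans (solve 1 (λ u → :0 :- u := :- u) refl 1#)
      (trans (-‿cong (sym (*-inverse p))) (Ringₚ.-‿distribʳ-* _ _))) (*-pos p (neg-pos q))))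

  x*y*x⁻¹≈y : ∀ {x} y → 0# < x → x * (y * x ⁻¹) ≈ y
  x*y*x⁻¹≈y {x} y p = trans (solve 3 (λ x y z → x :* (y :* z) := y :* (x :* z)) refl x y (x ⁻¹))
    (trans (*-congˡ (*-inverse p)) (*-identityʳ y))

  *-cancelˡ : ∀ {c x y} → 0# < c → c * x ≈ c * y → x ≈ y
  *-cancelˡ p e = ≤-antisym (*-cancelˡ-≤ p (inj₂ e)) (*-cancelˡ-≤ p (inj₂ (sym e)))

  x²≤y²⇒x≤y : ∀ {x y} → 0# ≤ y → x * x ≤ y * y → x ≤ y
  x²≤y²⇒x≤y {x} {y} p q = ≮⇒≥ λ r → ≤⇒≯ q (<-by
    (solve 2 (λ x y → x :* x :- y :* y := (x :- y) :* (x :- y :+ :2 :* y)) refl x y)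
    (*-pos (0<y-x r) (+-pos-nonneg (0<y-x r) (*-nonneg (<⇒≤ 0<2) p))))

  ^-nonneg : ∀ {x} k → 0# ≤ x → 0# ≤ x ^ k
  ^-nonneg zero    p = 0≤1
  ^-nonneg (suc k) p = *-nonneg p (^-nonneg k p)

  ^-pos : ∀ {x} k → 0# < x → 0# < x ^ k
  ^-pos zero    p = 0<1
  ^-pos (suc k) p = *-pos p (^-pos k p)

  ^-mono-≤ : ∀ {x y} k → 0# ≤ x → x ≤ y → x ^ k ≤ y ^ k
  ^-mono-≤ zero    p q = ≤-refl
  ^-mono-≤ (suc k) p q = *-mono-≤ p q (^-nonneg k p) (^-mono-≤ k p q)

  ^-mono-< : ∀ {x y} k → 0# ≤ x → x < y → x ^ suc k < y ^ suc k
  ^-mono-< {x} {y} k p q = ≤-<-trans (*-monoˡ-≤ p (^-mono-≤ k p (<⇒≤ q)))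
    (<-by (solve 3 (λ x y z → y :* z :- x :* z := z :* (y :- x)) refl x y (y ^ k))
      (*-pos (^-pos k (≤-<-trans p q)) (0<y-x q)))

  ^-cancel-≤ : ∀ {x y} k → 0# ≤ y → x ^ suc k ≤ y ^ suc k → x ≤ y
  ^-cancel-≤ k p q = ≮⇒≥ λ r → ≤⇒≯ q (^-mono-< k p r)

  0^suc : ∀ k → 0# ^ suc k ≈ 0#
  0^suc k = zeroˡ _

  1^ : ∀ k → 1# ^ k ≈ 1#
  1^ zero    = refl
  1^ (suc k) = trans (*-identityˡ _) (1^ k)

  ^2≈* : ∀ x → x ^ 2 ≈ x * x
  ^2≈* x = *-congˡ (*-identityʳ x)

  fromℕ-nonneg : ∀ n → 0# ≤ fromℕ n
  fromℕ-nonneg zero    = ≤-refl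
  fromℕ-nonneg (suc n) = +-nonneg 0≤1 (fromℕ-nonneg n)

  fromℕ-pos : ∀ n → 0# < fromℕ (suc n)
  fromℕ-pos n = +-pos-nonneg 0<1 (fromℕ-nonneg n)

  fromℕ-+ : ∀ m n → fromℕ (m ℕ.+ n) ≈ fromℕ m + fromℕ n
  fromℕ-+ = ×-homo-+ 1#

  fromℕ-* : ∀ m n → fromℕ (m ℕ.* n) ≈ fromℕ m * fromℕ n
  fromℕ-* = ×1-homo-*

  fromℕ-^ : ∀ m n → fromℕ (m ℕ.^ n) ≈ fromℕ m ^ n
  fromℕ-^ m zero    = +-identityʳ 1#
  fromℕ-^ m (suc n) = trans (fromℕ-* m (m ℕ.^ n)) (*-congˡ (fromℕ-^ m n))

  fromℕ-mono-≤ : ∀ {m n} → m ℕ.≤ n → fromℕ m ≤ fromℕ n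
  fromℕ-mono-≤ {n = n} ℕ.z≤n = fromℕ-nonneg n
  fromℕ-mono-≤ (ℕ.s≤s p) = +-mono-≤ ≤-refl (fromℕ-mono-≤ p)

  fromℕ!-pos : ∀ k → 0# < fromℕ (k ℕ.!)
  fromℕ!-pos zero    = fromℕ-pos 0
  fromℕ!-pos (suc k) = <-respʳ-≈ (sym (fromℕ-* (suc k) (k ℕ.!))) (*-pos (fromℕ-pos k) (fromℕ!-pos k))

  ≤-by-ε : ∀ {x y} → (∀ ε → 0# < ε → x ≤ y + ε) → x ≤ y
  ≤-by-ε {x} {y} h = ≮⇒≥ λ p → ≤⇒≯
    (≤-respʳ-≈ refl (h ((x - y) * 2# ⁻¹) (*-pos (0<y-x p) (⁻¹-pos 0<2))))
    (<-by (begin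
        x - (y + (x - y) * h⁻¹)
          ≈⟨ solve 3 (λ x y h → x :- (y :+ (x :- y) :* h) := (x :- y) :* (:1 :- h)) refl x y h⁻¹ ⟩
        (x - y) * (1# - h⁻¹)
          ≈⟨ *-congˡ (+-congʳ (*-inverse 0<2)) ⟨
        (x - y) * (2# * h⁻¹ - h⁻¹)
          ≈⟨ *-congˡ (solve 1 (λ h → :2 :* h :- h := h) refl h⁻¹) ⟩
        (x - y) * h⁻¹ ∎)
      (*-pos (0<y-x p) (⁻¹-pos 0<2)))
    where
    open ≈R
    h⁻¹ = 2# ⁻¹

  -- Finite sums

  sum-zero : ∀ {n} {f : Fin n → Carrier} → (∀ i → f i ≈ 0#) → sum f ≈ 0#
  sum-zero {zero}  h = refl
  sum-zero {suc n} h = trans (+-cong (h zero) (sum-zero (h ∘ suc))) (+-identityˡ 0#)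

  sum-nonneg : ∀ {n} {f : Fin n → Carrier} → (∀ i → 0# ≤ f i) → 0# ≤ sum f
  sum-nonneg {zero}  h = ≤-refl
  sum-nonneg {suc n} h = +-nonneg (h zero) (sum-nonneg (h ∘ suc))

  sum-mono-≤ : ∀ {n} {f g : Fin n → Carrier} → (∀ i → f i ≤ g i) → sum f ≤ sum g
  sum-mono-≤ {zero}  h = ≤-refl
  sum-mono-≤ {suc n} h = +-mono-≤ (h zero) (sum-mono-≤ (h ∘ suc))

  term≤sum : ∀ {n} {f : Fin n → Carrier} → (∀ i → 0# ≤ f i) → ∀ i → f i ≤ sum f
  term≤sum h zero    = x≤x+y (sum-nonneg (h ∘ suc))
  term≤sum h (suc i) = ≤-trans (term≤sum (h ∘ suc) i) (y≤x+y (h zero))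

  sum-const : ∀ n x → sum {n} (λ _ → x) ≈ fromℕ n * x
  sum-const zero    x = sym (zeroˡ x)
  sum-const (suc n) x = trans (+-congˡ (sum-const n x))
    (solve 2 (λ x n → x :+ n :* x := (:1 :+ n) :* x) refl x (fromℕ n))

  sum-++ : ∀ m {n} (f : Fin m → Carrier) (g : Fin n → Carrier) →
    sum (λ i → [ f , g ]′ (splitAt m i)) ≈ sum f + sum g
  sum-++ zero    f g = sym (+-identityˡ _)
  sum-++ (suc m) f g = trans (+-congˡ (trans (sum-cong shift) (sum-++ m (f ∘ suc) g))) (sym (+-assoc _ _ _))
    where
    shift : ∀ i → [ f , g ]′ (splitAt (suc m) (suc i)) ≈ [ f ∘ suc , g ]′ (splitAt m i)
    shift i with splitAt m i
    ... | inj₁ _ = refl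
    ... | inj₂ _ = refl

  -- Suprema and infima

  IsSup-least : ∀ {S s z} → IsSup S s → UpperBound S z → s ≤ z
  IsSup-least (_ , approx) ub = ≮⇒≥ λ z<s →
    let (x , Sx , z<x) = approx _ z<s in ≤⇒≯ (ub x Sx) z<x

  -- The bound b certifies that the family is bounded above; on an unbounded family `sup` would take
  -- its default value 0.
  ⨆-upper : ∀ {I : Set} {f : I → Carrier} {b} → (∀ i → f i ≤ b) → ∀ i → f i ≤ ⨆ f
  ⨆-upper {f = f} h i =
    proj₁ (sup-isSup _ (f i , i , refl) (_ , λ { x (j , e) → ≤-respˡ-≈ (sym e) (h j) })) (f i) (i , refl)

  ⨆-least : ∀ {I : Set} {f : I → Carrier} {b} → I → (∀ i → f i ≤ b) → ⨆ f ≤ b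
  ⨆-least {f = f} i h = IsSup-least (sup-isSup _ (f i , i , refl) (_ , ub)) ub
    where
    ub : UpperBound (λ x → ∃ λ j → x ≈ f j) _
    ub x (j , e) = ≤-respˡ-≈ (sym e) (h j)

  ⨆-empty : ∀ {I : Set} {f : I → Carrier} → ¬ I → ⨆ f ≈ 0#
  ⨆-empty {I} {f} ¬i with em {(∃ λ x → ∃ λ i → x ≈ f i) × ∃ (UpperBound (λ x → ∃ λ i → x ≈ f i))}
  ... | yes ((_ , i , _) , _) = ⊥-elim (¬i i)
  ... | no  _                 = refl

  -- An empty family has supremum 0 by the default of `sup`, whence 0 ≤ b. This covers matrices
  -- without rows or columns.
  ⨆-least-nonneg : ∀ {I : Set} {f : I → Carrier} {b} → 0# ≤ b → (∀ i → f i ≤ b) → ⨆ f ≤ b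
  ⨆-least-nonneg {I} 0≤b h with em {I}
  ... | yes i = ⨆-least i h
  ... | no ¬i = ≤-respˡ-≈ (sym (⨆-empty ¬i)) 0≤b

  ⨆-nonneg : ∀ {I : Set} {f : I → Carrier} {b} → (∀ i → 0# ≤ f i) → (∀ i → f i ≤ b) → 0# ≤ ⨆ f
  ⨆-nonneg {I} 0≤f h with em {I}
  ... | yes i = ≤-trans (0≤f i) (⨆-upper h i)
  ... | no ¬i = ≤-reflexive (sym (⨆-empty ¬i))

  ⨅-lower : ∀ {I : Set} {f : I → Carrier} {b} → (∀ i → b ≤ f i) → ∀ i → ⨅ f ≤ f i
  ⨅-lower {f = f} h i = ≤-respʳ-≈ (Ringₚ.-‿involutive (f i)) (neg-mono-≤ (⨆-upper (neg-mono-≤ ∘ h) i))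

  ⨅-greatest : ∀ {I : Set} {f : I → Carrier} {b} → I → (∀ i → b ≤ f i) → b ≤ ⨅ f
  ⨅-greatest {b = b} i h = ≤-respˡ-≈ (Ringₚ.-‿involutive b) (neg-mono-≤ (⨆-least i (neg-mono-≤ ∘ h)))

  -- Roots and absolute values

  private
    -- Continuity of powers from the right, with an explicit constant: in (s + h)(s^k + hL) the
    -- quadratic term h²L is absorbed into the next constant because h ≤ 1.
    ^-lipschitz : ∀ {s} k → 0# ≤ s →
      ∃ λ L → 0# ≤ L × (∀ h → 0# ≤ h → h ≤ 1# → (s + h) ^ k ≤ s ^ k + h * L)
    ^-lipschitz zero p = 0# , ≤-refl , λ h _ _ → x≤x+y (≤-reflexive (sym (zeroʳ h)))
    ^-lipschitz {s} (suc k) p with ^-lipschitz k p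
    ... | L , 0≤L , H = s * L + s ^ k + L , +-nonneg (+-nonneg (*-nonneg p 0≤L) (^-nonneg k p)) 0≤L ,
      λ h 0≤h h≤1 → begin
        (s + h) * (s + h) ^ k            ≤⟨ *-monoˡ-≤ (+-nonneg p 0≤h) (H h 0≤h h≤1) ⟩
        (s + h) * (s ^ k + h * L)        ≈⟨ solve 4 (λ s h z L → (s :+ h) :* (z :+ h :* L) :=
                                              s :* z :+ h :* (s :* L :+ z :+ h :* L)) refl s h (s ^ k) L ⟩
        s * s ^ k + h * (s * L + s ^ k + h * L) ≤⟨ +-mono-≤ ≤-refl (*-monoˡ-≤ 0≤h (+-mono-≤ ≤-refl
                                              (≤-respʳ-≈ (*-identityˡ L) (*-monoʳ-≤ 0≤L h≤1)))) ⟩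
        s * s ^ k + h * (s * L + s ^ k + L) ∎
      where open ≤R

    root-isSup : ∀ k {a} → 0# ≤ a → IsSup (λ y → 0# ≤ y × y ^ suc k ≤ a) (root (suc k) a)
    root-isSup k {a} p = sup-isSup _ (0# , ≤-refl , ≤-respˡ-≈ (sym (0^suc k)) p) (1# + a , ub)
      where
      ub : UpperBound (λ y → 0# ≤ y × y ^ suc k ≤ a) (1# + a)
      ub y (0≤y , q) = ^-cancel-≤ k (+-nonneg 0≤1 p) (≤-trans q (begin
        a                            ≤⟨ y≤x+y 0≤1 ⟩
        1# + a                       ≈⟨ *-identityʳ _ ⟨
        (1# + a) * 1#                ≈⟨ *-congˡ (1^ k) ⟨
        (1# + a) * 1# ^ k            ≤⟨ *-monoˡ-≤ (+-nonneg 0≤1 p) (^-mono-≤ k 0≤1 (x≤x+y p)) ⟩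
        (1# + a) * (1# + a) ^ k      ∎))
        where open ≤R

  root-nonneg : ∀ k {a} → 0# ≤ a → 0# ≤ root (suc k) a
  root-nonneg k p = proj₁ (root-isSup k p) 0# (≤-refl , ≤-respˡ-≈ (sym (0^suc k)) p)

  root-least : ∀ k {a z} → 0# ≤ a → 0# ≤ z → a ≤ z ^ suc k → root (suc k) a ≤ z
  root-least k p q r = IsSup-least (root-isSup k p) λ { y (_ , s) → ^-cancel-≤ k q (≤-trans s r) }

  -- The single choice h = d / (d + L) meets both upper bounds. It supplies the small step sizes and
  -- perturbations used later.
  small-multiplier : ∀ {d L} → 0# < d → 0# ≤ L → ∃ λ h → 0# < h × h ≤ 1# × h * L ≤ d
  small-multiplier {d} {L} p q = d * (d + L) ⁻¹ , *-pos p (⁻¹-pos dL) ,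
    *-cancelˡ-≤ dL (begin
      (d + L) * (d * (d + L) ⁻¹) ≈⟨ x*y*x⁻¹≈y d dL ⟩
      d                          ≤⟨ x≤x+y q ⟩
      d + L                      ≈⟨ *-identityʳ _ ⟨
      (d + L) * 1#               ∎) ,
    *-cancelˡ-≤ dL (begin
      (d + L) * (d * (d + L) ⁻¹ * L)   ≈⟨ *-assoc _ _ _ ⟨
      (d + L) * (d * (d + L) ⁻¹) * L   ≈⟨ *-congʳ (x*y*x⁻¹≈y d dL) ⟩
      d * L                            ≤⟨ *-monoˡ-≤ (<⇒≤ p) (y≤x+y (<⇒≤ p)) ⟩
      d * (d + L)                      ≈⟨ *-comm _ _ ⟩
      (d + L) * d                      ∎)
    where
    open ≤R
    dL = +-pos-nonneg p q

  -- If s = `root (suc k) a` had s^(k+1) < a, then s + h for some small h > 0 would still belong to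
  -- the set of which s is the supremum.
  a≤root^ : ∀ k {a} → 0# ≤ a → a ≤ root (suc k) a ^ suc k
  a≤root^ k {a} p = ≮⇒≥ λ r →
    let s = root (suc k) a
        (L , 0≤L , H) = ^-lipschitz (suc k) (root-nonneg k p)
        (h , 0<h , h≤1 , hL) = small-multiplier (0<y-x r) 0≤L
        s+h≤s = proj₁ (root-isSup k p) (s + h)
          ( +-nonneg (root-nonneg k p) (<⇒≤ 0<h)
          , ≤-trans (H h (<⇒≤ 0<h) h≤1) (≤-respʳ-≈
              (solve 2 (λ a z → z :+ (a :- z) := a) refl a (s ^ suc k)) (+-mono-≤ ≤-refl hL)))
    in ≤⇒≯ s+h≤s (<-by (solve 2 (λ s h → (s :+ h) :- s := h) refl s h) 0<h)

  -- If s² exceeds a, one Newton step below s still has square at least a.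
  sqrt-exists : ∀ {a} → 0# < a → ∃ λ s → 0# < s × s * s ≈ a
  sqrt-exists {a} 0<a = s , 0<s , ≤-antisym (≮⇒≥ newton) a≤s²
    where
    p = <⇒≤ 0<a
    s = root 2 a
    0≤s = root-nonneg 1 p
    a≤s² = ≤-respʳ-≈ (^2≈* s) (a≤root^ 1 p)
    0<s : 0# < s
    0<s with 0≤s
    ... | inj₁ q = q
    ... | inj₂ e = ⊥-elim (≤⇒≯ a≤s² (<-respˡ-≈ (trans (sym (zeroˡ s)) (*-congʳ e)) 0<a))
    newton : ¬ (a < s * s)
    newton a<s² = ≤⇒≯ (root-least 1 p 0≤y a≤y²) y<s
      where
      d = s * s - a
      0<2s = *-pos 0<2 0<s
      e = d * (2# * s) ⁻¹
      2se : 2# * s * e ≈ d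
      2se = x*y*x⁻¹≈y d 0<2s
      y = s - e
      0<e = *-pos (0<y-x a<s²) (⁻¹-pos 0<2s)
      y<s : y < s
      y<s = <-by (solve 2 (λ s e → s :- (s :- e) := e) refl s e) 0<e
      0≤y : 0# ≤ y
      0≤y = *-cancelˡ-≤ 0<2s (≤-by (trans
        (solve 2 (λ s e → :2 :* s :* (s :- e) :- :2 :* s :* :0 := :2 :* (s :* s) :- :2 :* s :* e) refl s e)
        (trans (+-congˡ (-‿cong 2se)) (solve 2 (λ s a → :2 :* (s :* s) :- (s :* s :- a) := s :* s :+ a) refl s a)))
        (+-nonneg (0≤x² s) p))
      a≤y² : a ≤ y ^ 2
      a≤y² = ≤-by (trans
        (solve 3 (λ s e a → (s :- e) :^ 2 :- a := (s :* s :- a) :- :2 :* s :* e :+ e :* e) refl s e a)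
        (trans (+-congʳ (trans (+-congˡ (-‿cong 2se)) (-‿inverseʳ d))) (+-identityˡ _))) (0≤x² e)

  ∣∣-nonneg : ∀ x → 0# ≤ ∣ x ∣
  ∣∣-nonneg x with compare x 0#
  ... | tri< p _ _ = <⇒≤ (neg-pos p)
  ... | tri≈ _ e _ = inj₂ (sym e)
  ... | tri> _ _ p = <⇒≤ p

  ∣∣² : ∀ x → ∣ x ∣ * ∣ x ∣ ≈ x * x
  ∣∣² x with compare x 0#
  ... | tri< _ _ _ = solve 1 (λ x → :- x :* :- x := x :* x) refl x
  ... | tri≈ _ _ _ = refl
  ... | tri> _ _ _ = refl

  x≤∣x∣ : ∀ x → x ≤ ∣ x ∣
  x≤∣x∣ x = x²≤y²⇒x≤y (∣∣-nonneg x) (≤-reflexive (sym (∣∣² x)))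

  ∣x∣<ε : ∀ {x ε} → x < ε → - x < ε → ∣ x ∣ < ε
  ∣x∣<ε {x} p q with compare x 0#
  ... | tri< _ _ _ = q
  ... | tri≈ _ _ _ = p
  ... | tri> _ _ _ = p

  -- For X > 0 the quadratic is evaluated at its minimiser t = S / X. For X = 0 it is affine in t,
  -- and if S were not 0, t = (Y + 1) / S would make it negative.
  discriminant : ∀ {X S Y} → 0# ≤ X → (∀ t → 0# ≤ Y - 2# * t * S + t * t * X) → S * S ≤ X * Y
  discriminant {X} {S} {Y} (inj₁ 0<X) h = ≤-by (begin
      X * Y - S * S
        ≈⟨ solve 3 (λ X S Y → X :* Y :- S :* S := X :* Y :- :2 :* S :* S :+ S :* S) refl X S Y ⟩
      X * Y - 2# * S * S + S * S
        ≈⟨ +-cong (+-congˡ (-‿cong (*-congʳ (*-congˡ Xt)))) (*-cong Xt Xt) ⟨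
      X * Y - 2# * (X * t) * S + X * t * (X * t)
        ≈⟨ solve 4 (λ X S Y t → X :* Y :- :2 :* (X :* t) :* S :+ X :* t :* (X :* t)
             := X :* (Y :- :2 :* t :* S :+ t :* t :* X)) refl X S Y t ⟩
      X * (Y - 2# * t * S + t * t * X) ∎) (*-nonneg (<⇒≤ 0<X) (h t))
    where
    open ≈R
    t = S * X ⁻¹
    Xt : X * t ≈ S
    Xt = x*y*x⁻¹≈y S 0<X
  discriminant {X} {S} {Y} (inj₂ 0≈X) h with S ≈? 0#
  ... | yes e = ≤-reflexive (trans (*-congʳ e) (trans (zeroˡ S) (trans (sym (zeroˡ Y)) (*-congʳ 0≈X))))
  ... | no n = ⊥-elim (≤⇒≯ (h t) (<-by (begin
      0# - (Y - 2# * t * S + t * t * X)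
        ≈⟨ +-congˡ (-‿cong (+-congˡ (*-congˡ (sym 0≈X)))) ⟩
      0# - (Y - 2# * t * S + t * t * 0#)
        ≈⟨ solve 3 (λ Y t S → :0 :- (Y :- :2 :* t :* S :+ t :* t :* :0) := :2 :* (S :* t) :- Y) refl Y t S ⟩
      2# * (S * t) - Y
        ≈⟨ +-congʳ (*-congˡ St) ⟩
      2# * (Y + 1#) - Y
        ≈⟨ solve 1 (λ Y → :2 :* (Y :+ :1) :- Y := :2 :+ Y) refl Y ⟩
      2# + Y ∎) (+-pos-nonneg 0<2 0≤Y)))
    where
    open ≈R
    t = (Y + 1#) * S ⁻¹
    St : S * t ≈ Y + 1#
    St = trans (solve 3 (λ x y z → x :* (y :* z) := y :* (x :* z)) refl S (Y + 1#) (S ⁻¹))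
      (trans (*-congˡ (*-inverseʳ S n)) (*-identityʳ _))
    0≤Y : 0# ≤ Y
    0≤Y = ≤-respʳ-≈ (solve 3 (λ Y S X → Y :- :2 :* :0 :* S :+ :0 :* :0 :* X := Y) refl Y S X) (h 0#)

  -- Signs and products

  sign : ℕ → Carrier
  sign k = (- 1#) ^ k

  sign² : ∀ k → sign k * sign k ≈ 1#
  sign² zero    = *-identityˡ 1#
  sign² (suc k) = trans (solve 1 (λ s → (:- :1 :* s) :* (:- :1 :* s) := s :* s) refl (sign k)) (sign² k)

  product : ∀ {n} → (Fin n → Carrier) → Carrier
  product {zero}  f = 1#
  product {suc n} f = f zero * product (f ∘ suc)

  product-cong : ∀ {n} {f g : Fin n → Carrier} → (∀ i → f i ≈ g i) → product f ≈ product g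
  product-cong {zero}  h = refl
  product-cong {suc n} h = *-cong (h zero) (product-cong (h ∘ suc))

  product-zero : ∀ {n} {f : Fin n → Carrier} i → f i ≈ 0# → product f ≈ 0#
  product-zero zero    e = trans (*-congʳ e) (zeroˡ _)
  product-zero (suc i) e = trans (*-congˡ (product-zero i e)) (zeroʳ _)

  product-distrib-* : ∀ {n} (f g : Fin n → Carrier) → product (λ i → f i * g i) ≈ product f * product g
  product-distrib-* {zero}  f g = sym (*-identityˡ 1#)
  product-distrib-* {suc n} f g = trans (*-congˡ (product-distrib-* (f ∘ suc) (g ∘ suc)))
    (solve 4 (λ a b c d → (a :* b) :* (c :* d) := (a :* c) :* (b :* d)) refl
      (f zero) (g zero) (product (f ∘ suc)) (product (g ∘ suc)))

  product-nonneg : ∀ {n} {f : Fin n → Carrier} → (∀ i → 0# ≤ f i) → 0# ≤ product f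
  product-nonneg {zero}  h = 0≤1
  product-nonneg {suc n} h = *-nonneg (h zero) (product-nonneg (h ∘ suc))

  product-mono-≤ : ∀ {n} {f g : Fin n → Carrier} → (∀ i → 0# ≤ f i) → (∀ i → f i ≤ g i) → product f ≤ product g
  product-mono-≤ {zero}  p h = ≤-refl
  product-mono-≤ {suc n} p h = *-mono-≤ (p zero) (h zero) (product-nonneg (p ∘ suc)) (product-mono-≤ (p ∘ suc) (h ∘ suc))

  product-≤-^ : ∀ {n} {f : Fin n → Carrier} {b} → (∀ i → 0# ≤ f i) → (∀ i → f i ≤ b) → product f ≤ b ^ n
  product-≤-^ {zero}  p h = ≤-refl
  product-≤-^ {suc n} p h = *-mono-≤ (p zero) (h zero) (product-nonneg (p ∘ suc)) (product-≤-^ (p ∘ suc) (h ∘ suc))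

  _ᵀ : ∀ {m n} → Matrix m n → Matrix n m
  (A ᵀ) i j = A j i

  -- Sums over all functions Fin k → Fin p

  ∑→ : ∀ k {p} → ((Fin k → Fin p) → Carrier) → Carrier
  ∑→ zero    φ = φ λ ()
  ∑→ (suc k) φ = sum λ a → ∑→ k λ f → φ (a ∷ f)

  ∑→-cong : ∀ k {p} {φ ψ : (Fin k → Fin p) → Carrier} → (∀ f → φ f ≈ ψ f) → ∑→ k φ ≈ ∑→ k ψ
  ∑→-cong zero    h = h _
  ∑→-cong (suc k) h = sum-cong λ a → ∑→-cong k λ f → h (a ∷ f)

  ∑→-mono-≤ : ∀ k {p} {φ ψ : (Fin k → Fin p) → Carrier} → (∀ f → φ f ≤ ψ f) → ∑→ k φ ≤ ∑→ k ψ
  ∑→-mono-≤ zero    h = h _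
  ∑→-mono-≤ (suc k) h = sum-mono-≤ λ a → ∑→-mono-≤ k λ f → h (a ∷ f)

  ∑→-nonneg : ∀ k {p} {φ : (Fin k → Fin p) → Carrier} → (∀ f → 0# ≤ φ f) → 0# ≤ ∑→ k φ
  ∑→-nonneg zero    h = h _
  ∑→-nonneg (suc k) h = sum-nonneg λ a → ∑→-nonneg k λ f → h (a ∷ f)

  ∑→-zero : ∀ k {p} {φ : (Fin k → Fin p) → Carrier} → (∀ f → φ f ≈ 0#) → ∑→ k φ ≈ 0#
  ∑→-zero zero    h = h _
  ∑→-zero (suc k) h = sum-zero λ a → ∑→-zero k λ f → h (a ∷ f)

  ∑→-distrib-+ : ∀ k {p} (φ ψ : (Fin k → Fin p) → Carrier) → ∑→ k (λ f → φ f + ψ f) ≈ ∑→ k φ + ∑→ k ψ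
  ∑→-distrib-+ zero    φ ψ = refl
  ∑→-distrib-+ (suc k) φ ψ = trans (sum-cong λ a → ∑→-distrib-+ k (φ ∘ (a ∷_)) (ψ ∘ (a ∷_)))
    (∑-distrib-+ (λ a → ∑→ k (φ ∘ (a ∷_))) (λ a → ∑→ k (ψ ∘ (a ∷_))))

  *-distribˡ-∑→ : ∀ k {p} c (φ : (Fin k → Fin p) → Carrier) → c * ∑→ k φ ≈ ∑→ k (λ f → c * φ f)
  *-distribˡ-∑→ zero    c φ = refl
  *-distribˡ-∑→ (suc k) c φ = trans (*-distribˡ-sum c λ a → ∑→ k (φ ∘ (a ∷_))) (sum-cong λ a → *-distribˡ-∑→ k c (φ ∘ (a ∷_)))

  ∑→-sum-comm : ∀ k {p n} (φ : Fin n → (Fin k → Fin p) → Carrier) →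
    ∑→ k (λ f → sum λ j → φ j f) ≈ sum λ j → ∑→ k (φ j)
  ∑→-sum-comm zero    φ = refl
  ∑→-sum-comm (suc k) φ = trans (sum-cong λ a → ∑→-sum-comm k λ j f → φ j (a ∷ f))
    (∑-comm λ a j → ∑→ k λ f → φ j (a ∷ f))

  -- Multiplying out the power gives one summand for each function. Over subsets an elementary
  -- symmetric polynomial would stand here instead, which is why functions are the convenient index
  -- set for weighted minors.
  ∑→-product : ∀ k {p} (w : Fin p → Carrier) → ∑→ k (λ f → product (w ∘ f)) ≈ sum w ^ k
  ∑→-product zero    w = refl
  ∑→-product (suc k) w = trans
    (sum-cong λ a → trans (sym (*-distribˡ-∑→ k (w a) λ f → product (w ∘ f))) (*-congˡ (∑→-product k w)))
    (sym (*-distribʳ-sum _ w))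

  ∑→-cauchy-schwarz : ∀ k {p} (x y : (Fin k → Fin p) → Carrier) →
    ∑→ k (λ f → x f * y f) * ∑→ k (λ f → x f * y f) ≤ ∑→ k (λ f → x f * x f) * ∑→ k (λ f → y f * y f)
  ∑→-cauchy-schwarz k x y = discriminant (∑→-nonneg k λ f → 0≤x² (x f)) λ t →
    ≤-respʳ-≈ (expansion t) (∑→-nonneg k λ f → 0≤x² (y f - t * x f))
    where
    open ≈R
    X = ∑→ k λ f → x f * x f
    Y = ∑→ k λ f → y f * y f
    Z = ∑→ k λ f → x f * y f
    expansion : ∀ t → ∑→ k (λ f → (y f - t * x f) * (y f - t * x f)) ≈ Y - 2# * t * Z + t * t * X
    expansion t = begin
      ∑→ k (λ f → (y f - t * x f) * (y f - t * x f))
        ≈⟨ ∑→-cong k (λ f → solve 3 (λ x y t → (y :- t :* x) :* (y :- t :* x)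
             := y :* y :+ :- (:2 :* t) :* (x :* y) :+ t :* t :* (x :* x)) refl (x f) (y f) t) ⟩
      ∑→ k (λ f → y f * y f + - (2# * t) * (x f * y f) + t * t * (x f * x f))
        ≈⟨ ∑→-distrib-+ k _ _ ⟩
      ∑→ k (λ f → y f * y f + - (2# * t) * (x f * y f)) + ∑→ k (λ f → t * t * (x f * x f))
        ≈⟨ +-cong (∑→-distrib-+ k _ _) (sym (*-distribˡ-∑→ k (t * t) _)) ⟩
      Y + ∑→ k (λ f → - (2# * t) * (x f * y f)) + t * t * X
        ≈⟨ +-congʳ (+-congˡ (sym (*-distribˡ-∑→ k (- (2# * t)) _))) ⟩
      Y + - (2# * t) * Z + t * t * X
        ≈⟨ solve 4 (λ X Y Z t → Y :+ :- (:2 :* t) :* Z :+ t :* t :* X := Y :- :2 :* t :* Z :+ t :* t :* X) refl X Y Z t ⟩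
      Y - 2# * t * Z + t * t * X ∎

  -- Alternating functions

  -- Reindexed argument lists agree only pointwise, so invariance under pointwise equality is
  -- carried along as a hypothesis.
  Extensional : ∀ {X : Set} {k} → ((Fin k → X) → Carrier) → Set
  Extensional {X} {k} φ = ∀ {f g : Fin k → X} → f ≗ g → φ f ≈ φ g

  HeadSwapping : ∀ {X : Set} k → ((Fin (suc k) → X) → Carrier) → Set
  HeadSwapping     zero    φ = ⊤
  HeadSwapping {X} (suc k) φ = ∀ a b (f : Fin k → X) → φ (a ∷ b ∷ f) ≈ - φ (b ∷ a ∷ f)

  -- Changes sign under each transposition of neighbouring arguments.
  Alternating : ∀ {X : Set} k → ((Fin k → X) → Carrier) → Set
  Alternating zero    φ = ⊤
  Alternating (suc k) φ = HeadSwapping k φ × (∀ a → Alternating k (λ f → φ (a ∷ f)))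

  ∷-cong : ∀ {X : Set} {k} {a b : X} {f g : Fin k → X} → a ≡ b → f ≗ g → (a ∷ f) ≗ (b ∷ g)
  ∷-cong p q zero    = p
  ∷-cong p q (suc i) = q i

  ∷-η : ∀ {X : Set} {k} (f : Fin (suc k) → X) → (f zero ∷ (f ∘ suc)) ≗ f
  ∷-η f zero    = ≡.refl
  ∷-η f (suc i) = ≡.refl

  ext-∷ : ∀ {X : Set} {k} {φ : (Fin (suc k) → X) → Carrier} → Extensional φ → ∀ a → Extensional (λ f → φ (a ∷ f))
  ext-∷ ext a h = ext (∷-cong ≡.refl h)

  x≈-x⇒x≈0 : ∀ {x} → x ≈ - x → x ≈ 0#
  x≈-x⇒x≈0 {x} e = *-cancelˡ 0<2 (trans (solve 1 (λ x → :2 :* x := x :+ x) refl x)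
    (trans (+-congˡ e) (trans (-‿inverseʳ x) (sym (zeroʳ 2#)))))

  -- The summands have the shape of a Laplace expansion: c holds the signs, d the entries of the
  -- first row, φ the minors.
  alternating-sum : ∀ {X : Set} k {n} {φ : Fin n → (Fin k → X) → Carrier} (c d : Fin n → Carrier) →
    (∀ j → Alternating k (φ j)) → Alternating k (λ f → sum λ j → c j * (d j * φ j f))
  alternating-sum zero          c d h = tt
  alternating-sum (suc zero)    c d h = tt , λ _ → tt
  alternating-sum (suc (suc k)) {φ = φ} c d h =
    (λ a b f → trans
      (sum-cong λ j → trans (*-congˡ (*-congˡ (proj₁ (h j) a b f)))
        (solve 3 (λ c d x → c :* (d :* :- x) := :- :1 :* (c :* (d :* x))) refl (c j) (d j) (φ j (b ∷ a ∷ f))))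
      (trans (sym (*-distribˡ-sum (- 1#) λ j → c j * (d j * φ j (b ∷ a ∷ f))))
        (solve 1 (λ x → :- :1 :* x := :- x) refl _))) ,
    λ a → alternating-sum (suc k) c d λ j → proj₂ (h j) a

  -- Moving a from position j to the front takes j transpositions of neighbours.
  alternating-insertAt : ∀ {X : Set} k {φ : (Fin (suc k) → X) → Carrier} → Extensional φ → Alternating (suc k) φ →
    ∀ j a f → φ (insertAt f j a) ≈ sign (toℕ j) * φ (a ∷ f)
  alternating-insertAt k ext alt zero a f =
    trans (ext λ { zero → ≡.refl ; (suc _) → ≡.refl }) (sym (*-identityˡ _))
  alternating-insertAt (suc k) {φ} ext alt (suc j) a f = begin
    φ (insertAt f (suc j) a)                  ≈⟨ ext (λ { zero → ≡.refl ; (suc _) → ≡.refl }) ⟩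
    φ (head f ∷ insertAt (tail f) j a)
      ≈⟨ alternating-insertAt k (ext-∷ {φ = φ} ext (head f)) (proj₂ alt (head f)) j a (tail f) ⟩
    sign (toℕ j) * φ (head f ∷ a ∷ tail f)    ≈⟨ *-congˡ (proj₁ alt (head f) a (tail f)) ⟩
    sign (toℕ j) * - φ (a ∷ head f ∷ tail f)
      ≈⟨ *-congˡ (-‿cong (ext (∷-cong ≡.refl (∷-η f)))) ⟩
    sign (toℕ j) * - φ (a ∷ f)
      ≈⟨ solve 2 (λ s x → s :* :- x := (:- :1 :* s) :* x) refl (sign (toℕ j)) (φ (a ∷ f)) ⟩
    sign (suc (toℕ j)) * φ (a ∷ f)            ∎
    where open ≈R

  private
    -- The second occurrence is brought next to the first; exchanging the two equal arguments then
    -- gives φ = - φ.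
    alternating-repeat-head : ∀ {X : Set} k {φ : (Fin (suc k) → X) → Carrier} → Extensional φ → Alternating (suc k) φ →
      ∀ f j → f zero ≡ f (suc j) → φ f ≈ 0#
    alternating-repeat-head (suc k) {φ} ext alt f j e = begin
      φ f                                       ≈⟨ ext (∷-η f) ⟨
      φ (f zero ∷ (f ∘ suc))                    ≈⟨ ext (∷-cong ≡.refl (insertAt-removeAt (f ∘ suc) j)) ⟨
      φ (f zero ∷ insertAt rest j (f (suc j)))
        ≈⟨ alternating-insertAt k (ext-∷ {φ = φ} ext (f zero)) (proj₂ alt (f zero)) j (f (suc j)) rest ⟩
      sign (toℕ j) * φ (f zero ∷ f (suc j) ∷ rest) ≈⟨ *-congˡ (ext (∷-cong ≡.refl (∷-cong (≡.sym e) (λ _ → ≡.refl)))) ⟩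
      sign (toℕ j) * φ (f zero ∷ f zero ∷ rest) ≈⟨ *-congˡ (x≈-x⇒x≈0 (proj₁ alt _ _ _)) ⟩
      sign (toℕ j) * 0#                         ≈⟨ zeroʳ _ ⟩
      0# ∎
      where
      open ≈R
      rest = removeAt (f ∘ suc) j

  alternating-repeat : ∀ {X : Set} k {φ : (Fin k → X) → Carrier} → Extensional φ → Alternating k φ →
    ∀ f i j → ¬ (i ≡ j) → f i ≡ f j → φ f ≈ 0#
  alternating-repeat k       ext alt f zero    zero    i≢j e = ⊥-elim (i≢j ≡.refl)
  alternating-repeat (suc k) ext alt f zero    (suc j) i≢j e = alternating-repeat-head k ext alt f j e
  alternating-repeat (suc k) ext alt f (suc i) zero    i≢j e = alternating-repeat-head k ext alt f i (≡.sym e)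
  alternating-repeat (suc k) {φ} ext alt f (suc i) (suc j) i≢j e = trans (sym (ext (∷-η f)))
    (alternating-repeat k (ext-∷ {φ = φ} ext (f zero)) (proj₂ alt (f zero)) (f ∘ suc) i j (i≢j ∘ ≡.cong suc) e)

  strictlyIncreasing-∷ : ∀ {k m} {a : Fin m} {g : Fin k → Fin m} →
    (∀ i → a Fin.< g i) → StrictlyIncreasing g → StrictlyIncreasing (a ∷ g)
  strictlyIncreasing-∷ p inc zero    (suc j) _           = p j
  strictlyIncreasing-∷ p inc (suc i) (suc j) (ℕ.s≤s i<j) = inc i j i<j

  private
    -- One step of insertion sort: a repeated index annihilates the value, otherwise a moves past
    -- the smaller entries and only the sign changes, which squaring hides. The last component, that
    -- whatever lies below all inputs lies below all outputs, keeps the old head in front in the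
    -- recursion.
    sort-insert : ∀ k {m} {φ : (Fin (suc k) → Fin m) → Carrier} → Extensional φ → Alternating (suc k) φ →
      ∀ a (g : Fin k → Fin m) → StrictlyIncreasing g →
      φ (a ∷ g) ≈ 0# ⊎
      ∃ λ h → StrictlyIncreasing h × φ h * φ h ≈ φ (a ∷ g) * φ (a ∷ g) ×
        (∀ (b : Fin m) → b Fin.< a → (∀ i → b Fin.< g i) → ∀ i → b Fin.< h i)
    sort-insert zero ext alt a g inc =
      inj₂ (a ∷ g , strictlyIncreasing-∷ (λ ()) inc , refl , λ { b p q zero → p })
    sort-insert (suc k) {φ = φ} ext alt a g inc with Finₚ.<-cmp a (g zero)
    ... | tri< a<g₀ _ _ = inj₂ (a ∷ g ,
      strictlyIncreasing-∷ (λ { zero → a<g₀ ; (suc i) → Finₚ.<-trans a<g₀ (inc zero (suc i) (ℕ.s≤s ℕ.z≤n)) }) inc ,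
      refl , λ { b p q zero → p ; b p q (suc i) → q i })
    ... | tri≈ _ a≡g₀ _ = inj₁ (alternating-repeat _ {φ = φ} ext alt (a ∷ g) zero (suc zero) (λ ()) a≡g₀)
    ... | tri> _ _ g₀<a with sort-insert k (ext-∷ {φ = φ} ext (g zero)) (proj₂ alt (g zero)) a (g ∘ suc)
                               (λ i j i<j → inc (suc i) (suc j) (ℕ.s≤s i<j))
    ...   | inj₁ e = inj₁ (trans swap (trans (-‿cong e) -0#≈0#))
      where swap = trans (ext (∷-cong ≡.refl (λ i → ≡.sym (∷-η g i)))) (proj₁ alt a (g zero) (g ∘ suc))
    ...   | inj₂ (h , inc-h , e , low) = inj₂ (g zero ∷ h ,
      strictlyIncreasing-∷ (low (g zero) g₀<a λ i → inc zero (suc i) (ℕ.s≤s ℕ.z≤n)) inc-h ,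
      trans e (trans (solve 1 (λ x → x :* x := :- x :* :- x) refl _) (*-cong (sym swap) (sym swap))) ,
      λ { b p q zero → q zero ; b p q (suc i) → low b p (q ∘ suc) i })
      where swap = trans (ext (∷-cong ≡.refl (λ i → ≡.sym (∷-η g i)))) (proj₁ alt a (g zero) (g ∘ suc))

  -- Insertion sort. It reduces minors with arbitrary indices to the strictly increasing ones over
  -- which `detlb` and `HasRank` range.
  alternating-sort : ∀ k {m} {φ : (Fin k → Fin m) → Carrier} → Extensional φ → Alternating k φ → ∀ f →
    φ f ≈ 0# ⊎ ∃ λ g → StrictlyIncreasing g × φ g * φ g ≈ φ f * φ f
  alternating-sort zero    ext alt f = inj₂ (f , (λ ()) , refl)
  alternating-sort (suc k) {φ = φ} ext alt f
    with alternating-sort k (ext-∷ {φ = φ} ext (f zero)) (proj₂ alt (f zero)) (f ∘ suc)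
  ... | inj₁ e = inj₁ (trans (sym (ext (∷-η f))) e)
  ... | inj₂ (g , inc , e) with sort-insert k {φ = φ} ext alt (f zero) g inc
  ...   | inj₁ e′ = inj₁ (x²≤0⇒x≈0 (≤-reflexive (trans (*-cong (sym (ext (∷-η f))) (sym (ext (∷-η f))))
                      (trans (sym e) (trans (*-congʳ e′) (zeroˡ _))))))
  ...   | inj₂ (h , inc-h , e′ , _) = inj₂ (h , inc-h , trans e′ (trans e (*-cong (ext (∷-η f)) (ext (∷-η f)))))

  -- Determinants

  det-cong : ∀ {n} {A B : Matrix n n} → A ≋ B → det A ≈ det B
  det-cong {zero}  h = refl
  det-cong {suc n} h = sum-cong λ j → *-congˡ {x = sign (toℕ j)}
    (*-cong (h zero j) (det-cong λ i l → h (suc i) (punchIn j l)))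

  private
    -- Laplace expansion along a row u in which the minors are an arbitrary function Φ of the
    -- injection listing the remaining columns. `expand₂` expands along two successive rows.
    expand : ∀ {n} → (Fin (suc n) → Carrier) → ((Fin n → Fin (suc n)) → Carrier) → Carrier
    expand u Φ = sum λ j → sign (toℕ j) * (u j * Φ (punchIn j))

    expand₂ : ∀ {n} (u v : Fin (suc (suc n)) → Carrier) → ((Fin n → Fin (suc (suc n))) → Carrier) → Carrier
    expand₂ u v Φ = expand u λ e → expand (v ∘ e) λ e′ → Φ (e ∘ e′)

    lift : ∀ {k n} → (Fin k → Fin n) → Fin (suc k) → Fin (suc n)
    lift h = zero ∷ (suc ∘ h)

    -- The terms of `expand₂` in which neither row uses column zero; with only two columns there are
    -- none.
    lower : ∀ {n} (u v : Fin (suc (suc n)) → Carrier) → ((Fin n → Fin (suc (suc n))) → Carrier) → Carrier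
    lower {zero}  u v Φ = 0#
    lower {suc n} u v Φ = expand₂ (u ∘ suc) (v ∘ suc) (Φ ∘ lift)

    inner : ∀ {n} (v : Fin (suc (suc n)) → Carrier) → ((Fin n → Fin (suc (suc n))) → Carrier) → Fin (suc n) → Carrier
    inner {zero}  v Φ j = 0#
    inner {suc n} v Φ j = expand (v ∘ suc ∘ punchIn j) λ e′ → Φ (lift (punchIn j ∘ e′))

    inner-lower : ∀ {n} u v Φ → sum (λ j → sign (toℕ j) * (u (suc j) * inner {n} v Φ j)) ≈ lower u v Φ
    inner-lower {zero}  u v Φ = sum-zero {1} λ j → trans (*-congˡ {x = sign (toℕ j)} (zeroʳ (u (suc j)))) (zeroʳ (sign (toℕ j)))
    inner-lower {suc n} u v Φ = refl

    expand-suc : ∀ {n} (v : Fin (suc (suc n)) → Carrier) {Φ : (Fin n → Fin (suc (suc n))) → Carrier} → Extensional Φ →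
      ∀ j → expand (v ∘ punchIn (suc j)) (λ e′ → Φ (punchIn (suc j) ∘ e′)) ≈
            v zero * Φ (suc ∘ punchIn j) - inner v Φ j
    expand-suc {zero} v {Φ} ext j =
      trans (+-congˡ {x = 1# * (v zero * Φ (suc ∘ punchIn j))} (sym -0#≈0#)) (+-congʳ (*-identityˡ _))
    expand-suc {suc n} v {Φ} ext j = +-cong (*-identityˡ _)
      (trans (sum-cong {suc n} λ l → trans
          (*-congˡ {x = sign (suc (toℕ l))} (*-congˡ {x = v (suc (punchIn j l))}
            (ext {punchIn (suc j) ∘ punchIn (suc l)} {lift (punchIn j ∘ punchIn l)} λ { zero → ≡.refl ; (suc i) → ≡.refl })))
          (solve 2 (λ s x → (:- :1 :* s) :* x := :- :1 :* (s :* x)) refl (sign (toℕ l))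
            (v (suc (punchIn j l)) * Φ (lift (punchIn j ∘ punchIn l)))))
        (trans (sym (*-distribˡ-sum {suc n} (- 1#) λ l → sign (toℕ l) * (v (suc (punchIn j l)) * Φ (lift (punchIn j ∘ punchIn l)))))
          (solve 1 (λ x → :- :1 :* x := :- x) refl _)))

    -- The terms are grouped by whether u, v or neither of them uses column zero. Exchanging u and v
    -- swaps the first two groups with opposite signs and leaves the third to induction.
    expand₂-split : ∀ {n} u v {Φ : (Fin n → Fin (suc (suc n))) → Carrier} → Extensional Φ →
      expand₂ u v Φ ≈ u zero * expand (v ∘ suc) (λ e → Φ (suc ∘ e))
                      - v zero * expand (u ∘ suc) (λ e → Φ (suc ∘ e)) + lower u v Φ
    expand₂-split {n} u v {Φ} ext = trans (+-cong (*-identityˡ _) rest) (sym (+-assoc _ _ _))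
      where
      open ≈R
      s : Fin (suc n) → Carrier
      s j = sign (toℕ j)
      rest : sum (λ j → sign (suc (toℕ j)) * (u (suc j) * expand (v ∘ punchIn (suc j)) (λ e′ → Φ (punchIn (suc j) ∘ e′))))
             ≈ - (v zero * expand (u ∘ suc) (λ e → Φ (suc ∘ e))) + lower u v Φ
      rest = begin
        _ ≈⟨ sum-cong (λ j → trans (*-congˡ {x = sign (suc (toℕ j))} (*-congˡ {x = u (suc j)} (expand-suc v {Φ} ext j)))
               (solve 5 (λ s u v x y → (:- :1 :* s) :* (u :* (v :* x :- y)) := :- v :* (s :* (u :* x)) :+ s :* (u :* y))
                 refl (s j) (u (suc j)) (v zero) (Φ (suc ∘ punchIn j)) (inner v Φ j))) ⟩
        sum (λ j → - v zero * (s j * (u (suc j) * Φ (suc ∘ punchIn j))) + s j * (u (suc j) * inner v Φ j))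
          ≈⟨ ∑-distrib-+ {suc n} (λ j → - v zero * (s j * (u (suc j) * Φ (suc ∘ punchIn j)))) (λ j → s j * (u (suc j) * inner v Φ j)) ⟩
        _ ≈⟨ +-cong (sym (*-distribˡ-sum (- v zero) λ j → s j * (u (suc j) * Φ (suc ∘ punchIn j)))) (inner-lower u v Φ) ⟩
        - v zero * expand (u ∘ suc) (λ e → Φ (suc ∘ e)) + lower u v Φ
          ≈⟨ +-congʳ (solve 2 (λ v x → :- v :* x := :- (v :* x)) refl (v zero) _) ⟩
        - (v zero * expand (u ∘ suc) (λ e → Φ (suc ∘ e))) + lower u v Φ ∎

    expand₂-antisym : ∀ {n} u v {Φ : (Fin n → Fin (suc (suc n))) → Carrier} → Extensional Φ →
      expand₂ u v Φ ≈ - expand₂ v u Φ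
    lower-antisym : ∀ {n} u v {Φ : (Fin n → Fin (suc (suc n))) → Carrier} → Extensional Φ →
      lower u v Φ ≈ - lower v u Φ
    lower-antisym {zero}  u v ext = sym -0#≈0#
    lower-antisym {suc n} u v {Φ} ext = expand₂-antisym (u ∘ suc) (v ∘ suc)
      λ h → ext (∷-cong ≡.refl (≡.cong suc ∘ h))
    expand₂-antisym u v {Φ} ext = begin
      expand₂ u v Φ                           ≈⟨ expand₂-split u v {Φ} ext ⟩
      u zero * V - v zero * U + lower u v Φ   ≈⟨ +-congˡ (lower-antisym u v {Φ} ext) ⟩
      u zero * V - v zero * U - lower v u Φ
        ≈⟨ solve 3 (λ a b c → a :- b :- c := :- (b :- a :+ c)) refl (u zero * V) (v zero * U) (lower v u Φ) ⟩
      - (v zero * U - u zero * V + lower v u Φ) ≈⟨ -‿cong (expand₂-split v u {Φ} ext) ⟨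
      - expand₂ v u Φ                         ∎
      where
      open ≈R
      U = expand (u ∘ suc) (λ e → Φ (suc ∘ e))
      V = expand (v ∘ suc) (λ e → Φ (suc ∘ e))

  det-rows-ext : ∀ {X : Set} {k} (C : X → Fin k → Carrier) → Extensional (λ f → det (λ i → C (f i)))
  det-rows-ext C h = det-cong λ i j → reflexive (≡.cong (λ x → C x j) (h i))

  -- An exchange of the first two rows is `expand₂-antisym`; exchanges further down take place
  -- inside the minors of the first-row expansion.
  det-rows-alternating : ∀ {X : Set} k (C : X → Fin k → Carrier) → Alternating k (λ f → det (λ i → C (f i)))
  det-rows-alternating zero    C = tt
  det-rows-alternating (suc k) C = headSwap k C ,
    λ a → alternating-sum k (λ j → sign (toℕ j)) (C a) λ j → det-rows-alternating k λ x l → C x (punchIn j l)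
    where
    headSwap : ∀ {X : Set} k (C : X → Fin (suc k) → Carrier) → HeadSwapping k (λ f → det (λ i → C (f i)))
    headSwap zero    C = tt
    headSwap (suc k) C a b f = expand₂-antisym (C a) (C b) {λ e → det (λ i l → C (f i) (e l))}
      λ h → det-cong λ i l → reflexive (≡.cong (C (f i)) (h l))

  -- First-row and first-column expansions agree: expand each once more along the other.
  det-column-expansion : ∀ {n} (A : Matrix (suc n) (suc n)) →
    det A ≈ sum λ i → sign (toℕ i) * (A i zero * det (λ k l → A (punchIn i k) (suc l)))
  det-column-expansion {zero}  A = refl
  det-column-expansion {suc n} A = +-congˡ (begin
    sum (λ j → s (suc j) * (A zero (suc j) * det (λ i l → A (suc i) (punchIn (suc j) l))))
      ≈⟨ sum-cong (λ j → trans (*-congˡ {x = s (suc j)} (*-congˡ (det-column-expansion λ i l → A (suc i) (punchIn (suc j) l))))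
           (trans (*-congˡ (*-distribˡ-sum (A zero (suc j)) λ i → s i * (A (suc i) zero * M i j)))
             (*-distribˡ-sum (s (suc j)) λ i → A zero (suc j) * (s i * (A (suc i) zero * M i j))))) ⟩
    sum (λ j → sum λ i → s (suc j) * (A zero (suc j) * (s i * (A (suc i) zero * M i j))))
      ≈⟨ ∑-comm (λ j i → s (suc j) * (A zero (suc j) * (s i * (A (suc i) zero * M i j)))) ⟩
    sum (λ i → sum λ j → s (suc j) * (A zero (suc j) * (s i * (A (suc i) zero * M i j))))
      ≈⟨ sum-cong (λ i → sum-cong λ j → solve 5 (λ s t a b m →
           (:- :1 :* s) :* (a :* (t :* (b :* m))) := (:- :1 :* t) :* (b :* (s :* (a :* m)))) refl
           (s j) (s i) (A zero (suc j)) (A (suc i) zero) (M i j)) ⟩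
    sum (λ i → sum λ j → s (suc i) * (A (suc i) zero * (s j * (A zero (suc j) * M i j))))
      ≈⟨ sum-cong (λ i → trans (*-congˡ {x = s (suc i)} (*-distribˡ-sum (A (suc i) zero) λ j → s j * (A zero (suc j) * M i j)))
           (*-distribˡ-sum (s (suc i)) λ j → A (suc i) zero * (s j * (A zero (suc j) * M i j)))) ⟨
    sum (λ i → s (suc i) * (A (suc i) zero * det (λ k l → A (punchIn (suc i) k) (suc l)))) ∎)
    where
    open ≈R
    s : ∀ {n} → Fin n → Carrier
    s j = sign (toℕ j)
    M : Fin (suc n) → Fin (suc n) → Carrier
    M i j = det λ k l → A (suc (punchIn i k)) (suc (punchIn j l))

  det-ᵀ : ∀ {n} (A : Matrix n n) → det (A ᵀ) ≈ det A
  det-ᵀ {zero}  A = refl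
  det-ᵀ {suc n} A = trans
    (sum-cong λ j → *-congˡ {x = sign (toℕ j)} (*-congˡ {x = A j zero} (det-ᵀ λ k l → A (punchIn j k) (suc l))))
    (sym (det-column-expansion A))

  det-scale-rows : ∀ {n} (a : Vec n) (A : Matrix n n) → det (λ i j → a i * A i j) ≈ product a * det A
  det-scale-rows {zero}  a A = sym (*-identityˡ 1#)
  det-scale-rows {suc n} a A = trans
    (sum-cong λ j → trans (*-congˡ {x = sign (toℕ j)} (*-congˡ {x = a zero * A zero j} (det-scale-rows (a ∘ suc) λ i l → A (suc i) (punchIn j l))))
      (solve 5 (λ s a x p d → s :* ((a :* x) :* (p :* d)) := (a :* p) :* (s :* (x :* d))) refl
        (sign (toℕ j)) (a zero) (A zero j) (product (a ∘ suc)) (det λ i l → A (suc i) (punchIn j l))))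
    (sym (*-distribˡ-sum (product a) λ j → sign (toℕ j) * (A zero j * det λ i l → A (suc i) (punchIn j l))))

  det-scale-columns : ∀ {n} (b : Vec n) (A : Matrix n n) → det (λ i j → A i j * b j) ≈ product b * det A
  det-scale-columns b A = begin
    det (λ i j → A i j * b j)    ≈⟨ det-ᵀ (λ i j → A i j * b j) ⟨
    det (λ j i → A i j * b j)    ≈⟨ det-cong (λ j i → *-comm (A i j) (b j)) ⟩
    det (λ j i → b j * A i j)    ≈⟨ det-scale-rows b (A ᵀ) ⟩
    product b * det (A ᵀ)        ≈⟨ *-congˡ (det-ᵀ A) ⟩
    product b * det A            ∎
    where open ≈R

  δ : ∀ {n} → Matrix n n
  δ zero    zero    = 1#
  δ zero    (suc j) = 0#
  δ (suc i) zero    = 0#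
  δ (suc i) (suc j) = δ i j

  δ-diag : ∀ {n} (i : Fin n) → δ i i ≈ 1#
  δ-diag zero    = refl
  δ-diag (suc i) = δ-diag i

  δ-off : ∀ {n} {i j : Fin n} → ¬ (i ≡ j) → δ i j ≈ 0#
  δ-off {i = zero}  {zero}  n = ⊥-elim (n ≡.refl)
  δ-off {i = zero}  {suc j} n = refl
  δ-off {i = suc i} {zero}  n = refl
  δ-off {i = suc i} {suc j} n = δ-off (n ∘ ≡.cong suc)

  δ-sym : ∀ {n} (i j : Fin n) → δ i j ≈ δ j i
  δ-sym zero    zero    = refl
  δ-sym zero    (suc j) = refl
  δ-sym (suc i) zero    = refl
  δ-sym (suc i) (suc j) = δ-sym i j

  sum-δ : ∀ {n} (i : Fin n) (x : Vec n) → sum (λ l → δ i l * x l) ≈ x i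
  sum-δ zero    x = trans (+-cong (*-identityˡ _) (sum-zero λ l → zeroˡ (x (suc l)))) (+-identityʳ _)
  sum-δ (suc i) x = trans (+-cong (zeroˡ _) (sum-δ i (x ∘ suc))) (+-identityˡ _)

  det-δ : ∀ n → det (δ {n}) ≈ 1#
  det-δ zero    = refl
  det-δ (suc n) = trans (+-cong
      (trans (*-identityˡ _) (trans (*-identityˡ _) (det-δ n)))
      (sum-zero {n} λ j → trans (*-congˡ {x = sign (suc (toℕ j))} (zeroˡ (det λ i l → δ (suc i) (punchIn (suc j) l))))
        (zeroʳ (sign (suc (toℕ j))))))
    (+-identityʳ 1#)

  -- The Cauchy-Binet formula over all functions

  -- Multilinearity in the rows: row i of the product is a combination of the rows of C, and f i
  -- records which of them is picked.
  det-⊗ : ∀ {k p} (B : Matrix k p) (C : Matrix p k) →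
    det (B ⊗ C) ≈ ∑→ k λ f → product (λ i → B i (f i)) * det (λ i → C (f i))
  det-⊗ {zero}  B C = sym (*-identityˡ 1#)
  det-⊗ {suc k} {p} B C = begin
    sum (λ j → s j * (sum (λ a → B zero a * C a j) * det (λ i l → (B ⊗ C) (suc i) (punchIn j l))))
      ≈⟨ sum-cong (λ j → trans (*-congˡ {x = s j} (*-congˡ (det-⊗ (B ∘ suc) λ a l → C a (punchIn j l))))
           (trans (*-congˡ (*-distribʳ-sum (D j) λ a → B zero a * C a j))
             (*-distribˡ-sum (s j) λ a → B zero a * C a j * D j))) ⟩
    sum (λ j → sum λ a → s j * (B zero a * C a j * D j))
      ≈⟨ ∑-comm (λ j a → s j * (B zero a * C a j * D j)) ⟩
    sum (λ a → sum λ j → s j * (B zero a * C a j * D j))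
      ≈⟨ sum-cong (λ a → trans (sum-cong λ j → trans
             (solve 4 (λ s b c d → s :* (b :* c :* d) := (b :* (s :* c)) :* d) refl (s j) (B zero a) (C a j) (D j))
             (*-distribˡ-∑→ k (B zero a * (s j * C a j)) λ f → w f * det (λ i l → C (f i) (punchIn j l))))
           (sym (∑→-sum-comm k λ j f → B zero a * (s j * C a j) * (w f * det (λ i l → C (f i) (punchIn j l)))))) ⟩
    sum (λ a → ∑→ k λ f → sum λ j → B zero a * (s j * C a j) * (w f * det (λ i l → C (f i) (punchIn j l))))
      ≈⟨ sum-cong (λ a → ∑→-cong k λ f → trans
           (sum-cong λ j → solve 5 (λ b s c w d → b :* (s :* c) :* (w :* d) := (b :* w) :* (s :* (c :* d))) refl
             (B zero a) (s j) (C a j) (w f) (det (λ i l → C (f i) (punchIn j l))))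
           (sym (*-distribˡ-sum (B zero a * w f) λ j → s j * (C a j * det (λ i l → C (f i) (punchIn j l)))))) ⟩
    sum (λ a → ∑→ k λ f → (B zero a * w f) * det (λ i → C ((a ∷ f) i))) ∎
    where
    open ≈R
    s : Fin (suc k) → Carrier
    s j = sign (toℕ j)
    w : (Fin k → Fin p) → Carrier
    w f = product λ i → B (suc i) (f i)
    D : Fin (suc k) → Carrier
    D j = ∑→ k λ f → w f * det (λ i l → C (f i) (punchIn j l))

  ∑→-insertAt : ∀ k {p} {F : (Fin (suc k) → Fin p) → Carrier} → Extensional F → ∀ j →
    ∑→ (suc k) F ≈ sum λ a → ∑→ k λ f → F (insertAt f j a)
  ∑→-insertAt k {p} ext zero = sum-cong {p} λ a → ∑→-cong k λ f →
    ext {a ∷ f} {insertAt f zero a} λ { zero → ≡.refl ; (suc _) → ≡.refl }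
  ∑→-insertAt (suc k) {p} {F} ext (suc j) = begin
    sum (λ b → ∑→ (suc k) λ f → F (b ∷ f))
      ≈⟨ sum-cong (λ b → ∑→-insertAt k (ext-∷ {φ = F} ext b) j) ⟩
    sum (λ b → sum λ a → ∑→ k λ f → F (b ∷ insertAt f j a))
      ≈⟨ ∑-comm (λ b a → ∑→ k λ f → F (b ∷ insertAt f j a)) ⟩
    sum (λ a → sum λ b → ∑→ k λ f → F (b ∷ insertAt f j a))
      ≈⟨ sum-cong {p} (λ a → sum-cong {p} λ b → ∑→-cong k λ f →
           ext {b ∷ insertAt f j a} {insertAt (b ∷ f) (suc j) a} λ { zero → ≡.refl ; (suc _) → ≡.refl }) ⟩
    sum (λ a → sum λ b → ∑→ k λ f → F (insertAt (b ∷ f) (suc j) a)) ∎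
    where open ≈R

  -- In the Laplace expansion of `det`, bringing f j to the front of φ produces a sign that cancels
  -- the sign of the j-th term. All values of j therefore contribute equally, and the induction
  -- accumulates k!.
  ∑→-det-alternating : ∀ k {p} (B : Matrix k p) {φ : (Fin k → Fin p) → Carrier} → Extensional φ → Alternating k φ →
    ∑→ k (λ f → det (λ i j → B i (f j)) * φ f) ≈ fromℕ (k !) * ∑→ k (λ f → product (λ i → B i (f i)) * φ f)
  ∑→-det-alternating zero B {φ} ext alt =
    trans (*-congʳ (sym (+-identityʳ 1#))) (*-congˡ (sym (*-identityˡ _)))
  ∑→-det-alternating (suc k) {p} B {φ} ext alt = begin
    ∑→ (suc k) (λ f → sum (λ j → s j * (B zero (f j) * det (λ i l → B (suc i) (f (punchIn j l))))) * φ f)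
      ≈⟨ ∑→-cong (suc k) (λ f → *-distribʳ-sum (φ f) λ j → s j * (B zero (f j) * det (λ i l → B (suc i) (f (punchIn j l))))) ⟩
    ∑→ (suc k) (λ f → sum λ j → F j f)
      ≈⟨ ∑→-sum-comm (suc k) F ⟩
    sum (λ j → ∑→ (suc k) (F j))
      ≈⟨ sum-cong each ⟩
    sum {suc k} (λ _ → fromℕ (k !) * T)
      ≈⟨ sum-const (suc k) _ ⟩
    fromℕ (suc k) * (fromℕ (k !) * T)
      ≈⟨ *-assoc _ _ _ ⟨
    fromℕ (suc k) * fromℕ (k !) * T
      ≈⟨ *-congʳ (fromℕ-* (suc k) (k !)) ⟨
    fromℕ (suc k !) * T ∎
    where
    open ≈R
    s : Fin (suc k) → Carrier
    s j = sign (toℕ j)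
    F : Fin (suc k) → (Fin (suc k) → Fin p) → Carrier
    F j f = s j * (B zero (f j) * det (λ i l → B (suc i) (f (punchIn j l)))) * φ f
    T = ∑→ (suc k) λ f → product (λ i → B i (f i)) * φ f
    w : (Fin k → Fin p) → Carrier
    w f = product λ i → B (suc i) (f i)
    D : (Fin k → Fin p) → Carrier
    D f = det λ i l → B (suc i) (f l)
    F-ext : ∀ j → Extensional (F j)
    F-ext j h = *-cong (*-congˡ {x = s j} (*-cong (reflexive (≡.cong (B zero) (h j)))
      (det-cong λ i l → reflexive (≡.cong (B (suc i)) (h (punchIn j l)))))) (ext h)
    F-insertAt : ∀ j a f → F j (insertAt f j a) ≈ B zero a * (D f * φ (a ∷ f))
    F-insertAt j a f = trans
      (*-cong (*-congˡ {x = s j} (*-cong (reflexive (≡.cong (B zero) (insertAt-lookup f j a)))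
          (det-cong λ i l → reflexive (≡.cong (B (suc i)) (insertAt-punchIn f j a l)))))
        (alternating-insertAt k ext alt j a f))
      (trans (solve 4 (λ s b d x → s :* (b :* d) :* (s :* x) := (s :* s) :* (b :* (d :* x))) refl
          (s j) (B zero a) (D f) (φ (a ∷ f)))
        (trans (*-congʳ (sign² (toℕ j))) (*-identityˡ _)))
    each : ∀ j → ∑→ (suc k) (F j) ≈ fromℕ (k !) * T
    each j = begin
      ∑→ (suc k) (F j)                                        ≈⟨ ∑→-insertAt k (F-ext j) j ⟩
      sum (λ a → ∑→ k λ f → F j (insertAt f j a))             ≈⟨ sum-cong (λ a → ∑→-cong k (F-insertAt j a)) ⟩
      sum (λ a → ∑→ k λ f → B zero a * (D f * φ (a ∷ f)))
        ≈⟨ sum-cong (λ a → *-distribˡ-∑→ k (B zero a) λ f → D f * φ (a ∷ f)) ⟨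
      sum (λ a → B zero a * ∑→ k λ f → D f * φ (a ∷ f))
        ≈⟨ sum-cong (λ a → *-congˡ {x = B zero a} (∑→-det-alternating k (B ∘ suc) (ext-∷ {φ = φ} ext a) (proj₂ alt a))) ⟩
      sum (λ a → B zero a * (fromℕ (k !) * ∑→ k λ f → w f * φ (a ∷ f)))
        ≈⟨ sum-cong (λ a → trans
             (solve 3 (λ b n x → b :* (n :* x) := n :* (b :* x)) refl (B zero a) (fromℕ (k !)) (∑→ k λ f → w f * φ (a ∷ f)))
             (*-congˡ (trans (*-distribˡ-∑→ k (B zero a) λ f → w f * φ (a ∷ f))
               (∑→-cong k λ f → sym (*-assoc (B zero a) (w f) (φ (a ∷ f))))))) ⟩
      sum (λ a → fromℕ (k !) * ∑→ k λ f → B zero a * w f * φ (a ∷ f))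
        ≈⟨ *-distribˡ-sum (fromℕ (k !)) (λ a → ∑→ k λ f → B zero a * w f * φ (a ∷ f)) ⟨
      fromℕ (k !) * T ∎

  -- The factor k! counts orderings: each k-element subset occurs once for every ordering, and
  -- functions that are not injective contribute 0.
  cauchy-binet : ∀ {k p} (B : Matrix k p) (C : Matrix p k) →
    fromℕ (k !) * det (B ⊗ C) ≈ ∑→ k λ f → det (λ i j → B i (f j)) * det (λ i → C (f i))
  cauchy-binet {k} B C = trans (*-congˡ (det-⊗ B C))
    (sym (∑→-det-alternating k B (det-rows-ext C) (det-rows-alternating k C)))

  cauchy-binet-gram : ∀ {k p} (Z : Matrix p k) →
    fromℕ (k !) * det ((Z ᵀ) ⊗ Z) ≈ ∑→ k λ f → det (λ i → Z (f i)) * det (λ i → Z (f i))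
  cauchy-binet-gram {k} Z = trans (cauchy-binet (Z ᵀ) Z) (∑→-cong k λ f → *-congʳ (det-ᵀ λ i → Z (f i)))

  det-⊗-≤ : ∀ {k p} (B : Matrix k p) (C : Matrix p k) →
    det (B ⊗ C) * det (B ⊗ C) ≤ det (B ⊗ (B ᵀ)) * det ((C ᵀ) ⊗ C)
  det-⊗-≤ {k} B C = *-cancelˡ-≤ (*-pos 0<k! 0<k!) (begin
    k! * k! * (d * d)         ≈⟨ solve 2 (λ n d → n :* n :* (d :* d) := (n :* d) :* (n :* d)) refl k! d ⟩
    k! * d * (k! * d)         ≈⟨ *-cong (cauchy-binet B C) (cauchy-binet B C) ⟩
    _                         ≤⟨ ∑→-cauchy-schwarz k (λ f → det (λ i j → B i (f j))) (λ f → det (λ i → C (f i))) ⟩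
    _                         ≈⟨ *-cong (trans (∑→-cong k λ f → *-congˡ (sym (det-ᵀ λ i j → B i (f j))))
                                   (sym (cauchy-binet B (B ᵀ)))) (sym (cauchy-binet-gram C)) ⟩
    k! * b * (k! * c)         ≈⟨ solve 3 (λ n b c → n :* b :* (n :* c) := n :* n :* (b :* c)) refl k! b c ⟩
    k! * k! * (b * c)         ∎)
    where
    open ≤R
    k! = fromℕ (k !)
    d = det (B ⊗ C)
    b = det (B ⊗ (B ᵀ))
    c = det ((C ᵀ) ⊗ C)
    0<k! = fromℕ!-pos k

  -- Row operations and dependent rows

  -- Since A = δ ⊗ A, both determinants expand over the same functions f, so their coefficients can
  -- be compared term by term.
  det-⊗-by : ∀ {n} (B A : Matrix n n) c →
    (∀ f → product (λ i → B i (f i)) * det (λ i → A (f i)) ≈ c * (product (λ i → δ i (f i)) * det (λ i → A (f i)))) →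
    det (B ⊗ A) ≈ c * det A
  det-⊗-by {n} B A c h = begin
    det (B ⊗ A)            ≈⟨ det-⊗ B A ⟩
    _                      ≈⟨ ∑→-cong n h ⟩
    _                      ≈⟨ *-distribˡ-∑→ n c _ ⟨
    _                      ≈⟨ *-congˡ (det-⊗ δ A) ⟨
    c * det (δ ⊗ A)        ≈⟨ *-congˡ (det-cong λ i j → sum-δ i (column A j)) ⟩
    c * det A              ∎
    where open ≈R

  det-repeat : ∀ {n} (A : Matrix n n) (f : Fin n → Fin n) i j → ¬ (i ≡ j) → f i ≡ f j → det (λ i → A (f i)) ≈ 0#
  det-repeat {n} A = alternating-repeat n (det-rows-ext A) (det-rows-alternating n A)

  -- Left multiplication by an elementary matrix `B` that differs from `δ` only in column zero below
  -- the diagonal. A surviving f must fix zero, because row zero of `B` is that of `δ`, and sends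
  -- nothing else to zero, because a row would repeat; along such f the two matrices agree.
  det-add-first-row : ∀ {n} (c : Vec (suc n)) (A : Matrix (suc n) (suc n)) → c zero ≈ 0# →
    det (λ i j → A i j + c i * A zero j) ≈ det A
  det-add-first-row {n} c A c₀≈0 = trans (det-cong λ i j → sym (entry i j)) (trans (det-⊗-by B A 1# term) (*-identityˡ _))
    where
    B : Matrix (suc n) (suc n)
    B i a = δ i a + c i * δ zero a
    entry : ∀ i j → (B ⊗ A) i j ≈ A i j + c i * A zero j
    entry i j = begin
      sum (λ a → (δ i a + c i * δ zero a) * A a j)
        ≈⟨ sum-cong (λ a → solve 4 (λ d c e x → (d :+ c :* e) :* x := d :* x :+ c :* (e :* x)) refl (δ i a) (c i) (δ zero a) (A a j)) ⟩
      sum (λ a → δ i a * A a j + c i * (δ zero a * A a j))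
        ≈⟨ ∑-distrib-+ (λ a → δ i a * A a j) (λ a → c i * (δ zero a * A a j)) ⟩
      sum (λ a → δ i a * A a j) + sum (λ a → c i * (δ zero a * A a j))
        ≈⟨ +-cong (sum-δ i (column A j)) (trans (sym (*-distribˡ-sum (c i) λ a → δ zero a * A a j)) (*-congˡ (sum-δ zero (column A j)))) ⟩
      A i j + c i * A zero j ∎
      where open ≈R
    B≈δ : ∀ {i a} → c i * δ zero a ≈ 0# → B i a ≈ δ i a
    B≈δ e = trans (+-congˡ e) (+-identityʳ _)
    B₀≈δ₀ : ∀ a → B zero a ≈ δ zero a
    B₀≈δ₀ a = B≈δ {zero} {a} (trans (*-congʳ c₀≈0) (zeroˡ _))
    zeros : ∀ {x y z} → x ≈ 0# → y ≈ 0# → x * z ≈ 1# * (y * z)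
    zeros {x} {y} {z} p q = trans (trans (*-congʳ p) (zeroˡ z))
      (sym (trans (*-identityˡ _) (trans (*-congʳ q) (zeroˡ z))))
    term : ∀ f → product (λ i → B i (f i)) * det (λ i → A (f i)) ≈ 1# * (product (λ i → δ i (f i)) * det (λ i → A (f i)))
    term f with f zero Finₚ.≟ zero
    ... | no n₀ = zeros (product-zero {f = λ i → B i (f i)} zero (trans (B₀≈δ₀ (f zero)) e)) (product-zero {f = λ i → δ i (f i)} zero e)
      where e = δ-off (n₀ ∘ ≡.sym)
    ... | yes p₀ with Finₚ.any? (λ i → f (suc i) Finₚ.≟ zero)
    ...   | yes (i , pᵢ) = trans (trans (*-congˡ e) (zeroʳ _)) (sym (trans (*-identityˡ _) (trans (*-congˡ e) (zeroʳ _))))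
      where e = det-repeat A f zero (suc i) (λ ()) (≡.trans p₀ (≡.sym pᵢ))
    ...   | no none = trans (*-congʳ (*-cong (B₀≈δ₀ (f zero))
              (product-cong λ i → B≈δ {suc i} {f (suc i)} (trans (*-congˡ (δ-off λ e → none (i , ≡.sym e))) (zeroʳ _)))))
            (sym (*-identityˡ _))

  -- Scaling row i by 0 and all other rows by 1 leaves A unchanged and multiplies the determinant by
  -- 0.
  det-zero-row : ∀ {n} (A : Matrix n n) i → (∀ j → A i j ≈ 0#) → det A ≈ 0#
  det-zero-row A i h = begin
    det A                                  ≈⟨ det-cong (λ k j → sym (scaled k j)) ⟩
    det (λ k j → (1# - δ i k) * A k j)     ≈⟨ det-scale-rows (λ k → 1# - δ i k) A ⟩
    product (λ k → 1# - δ i k) * det A     ≈⟨ *-congʳ (product-zero i (trans (+-congˡ (-‿cong (δ-diag i))) (-‿inverseʳ 1#))) ⟩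
    0# * det A                             ≈⟨ zeroˡ _ ⟩
    0#                                     ∎
    where
    open ≈R
    scaled : ∀ k j → (1# - δ i k) * A k j ≈ A k j
    scaled k j with i Finₚ.≟ k
    ... | yes ≡.refl = trans (*-congˡ (h j)) (trans (zeroʳ _) (sym (h j)))
    ... | no n = trans (*-congʳ (+-congˡ (-‿cong (δ-off n)))) (solve 1 (λ x → (:1 :- :0) :* x := x) refl (A k j))

  product-single : ∀ {n} {f : Fin n → Carrier} i → (∀ j → ¬ (j ≡ i) → f j ≈ 1#) → product f ≈ f i
  product-single zero    h = trans (*-congˡ (product-ones λ j → h (suc j) λ ())) (*-identityʳ _)
    where
    product-ones : ∀ {n} {f : Fin n → Carrier} → (∀ j → f j ≈ 1#) → product f ≈ 1#
    product-ones {zero}  h = refl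
    product-ones {suc n} h = trans (*-cong (h zero) (product-ones (h ∘ suc))) (*-identityˡ 1#)
  product-single (suc i) h = trans (*-cong (h zero λ ()) (product-single i λ j n → h (suc j) (n ∘ Finₚ.suc-injective))) (*-identityˡ _)

  -- Replacing row i₀ of the identity by c gives a matrix `B` of determinant c i₀, and row i₀ of `B`
  -- ⊗ A is the vanishing combination.
  det-dependent-rows : ∀ {n} (A : Matrix n n) (c : Vec n) → (∀ j → sum (λ i → c i * A i j) ≈ 0#) →
    ∀ i → c i * det A ≈ 0#
  det-dependent-rows {n} A c h i₀ = trans (sym (det-⊗-by B A (c i₀) term)) (det-zero-row (B ⊗ A) i₀ B⊗A≈0)
    where
    row : ∀ {i} → Dec (i ≡ i₀) → Vec n
    row     (yes _) = c
    row {i} (no _)  = δ i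
    B : Matrix n n
    B i = row (i Finₚ.≟ i₀)
    B-at : ∀ a → B i₀ a ≈ c a
    B-at a with i₀ Finₚ.≟ i₀
    ... | yes _ = refl
    ... | no n  = ⊥-elim (n ≡.refl)
    B-off : ∀ {i} → ¬ (i ≡ i₀) → ∀ a → B i a ≈ δ i a
    B-off {i} n a with i Finₚ.≟ i₀
    ... | yes e = ⊥-elim (n e)
    ... | no _  = refl
    B⊗A≈0 : ∀ j → (B ⊗ A) i₀ j ≈ 0#
    B⊗A≈0 j = trans (sum-cong λ a → *-congʳ {x = A a j} (B-at a)) (h j)
    term : ∀ f → product (λ i → B i (f i)) * det (λ i → A (f i)) ≈ c i₀ * (product (λ i → δ i (f i)) * det (λ i → A (f i)))
    -- Outside i₀ the rows of `B` are those of `δ`, so only an f fixing every other index can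
    -- contribute; if it moves i₀ as well, a row of A is repeated.
    term f with Finₚ.any? (λ i → ¬? (i Finₚ.≟ i₀) ×-dec ¬? (f i Finₚ.≟ i))
    ... | yes (i , i≢i₀ , fi≢i) =
      trans (trans (*-congʳ (product-zero i (trans (B-off i≢i₀ (f i)) e))) (zeroˡ _))
        (sym (trans (*-congˡ (trans (*-congʳ (product-zero i e)) (zeroˡ _))) (zeroʳ _)))
      where e = δ-off (fi≢i ∘ ≡.sym)
    ... | no none with f i₀ Finₚ.≟ i₀
    ...   | no n = trans (trans (*-congˡ e) (zeroʳ _)) (sym (trans (*-congˡ (trans (*-congˡ e) (zeroʳ _))) (zeroʳ _)))
      where
      e = det-repeat A f i₀ (f i₀) (n ∘ ≡.sym)
        (≡.sym (decidable-stable (f (f i₀) Finₚ.≟ f i₀) λ q → none (f i₀ , n , q)))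
    ...   | yes p = trans (*-congʳ (trans (product-single i₀ offB) (trans (B-at (f i₀)) (reflexive (≡.cong c p)))))
            (*-congˡ (sym (trans (*-congʳ (trans (product-single i₀ λ j n → trans (sym (B-off n (f j))) (offB j n))
              (trans (reflexive (≡.cong (δ i₀) p)) (δ-diag i₀)))) (*-identityˡ _))))
      where
      offB : ∀ j → ¬ (j ≡ i₀) → B j (f j) ≈ 1#
      offB j n = trans (B-off n (f j)) (trans (reflexive (≡.cong (δ j)
        (decidable-stable (f j Finₚ.≟ j) λ q → none (j , n , q)))) (δ-diag j))

  det≉0⇒independent : ∀ {n} (A : Matrix n n) → ¬ (det A ≈ 0#) → LinearlyIndependent (column A)
  det≉0⇒independent A d≉0 c h j with c j ≈? 0#
  ... | yes e = e
  ... | no n  = ⊥-elim (d≉0 (trans (sym (det-ᵀ A)) (x²≤0⇒x≈0 (≤-reflexive (begin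
    d * d                       ≈⟨ *-identityˡ _ ⟨
    1# * (d * d)                ≈⟨ *-congʳ (*-inverseʳ (c j) n) ⟨
    c j * c j ⁻¹ * (d * d)      ≈⟨ solve 3 (λ c e d → c :* e :* (d :* d) := c :* d :* (e :* d)) refl (c j) (c j ⁻¹) d ⟩
    c j * d * (c j ⁻¹ * d)      ≈⟨ *-congʳ (det-dependent-rows (A ᵀ) c h j) ⟩
    0# * (c j ⁻¹ * d)           ≈⟨ zeroˡ _ ⟩
    0#                          ∎)))))
    where
    open ≈R
    d = det (A ᵀ)

  -- Schur complements and Gram determinants

  schurComplement : ∀ {n} → Matrix (suc n) (suc n) → Matrix n n
  schurComplement A i j = A (suc i) (suc j) - A (suc i) zero * A zero zero ⁻¹ * A zero (suc j)

  det-schurComplement : ∀ {n} (A : Matrix (suc n) (suc n)) → 0# < A zero zero →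
    det A ≈ A zero zero * det (schurComplement A)
  det-schurComplement {n} A 0<a = begin
    det A                                           ≈⟨ det-add-first-row c A refl ⟨
    det A′                                          ≈⟨ det-column-expansion A′ ⟩
    _                                               ≈⟨ +-cong (*-identityˡ _) (sum-zero {n} λ i →
         trans (*-congˡ {x = sign (suc (toℕ i))} (trans (*-congʳ {x = det λ k l → A′ (punchIn (suc i) k) (suc l)} (cleared i)) (zeroˡ _)))
           (zeroʳ (sign (suc (toℕ i))))) ⟩
    A′ zero zero * det (λ k l → A′ (suc k) (suc l)) + 0#
                                                    ≈⟨ +-identityʳ _ ⟩
    A′ zero zero * det (λ k l → A′ (suc k) (suc l)) ≈⟨ *-cong (trans (+-congˡ (zeroˡ a)) (+-identityʳ a))
         (det-cong λ i j → solve 4 (λ x b e y → x :+ :- (b :* e) :* y := x :- b :* e :* y) refl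
           (A (suc i) (suc j)) (A (suc i) zero) (a ⁻¹) (A zero (suc j))) ⟩
    a * det (schurComplement A)                     ∎
    where
    open ≈R
    a = A zero zero
    c : Vec (suc n)
    c zero    = 0#
    c (suc i) = - (A (suc i) zero * a ⁻¹)
    A′ : Matrix (suc n) (suc n)
    A′ i j = A i j + c i * A zero j
    cleared : ∀ i → A′ (suc i) zero ≈ 0#
    cleared i = trans (solve 3 (λ b e a → b :+ :- (b :* e) :* a := b :* (:1 :- a :* e)) refl (A (suc i) zero) (a ⁻¹) a)
      (trans (*-congˡ (trans (+-congˡ (-‿cong (*-inverse 0<a))) (-‿inverseʳ 1#))) (zeroʳ _))

  infixr 7 _⊛_
  _⊛_ : ∀ {m n} → Matrix m n → Vec n → Vec m
  (M ⊛ v) i = sum λ j → M i j * v j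

  normSq : ∀ {n} → Vec n → Carrier
  normSq v = sum λ i → v i * v i

  normSq-cong : ∀ {n} {u v : Vec n} → (∀ i → u i ≈ v i) → normSq u ≈ normSq v
  normSq-cong h = sum-cong λ i → *-cong (h i) (h i)

  normSq-nonneg : ∀ {n} (v : Vec n) → 0# ≤ normSq v
  normSq-nonneg v = sum-nonneg λ i → 0≤x² (v i)

  sum-*-assoc : ∀ {m n} (x : Vec m) (M : Matrix m n) (y : Vec n) →
    sum (λ i → x i * (M ⊛ y) i) ≈ sum λ a → sum (λ i → x i * M i a) * y a
  sum-*-assoc x M y = begin
    sum (λ i → x i * sum λ a → M i a * y a)
      ≈⟨ sum-cong (λ i → trans (*-distribˡ-sum (x i) λ a → M i a * y a) (sum-cong λ a → sym (*-assoc (x i) (M i a) (y a)))) ⟩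
    sum (λ i → sum λ a → x i * M i a * y a)
      ≈⟨ ∑-comm (λ i a → x i * M i a * y a) ⟩
    sum (λ a → sum λ i → x i * M i a * y a)
      ≈⟨ sum-cong (λ a → *-distribʳ-sum (y a) λ i → x i * M i a) ⟨
    sum (λ a → sum (λ i → x i * M i a) * y a) ∎
    where open ≈R

  ⊗-assoc : ∀ {m n p q} (A : Matrix m n) (B : Matrix n p) (C : Matrix p q) → ((A ⊗ B) ⊗ C) ≋ (A ⊗ (B ⊗ C))
  ⊗-assoc A B C i j = sym (sum-*-assoc (A i) B (column C j))

  ⊗-cong : ∀ {m n p} {A A′ : Matrix m n} {B B′ : Matrix n p} → A ≋ A′ → B ≋ B′ → (A ⊗ B) ≋ (A′ ⊗ B′)
  ⊗-cong h k i j = sum-cong λ l → *-cong (h i l) (k l j)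

  sum-δʳ : ∀ {n} (x : Vec n) (i : Fin n) → sum (λ l → x l * δ i l) ≈ x i
  sum-δʳ x i = trans (sum-cong λ l → *-comm (x l) (δ i l)) (sum-δ i x)

  ⊗-identityʳ : ∀ {m n} (A : Matrix m n) → (A ⊗ δ) ≋ A
  ⊗-identityʳ A i j = trans (sum-cong λ l → *-congˡ {x = A i l} (δ-sym l j)) (sum-δʳ (A i) j)

  gram : ∀ {m n} → Matrix m n → Matrix n n
  gram Z = (Z ᵀ) ⊗ Z

  gram-sym : ∀ {m n} (Z : Matrix m n) i j → gram Z i j ≈ gram Z j i
  gram-sym Z i j = sum-cong λ a → *-comm (Z a i) (Z a j)

  quad : ∀ {n} → Matrix n n → Vec n → Carrier
  quad G c = sum λ i → c i * (G ⊛ c) i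

  quad-gram : ∀ {m n} (Z : Matrix m n) c → quad (gram Z) c ≈ normSq (Z ⊛ c)
  quad-gram Z c = begin
    sum (λ i → c i * (gram Z ⊛ c) i)            ≈⟨ sum-cong (λ i → *-congˡ {x = c i} (sum-*-assoc ((Z ᵀ) i) Z c)) ⟨
    sum (λ i → c i * ((Z ᵀ) ⊛ (Z ⊛ c)) i)       ≈⟨ sum-*-assoc c (Z ᵀ) (Z ⊛ c) ⟩
    sum (λ a → sum (λ i → c i * Z a i) * (Z ⊛ c) a)
      ≈⟨ sum-cong (λ a → *-congʳ {x = (Z ⊛ c) a} (sum-cong λ i → *-comm (c i) (Z a i))) ⟩
    normSq (Z ⊛ c) ∎
    where open ≈R

  -- The minimum of a quadratic form over the first coordinate is the form of the Schur complement.
  quad-schurComplement : ∀ {n} (G : Matrix (suc n) (suc n)) → (∀ i j → G i j ≈ G j i) → 0# < G zero zero →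
    ∀ c → ∃ λ c₀ → quad G (c₀ ∷ c) ≈ quad (schurComplement G) c
  quad-schurComplement {n} G symG 0<a c = c₀ , (begin
    c₀ * (a * c₀ + β) + sum (λ i → c i * (G (suc i) zero * c₀ + R i))
      ≈⟨ +-cong (trans (*-congˡ (trans (+-congʳ ac₀) (-‿inverseˡ β))) (zeroʳ c₀))
           (trans (sum-cong λ i → solve 4 (λ c g z r → c :* (g :* z :+ r) := g :* c :* z :+ c :* r) refl (c i) (G (suc i) zero) c₀ (R i))
           (trans (∑-distrib-+ (λ i → G (suc i) zero * c i * c₀) (λ i → c i * R i))
             (+-congʳ (trans (sym (*-distribʳ-sum c₀ λ i → G (suc i) zero * c i)) (*-congʳ colβ))))) ⟩
    0# + (β * c₀ + P)
      ≈⟨ solve 3 (λ b e p → :0 :+ (b :* :- (b :* e) :+ p) := p :+ b :* :- (e :* b)) refl β (a ⁻¹) P ⟩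
    P + β * - (a ⁻¹ * β)
      ≈⟨ +-congˡ (trans (*-congʳ (sym colβ)) (*-distribʳ-sum (- (a ⁻¹ * β)) λ i → G (suc i) zero * c i)) ⟩
    P + sum (λ i → G (suc i) zero * c i * - (a ⁻¹ * β))
      ≈⟨ ∑-distrib-+ (λ i → c i * R i) (λ i → G (suc i) zero * c i * - (a ⁻¹ * β)) ⟨
    sum (λ i → c i * R i + G (suc i) zero * c i * - (a ⁻¹ * β))
      ≈⟨ sum-cong row ⟩
    quad (schurComplement G) c ∎)
    where
    open ≈R
    a = G zero zero
    β = sum λ j → G zero (suc j) * c j
    R : Vec n
    R i = sum λ j → G (suc i) (suc j) * c j
    P = sum λ i → c i * R i
    c₀ = - (β * a ⁻¹)
    ac₀ : a * c₀ ≈ - β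
    ac₀ = trans (solve 2 (λ a x → a :* :- x := :- (a :* x)) refl a (β * a ⁻¹)) (-‿cong (x*y*x⁻¹≈y β 0<a))
    colβ : sum (λ i → G (suc i) zero * c i) ≈ β
    colβ = sum-cong λ i → *-congʳ (symG (suc i) zero)
    row : ∀ i → c i * R i + G (suc i) zero * c i * - (a ⁻¹ * β) ≈ c i * (schurComplement G ⊛ c) i
    row i = begin
      c i * R i + G (suc i) zero * c i * - (a ⁻¹ * β)
        ≈⟨ solve 5 (λ c r g e b → c :* r :+ g :* c :* :- (e :* b) := c :* (r :+ :- (g :* e) :* b)) refl (c i) (R i) (G (suc i) zero) (a ⁻¹) β ⟩
      c i * (R i + - (G (suc i) zero * a ⁻¹) * β)
        ≈⟨ *-congˡ (+-congˡ (*-distribˡ-sum (- (G (suc i) zero * a ⁻¹)) λ j → G zero (suc j) * c j)) ⟩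
      c i * (R i + sum λ j → - (G (suc i) zero * a ⁻¹) * (G zero (suc j) * c j))
        ≈⟨ *-congˡ (∑-distrib-+ (λ j → G (suc i) (suc j) * c j) (λ j → - (G (suc i) zero * a ⁻¹) * (G zero (suc j) * c j))) ⟨
      c i * sum (λ j → G (suc i) (suc j) * c j + - (G (suc i) zero * a ⁻¹) * (G zero (suc j) * c j))
        ≈⟨ *-congˡ (sum-cong λ j → solve 5 (λ g h e k c → g :* c :+ :- (h :* e) :* (k :* c) := (g :- h :* e :* k) :* c) refl
             (G (suc i) (suc j)) (G (suc i) zero) (a ⁻¹) (G zero (suc j)) (c j)) ⟩
      c i * (schurComplement G ⊛ c) i ∎

  schurComplement-sym : ∀ {n} {G : Matrix (suc n) (suc n)} → (∀ i j → G i j ≈ G j i) →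
    ∀ i j → schurComplement G i j ≈ schurComplement G j i
  schurComplement-sym {G = G} symG i j = +-cong (symG (suc i) (suc j)) (-‿cong (trans
    (*-cong (*-congʳ (symG (suc i) zero)) (symG zero (suc j)))
    (solve 3 (λ x e y → x :* e :* y := y :* e :* x) refl (G zero (suc i)) (G zero zero ⁻¹) (G (suc j) zero))))

  quad-δ : ∀ {n} (G : Matrix n n) i → quad G (δ i) ≈ G i i
  quad-δ G i = trans (sum-δ i (G ⊛ δ i)) (sum-δʳ (G i) i)

  -- The first basis vector shows that the pivot is at least t. The form of the Schur complement
  -- takes values of the form of G at suitable longer vectors, so it inherits the lower bound. This
  -- replaces the product of the eigenvalues.
  det-≥-^ : ∀ {n} (G : Matrix n n) {t} → 0# < t → (∀ i j → G i j ≈ G j i) →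
    (∀ c → t * normSq c ≤ quad G c) → t ^ n ≤ det G
  det-≥-^ {zero}  G 0<t symG h = ≤-refl
  det-≥-^ {suc n} G {t} 0<t symG h = ≤-respʳ-≈ (sym (det-schurComplement G 0<a))
    (*-mono-≤ (<⇒≤ 0<t) t≤a (^-nonneg n (<⇒≤ 0<t)) (det-≥-^ (schurComplement G) 0<t (schurComplement-sym {G = G} symG) h′))
    where
    t≤a : t ≤ G zero zero
    t≤a = ≤-respˡ-≈ (trans (*-congˡ {x = t} (trans (sum-δ {suc n} zero (δ zero)) (δ-diag {suc n} zero))) (*-identityʳ t))
      (≤-respʳ-≈ (quad-δ G zero) (h (δ zero)))
    0<a = <-≤-trans 0<t t≤a
    h′ : ∀ c → t * normSq c ≤ quad (schurComplement G) c
    h′ c = let (c₀ , e) = quad-schurComplement G symG 0<a c in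
      ≤-respʳ-≈ e (≤-trans (*-monoˡ-≤ (<⇒≤ 0<t) (y≤x+y (0≤x² c₀))) (h (c₀ ∷ c)))

  psd-cauchy-schwarz : ∀ {n} (G : Matrix n n) → (∀ i j → G i j ≈ G j i) → (∀ c → 0# ≤ quad G c) →
    ∀ i j → G i j * G i j ≤ G i i * G j j
  psd-cauchy-schwarz {n} G symG h i j = discriminant (≤-respʳ-≈ (quad-δ G i) (h (δ i))) λ t → ≤-respʳ-≈ (expansion t) (h (v t))
    where
    open ≈R
    v : Carrier → Vec n
    v t l = δ j l - t * δ i l
    pair : ∀ t x → sum (λ l → v t l * x l) ≈ x j - t * x i
    pair t x = begin
      sum (λ l → (δ j l - t * δ i l) * x l)
        ≈⟨ sum-cong (λ l → solve 4 (λ d t e x → (d :- t :* e) :* x := d :* x :+ :- t :* (e :* x)) refl (δ j l) t (δ i l) (x l)) ⟩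
      sum (λ l → δ j l * x l + - t * (δ i l * x l))
        ≈⟨ ∑-distrib-+ (λ l → δ j l * x l) (λ l → - t * (δ i l * x l)) ⟩
      sum (λ l → δ j l * x l) + sum (λ l → - t * (δ i l * x l))
        ≈⟨ +-cong (sum-δ j x) (trans (sym (*-distribˡ-sum (- t) λ l → δ i l * x l)) (*-congˡ (sum-δ i x))) ⟩
      x j + - t * x i
        ≈⟨ solve 3 (λ a t b → a :+ :- t :* b := a :- t :* b) refl (x j) t (x i) ⟩
      x j - t * x i ∎
    Gv : ∀ t k → (G ⊛ v t) k ≈ G k j - t * G k i
    Gv t k = trans (sum-cong λ l → *-comm (G k l) (v t l)) (pair t (G k))
    expansion : ∀ t → quad G (v t) ≈ G j j - 2# * t * G i j + t * t * G i i
    expansion t = begin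
      quad G (v t)                                       ≈⟨ pair t (G ⊛ v t) ⟩
      (G ⊛ v t) j - t * (G ⊛ v t) i                      ≈⟨ +-cong (Gv t j) (-‿cong (*-congˡ (Gv t i))) ⟩
      (G j j - t * G j i) - t * (G i j - t * G i i)      ≈⟨ +-congʳ (+-congˡ (-‿cong (*-congˡ (symG j i)))) ⟩
      (G j j - t * G i j) - t * (G i j - t * G i i)
        ≈⟨ solve 4 (λ y t s x → (y :- t :* s) :- t :* (s :- t :* x) := y :- :2 :* t :* s :+ t :* t :* x) refl (G j j) t (G i j) (G i i) ⟩
      G j j - 2# * t * G i j + t * t * G i i ∎

  -- Eliminating a positive pivot only lowers the remaining diagonal entries. A pivot 0 makes the
  -- whole first row vanish by `psd-cauchy-schwarz`, and then both sides are 0.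
  hadamard : ∀ {n} (G : Matrix n n) → (∀ i j → G i j ≈ G j i) → (∀ c → 0# ≤ quad G c) →
    det G ≤ product λ i → G i i
  hadamard {zero}  G symG h = ≤-refl
  hadamard {suc n} G symG h with ≤-respʳ-≈ (quad-δ G zero) (h (δ zero))
  ... | inj₂ 0≈a = ≤-reflexive (trans (det-zero-row G zero λ j → x²≤0⇒x≈0 (≤-respʳ-≈
          (trans (*-congʳ (sym 0≈a)) (zeroˡ _)) (psd-cauchy-schwarz G symG h zero j)))
        (sym (product-zero {f = λ i → G i i} zero (sym 0≈a))))
  ... | inj₁ 0<a = ≤-respˡ-≈ (sym (det-schurComplement G 0<a)) (*-monoˡ-≤ (<⇒≤ 0<a)
        (≤-trans (hadamard (schurComplement G) (schurComplement-sym {G = G} symG) h′)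
          (product-mono-≤ (λ i → ≤-respʳ-≈ (quad-δ (schurComplement G) i) (h′ (δ i))) diag)))
    where
    h′ : ∀ c → 0# ≤ quad (schurComplement G) c
    h′ c = let (c₀ , e) = quad-schurComplement G symG 0<a c in
      ≤-respʳ-≈ e (h (c₀ ∷ c))
    diag : ∀ i → schurComplement G i i ≤ G (suc i) (suc i)
    diag i = ≤-by (trans
        (solve 4 (λ g b e d → g :- (g :- b :* e :* d) := e :* (b :* d)) refl
          (G (suc i) (suc i)) (G (suc i) zero) (G zero zero ⁻¹) (G zero (suc i)))
        (*-congˡ (*-congˡ (symG zero (suc i)))))
      (*-nonneg (<⇒≤ (⁻¹-pos 0<a)) (0≤x² _))

  det-gram-nonneg : ∀ {k p} (Z : Matrix p k) → 0# ≤ det (gram Z)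
  det-gram-nonneg {k} Z = *-cancelˡ-≤ (fromℕ!-pos k) (≤-respˡ-≈ (sym (zeroʳ _))
    (≤-respʳ-≈ (sym (cauchy-binet-gram Z)) (∑→-nonneg k λ f → 0≤x² (det λ i → Z (f i)))))

  det-gram-≤ : ∀ {k p} (Z : Matrix p k) → det (gram Z) ≤ product λ j → normSq (column Z j)
  det-gram-≤ Z = hadamard (gram Z) (gram-sym Z) λ c → ≤-respʳ-≈ (sym (quad-gram Z c)) (normSq-nonneg (Z ⊛ c))

  det-⊗-hadamard : ∀ {k p} (B : Matrix k p) (C : Matrix p k) →
    det (B ⊗ C) * det (B ⊗ C) ≤ product (λ i → normSq (B i)) * product (λ j → normSq (column C j))
  det-⊗-hadamard B C = ≤-trans (det-⊗-≤ B C)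
    (*-mono-≤ (det-gram-nonneg (B ᵀ)) (det-gram-≤ (B ᵀ)) (det-gram-nonneg C) (det-gram-≤ C))

  -- Both index maps range over all functions, so each minor of k distinct rows and columns is
  -- counted k!² times. This is the origin of the two factors k! in the bounds against it.
  minorSqSum : ∀ {m n} → ℕ → Matrix m n → Carrier
  minorSqSum k M = ∑→ k λ f → ∑→ k λ g → det (λ i j → M (f i) (g j)) * det (λ i j → M (f i) (g j))

  -- Cauchy-Binet splits the Gram determinant over choices f of rows. For each f, Cauchy-Binet and
  -- Cauchy-Schwarz separate the minors of M from those of X, and the squared minors of an
  -- orthonormal X sum to k!.
  det-gram-orthonormal-≤ : ∀ {m n k} (M : Matrix m n) (X : Matrix n k) → gram X ≋ δ →
    fromℕ (k !) * fromℕ (k !) * det (gram (M ⊗ X)) ≤ minorSqSum k M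
  det-gram-orthonormal-≤ {k = k} M X orth = begin
    k! * k! * det (gram (M ⊗ X))                 ≈⟨ *-assoc _ _ _ ⟩
    k! * (k! * det (gram (M ⊗ X)))               ≈⟨ *-congˡ (cauchy-binet-gram (M ⊗ X)) ⟩
    k! * ∑→ k (λ f → d f * d f)                  ≈⟨ *-distribˡ-∑→ k k! (λ f → d f * d f) ⟩
    ∑→ k (λ f → k! * (d f * d f))                ≤⟨ ∑→-mono-≤ k each ⟩
    minorSqSum k M                               ∎
    where
    open ≤R
    k! = fromℕ (k !)
    d : _ → Carrier
    d f = det ((λ i → M (f i)) ⊗ X)
    each : ∀ f → k! * (d f * d f) ≤ ∑→ k λ g → det (λ i j → M (f i) (g j)) * det (λ i j → M (f i) (g j))
    each f = *-cancelˡ-≤ (fromℕ!-pos k) (begin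
      k! * (k! * (d f * d f))       ≈⟨ solve 2 (λ n d → n :* (n :* (d :* d)) := (n :* d) :* (n :* d)) refl k! (d f) ⟩
      k! * d f * (k! * d f)         ≈⟨ *-cong (cauchy-binet (λ i → M (f i)) X) (cauchy-binet (λ i → M (f i)) X) ⟩
      _                             ≤⟨ ∑→-cauchy-schwarz k (λ g → det (λ i j → M (f i) (g j))) (λ g → det (λ i → X (g i))) ⟩
      S * ∑→ k (λ g → det (λ i → X (g i)) * det (λ i → X (g i)))
                                    ≈⟨ *-congˡ (trans (sym (cauchy-binet-gram X)) (*-congˡ (trans (det-cong orth) (det-δ k)))) ⟩
      S * (k! * 1#)                 ≈⟨ solve 2 (λ s n → s :* (n :* :1) := n :* s) refl S k! ⟩
      k! * S                        ∎)
      where S = ∑→ k λ g → det (λ i j → M (f i) (g j)) * det (λ i j → M (f i) (g j))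

  -- Orthonormal systems and reflections

  Orthonormal : ∀ {m n} → Matrix m n → Set
  Orthonormal X = gram X ≋ δ

  normSq-scale : ∀ {n} x (v : Vec n) → normSq (λ i → x * v i) ≈ x * x * normSq v
  normSq-scale x v = trans (sum-cong λ i → solve 2 (λ x v → x :* v :* (x :* v) := x :* x :* (v :* v)) refl x (v i))
    (sym (*-distribˡ-sum (x * x) λ i → v i * v i))

  ⊛-scale : ∀ {m n} (Z : Matrix m n) x v i → (Z ⊛ (λ j → x * v j)) i ≈ x * (Z ⊛ v) i
  ⊛-scale Z x v i = trans (sum-cong λ j → solve 3 (λ z x v → z :* (x :* v) := x :* (z :* v)) refl (Z i j) x (v j))
    (sym (*-distribˡ-sum x λ j → Z i j * v j))

  orthonormal-isometry : ∀ {m n} {Z : Matrix m n} → Orthonormal Z → ∀ c → normSq (Z ⊛ c) ≈ normSq c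
  orthonormal-isometry {Z = Z} orth c = trans (sym (quad-gram Z c)) (sum-cong λ i → *-congˡ
    (trans (sum-cong λ j → *-congʳ (orth i j)) (sum-δ i c)))

  orthonormal-⊗ : ∀ {m n p} {X : Matrix m n} {H : Matrix n p} → Orthonormal X → Orthonormal H → Orthonormal (X ⊗ H)
  orthonormal-⊗ {X = X} {H} orthX orthH i j = begin
    gram (X ⊗ H) i j
      ≈⟨ ⊗-cong {A′ = (H ᵀ) ⊗ (X ᵀ)} {B = X ⊗ H} (λ k a → sum-cong λ l → *-comm (X a l) (H l k)) (λ _ _ → refl) i j ⟩
    (((H ᵀ) ⊗ (X ᵀ)) ⊗ (X ⊗ H)) i j    ≈⟨ ⊗-assoc (H ᵀ) (X ᵀ) (X ⊗ H) i j ⟩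
    ((H ᵀ) ⊗ ((X ᵀ) ⊗ (X ⊗ H))) i j    ≈⟨ ⊗-cong {A = H ᵀ} (λ _ _ → refl) (⊗-assoc (X ᵀ) X H) i j ⟨
    ((H ᵀ) ⊗ (gram X ⊗ H)) i j
      ≈⟨ ⊗-cong {A = H ᵀ} (λ _ _ → refl) (λ k l → trans (sum-cong λ a → *-congʳ {x = H a l} (orthX k a)) (sum-δ k (column H l))) i j ⟩
    gram H i j                         ≈⟨ orthH i j ⟩
    δ i j                              ∎
    where open ≈R

  -- The reflection exchanging c and the first basis vector; c₀ ≤ 0 keeps the two apart.
  module Householder {n} (c : Vec (suc n)) (‖c‖≈1 : normSq c ≈ 1#) (c₀≤0 : c zero ≤ 0#) where

    private
      0<1-c₀ : 0# < 1# - c zero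
      0<1-c₀ = 0<y-x (≤-<-trans c₀≤0 0<1)

      s = (1# - c zero) ⁻¹

      w : Vec (suc n)
      w i = c i - δ zero i

    H : Matrix (suc n) (suc n)
    H i j = δ j i - s * w j * w i

    private
      W = normSq w

      W≈ : W ≈ 2# * (1# - c zero)
      W≈ = begin
        sum (λ i → (c i - δ zero i) * (c i - δ zero i))
          ≈⟨ sum-cong (λ i → solve 2 (λ c d → (c :- d) :* (c :- d) := c :* c :+ d :* (d :- :2 :* c)) refl (c i) (δ zero i)) ⟩
        sum (λ i → c i * c i + δ zero i * (δ zero i - 2# * c i))
          ≈⟨ ∑-distrib-+ (λ i → c i * c i) (λ i → δ zero i * (δ zero i - 2# * c i)) ⟩
        normSq c + sum (λ i → δ zero i * (δ zero i - 2# * c i))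
          ≈⟨ +-cong ‖c‖≈1 (sum-δ zero λ i → δ zero i - 2# * c i) ⟩
        1# + (1# - 2# * c zero)
          ≈⟨ solve 1 (λ c → :1 :+ (:1 :- :2 :* c) := :2 :* (:1 :- c)) refl (c zero) ⟩
        2# * (1# - c zero) ∎
        where open ≈R

      sW : s * W ≈ 2#
      sW = trans (*-congˡ W≈) (trans (solve 3 (λ s u c → s :* (u :* c) := u :* (c :* s)) refl s 2# (1# - c zero))
        (trans (*-congˡ (*-inverse 0<1-c₀)) (*-identityʳ 2#)))

      pair : ∀ i x → sum (λ a → H a i * x a) ≈ x i - s * w i * sum (λ a → w a * x a)
      pair i x = begin
        sum (λ a → (δ i a - s * w i * w a) * x a)
          ≈⟨ sum-cong (λ a → solve 4 (λ d t w x → (d :- t :* w) :* x := d :* x :+ :- t :* (w :* x)) refl (δ i a) (s * w i) (w a) (x a)) ⟩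
        sum (λ a → δ i a * x a + - (s * w i) * (w a * x a))
          ≈⟨ ∑-distrib-+ (λ a → δ i a * x a) (λ a → - (s * w i) * (w a * x a)) ⟩
        sum (λ a → δ i a * x a) + sum (λ a → - (s * w i) * (w a * x a))
          ≈⟨ +-cong (sum-δ i x) (sym (*-distribˡ-sum (- (s * w i)) λ a → w a * x a)) ⟩
        x i + - (s * w i) * sum (λ a → w a * x a)
          ≈⟨ solve 3 (λ x t y → x :+ :- t :* y := x :- t :* y) refl (x i) (s * w i) (sum (λ a → w a * x a)) ⟩
        x i - s * w i * sum (λ a → w a * x a) ∎
        where open ≈R

    H-sym : ∀ i j → H i j ≈ H j i
    H-sym i j = +-cong (δ-sym j i) (-‿cong (solve 3 (λ s x y → s :* x :* y := s :* y :* x) refl s (w j) (w i)))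

    H-orthonormal : Orthonormal H
    H-orthonormal i j = begin
      sum (λ a → H a i * H a j)
        ≈⟨ pair i (column H j) ⟩
      H i j - s * w i * sum (λ a → w a * H a j)
        ≈⟨ +-congˡ (-‿cong (*-congˡ (trans (sum-cong λ a → *-comm (w a) (H a j)) (pair j w)))) ⟩
      (δ j i - s * w j * w i) - s * w i * (w j - s * w j * W)
        ≈⟨ solve 5 (λ d s x y u → (d :- s :* y :* x) :- s :* x :* (y :- s :* y :* u) := d :- s :* x :* y :* (:2 :- s :* u)) refl
             (δ j i) s (w i) (w j) W ⟩
      δ j i - s * w i * w j * (2# - s * W)
        ≈⟨ +-congˡ (-‿cong (trans (*-congˡ (trans (+-congˡ (-‿cong sW)) (-‿inverseʳ 2#))) (zeroʳ _))) ⟩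
      δ j i - 0#
        ≈⟨ solve 1 (λ d → d :- :0 := d) refl (δ j i) ⟩
      δ j i
        ≈⟨ δ-sym j i ⟩
      δ i j ∎
      where open ≈R

    Hᵀ-orthonormal : Orthonormal (H ᵀ)
    Hᵀ-orthonormal i j = trans (sum-cong λ a → *-cong (H-sym i a) (H-sym j a)) (H-orthonormal i j)

    H⊗H≋δ : (H ⊗ H) ≋ δ
    H⊗H≋δ i j = trans (sum-cong λ a → *-congʳ {x = H a j} (H-sym i a)) (H-orthonormal i j)

    H-column₀ : ∀ i → H i zero ≈ c i
    H-column₀ i = begin
      δ zero i - s * (c zero - 1#) * (c i - δ zero i)
        ≈⟨ solve 4 (λ d s c x → d :- s :* (c :- :1) :* (x :- d) := d :+ (:1 :- c) :* s :* (x :- d)) refl (δ zero i) s (c zero) (c i) ⟩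
      δ zero i + (1# - c zero) * s * (c i - δ zero i)
        ≈⟨ +-congˡ (*-congʳ (*-inverse 0<1-c₀)) ⟩
      δ zero i + 1# * (c i - δ zero i)
        ≈⟨ solve 2 (λ d x → d :+ :1 :* (x :- d) := x) refl (δ zero i) (c i) ⟩
      c i ∎
      where open ≈R

  -- If no unit vector satisfied the bound, homogeneity would give ‖Zc‖² ≥ t ‖c‖² for all c, and
  -- `det-≥-^` the excluded determinant bound. Replacing c by its negative arranges the sign that
  -- the reflection requires.
  small-unit-vector : ∀ {m k} (Z : Matrix m (suc k)) {t} → 0# < t → ¬ (t ^ suc k ≤ det (gram Z)) →
    ∃ λ c → normSq c ≈ 1# × c zero ≤ 0# × normSq (Z ⊛ c) ≤ t
  small-unit-vector {k = k} Z {t} 0<t ¬det with em {∃ λ c → normSq c ≈ 1# × normSq (Z ⊛ c) ≤ t}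
  ... | yes (c , unit , small) = [ (λ p → c , unit , p , small) , flip ]′ (≤-total (c zero) 0#)
    where
    -1² : ∀ x → - 1# * - 1# * x ≈ x
    -1² = solve 1 (λ x → :- :1 :* :- :1 :* x := x) refl
    flip : 0# ≤ c zero → ∃ λ c → normSq c ≈ 1# × c zero ≤ 0# × normSq (Z ⊛ c) ≤ t
    flip p = (λ i → - 1# * c i) , trans (normSq-scale (- 1#) c) (trans (-1² _) unit) ,
      ≤-by (solve 1 (λ x → :0 :- :- :1 :* x := x) refl (c zero)) p ,
      ≤-respˡ-≈ (sym (trans (normSq-cong (⊛-scale Z (- 1#) c)) (trans (normSq-scale (- 1#) (Z ⊛ c)) (-1² _)))) small
  ... | no none = ⊥-elim (¬det (det-≥-^ (gram Z) 0<t (gram-sym Z) λ c → ≤-respʳ-≈ (sym (quad-gram Z c)) (bound c (normSq-nonneg c))))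
    where
    open ≤R
    bound : ∀ c → 0# ≤ normSq c → t * normSq c ≤ normSq (Z ⊛ c)
    bound c (inj₂ e) = ≤-respˡ-≈ (trans (sym (zeroʳ t)) (*-congˡ e)) (normSq-nonneg (Z ⊛ c))
    bound c (inj₁ 0<N) = ≮⇒≥ λ p → none ((λ i → x * c i) , trans (normSq-scale x c) x²N ,
      (begin
        normSq (Z ⊛ λ i → x * c i)     ≈⟨ normSq-cong (⊛-scale Z x c) ⟩
        normSq (λ i → x * (Z ⊛ c) i)   ≈⟨ normSq-scale x (Z ⊛ c) ⟩
        x * x * normSq (Z ⊛ c)         ≤⟨ *-monoˡ-≤ (0≤x² x) (<⇒≤ p) ⟩
        x * x * (t * N)                ≈⟨ solve 3 (λ x t n → x :* x :* (t :* n) := t :* (x :* x :* n)) refl x t N ⟩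
        t * (x * x * N)                ≈⟨ *-congˡ x²N ⟩
        t * 1#                         ≈⟨ *-identityʳ t ⟩
        t                              ∎))
      where
      N = normSq c
      root-N = sqrt-exists 0<N
      l = proj₁ root-N
      x = l ⁻¹
      x²N : x * x * N ≈ 1#
      x²N = begin-equality
        x * x * N          ≈⟨ *-congˡ (proj₂ (proj₂ root-N)) ⟨
        x * x * (l * l)    ≈⟨ solve 2 (λ x l → x :* x :* (l :* l) := (l :* x) :* (l :* x)) refl x l ⟩
        l * x * (l * x)    ≈⟨ *-cong (*-inverse (proj₁ (proj₂ root-N))) (*-inverse (proj₁ (proj₂ root-N))) ⟩
        1# * 1#            ≈⟨ *-identityˡ 1# ⟩
        1#                 ∎

  -- Splitting off directions one at a time

  frobSq : ∀ {m n} → Matrix m n → Carrier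
  frobSq U = sum λ i → normSq (U i)

  -- A split-off direction costs σ k in the squared Frobenius norm of each of the two factors,
  -- whence the factor 2.
  total : (ℕ → Carrier) → ℕ → Carrier
  total σ zero    = 0#
  total σ (suc k) = total σ k + 2# * σ k

  -- A stand-in for the singular value decomposition: split off, one dimension at a time, a direction that M
  -- shrinks to length at most σ k; one exists as long as the (k+1)-minors of M are too small to prevent it.
  low-cost-factorization : ∀ {m n} (M : Matrix m n) (σ : ℕ → Carrier) → (∀ k → 0# < σ k) →
    (∀ k → minorSqSum (suc k) M < fromℕ (suc k !) * fromℕ (suc k !) * (σ k * σ k) ^ suc k) →
    ∀ k (X : Matrix n k) → Orthonormal X →
    Σ (Matrix m k) λ U → Σ (Matrix k k) λ V → (M ⊗ X) ≋ (U ⊗ V) × frobSq U + frobSq V ≤ total σ k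
  low-cost-factorization {m} M σ 0<σ small zero X orth = (λ _ ()) , (λ ()) , (λ _ ()) ,
    ≤-reflexive (trans (+-identityʳ _) (sum-zero {m} λ _ → refl))
  low-cost-factorization {m} {n} M σ 0<σ small (suc k) X orth = U , V , factor , cost
    where
    Z = M ⊗ X
    unit = small-unit-vector Z (*-pos (0<σ k) (0<σ k)) λ p → ≤⇒≯
      (≤-trans (*-monoˡ-≤ (*-nonneg (fromℕ-nonneg (suc k !)) (fromℕ-nonneg (suc k !))) p) (det-gram-orthonormal-≤ M X orth))
      (small k)
    c = proj₁ unit
    open Householder c (proj₁ (proj₂ unit)) (proj₁ (proj₂ (proj₂ unit)))
    -- The first column of Y is X c; the others form an orthonormal basis of its complement in the
    -- column space of X, to which the recursion applies.
    Y = X ⊗ H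
    X′ : Matrix n k
    X′ i j = Y i (suc j)
    rec = low-cost-factorization M σ 0<σ small k X′ λ i j → orthonormal-⊗ {X = X} {H} orth H-orthonormal (suc i) (suc j)
    U′ = proj₁ rec
    V′ = proj₁ (proj₂ rec)
    -- The rank-one part is the column u times the row c, with ‖u‖ ≤ σ k and ‖c‖ = 1. Dividing u and
    -- multiplying c by the square root of σ k balances it: each piece has squared norm at most σ k.
    √σ = sqrt-exists (0<σ k)
    l = proj₁ √σ
    0<l = proj₁ (proj₂ √σ)
    l²≈σ = proj₂ (proj₂ √σ)
    u : Vec m
    u = Z ⊛ c
    U : Matrix m (suc k)
    U i zero    = l ⁻¹ * u i
    U i (suc j) = U′ i j
    T : Matrix (suc k) (suc k)
    T zero    zero    = l
    T zero    (suc j) = 0#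
    T (suc i) zero    = 0#
    T (suc i) (suc j) = V′ i j
    V = T ⊗ H
    U⊗T : (M ⊗ Y) ≋ (U ⊗ T)
    U⊗T i zero = begin
      (M ⊗ Y) i zero                            ≈⟨ ⊗-assoc M X H i zero ⟨
      (Z ⊗ H) i zero                            ≈⟨ sum-cong (λ a → *-congˡ {x = Z i a} (H-column₀ a)) ⟩
      u i                                       ≈⟨ *-identityˡ _ ⟨
      1# * u i                                  ≈⟨ *-congʳ (*-inverse 0<l) ⟨
      l * l ⁻¹ * u i                            ≈⟨ solve 3 (λ l m u → l :* m :* u := m :* u :* l) refl l (l ⁻¹) (u i) ⟩
      l ⁻¹ * u i * l                            ≈⟨ +-identityʳ _ ⟨
      l ⁻¹ * u i * l + 0#                       ≈⟨ +-congˡ (sum-zero λ j → zeroʳ (U′ i j)) ⟨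
      (U ⊗ T) i zero                            ∎
      where open ≈R
    U⊗T i (suc j) = trans (proj₁ (proj₂ (proj₂ rec)) i j)
      (sym (trans (+-congʳ (zeroʳ (l ⁻¹ * u i))) (+-identityˡ _)))
    factor : (M ⊗ X) ≋ (U ⊗ V)
    factor i j = begin
      Z i j                        ≈⟨ ⊗-identityʳ Z i j ⟨
      (Z ⊗ δ) i j                  ≈⟨ ⊗-cong {A = Z} (λ _ _ → refl) H⊗H≋δ i j ⟨
      (Z ⊗ (H ⊗ H)) i j            ≈⟨ ⊗-assoc Z H H i j ⟨
      ((Z ⊗ H) ⊗ H) i j            ≈⟨ ⊗-cong {B = H} (⊗-assoc M X H) (λ _ _ → refl) i j ⟩
      ((M ⊗ Y) ⊗ H) i j            ≈⟨ ⊗-cong {B = H} U⊗T (λ _ _ → refl) i j ⟩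
      ((U ⊗ T) ⊗ H) i j            ≈⟨ ⊗-assoc U T H i j ⟩
      (U ⊗ V) i j                  ∎
      where open ≈R
    frobU : frobSq U ≤ σ k + frobSq U′
    frobU = begin
      sum (λ i → l ⁻¹ * u i * (l ⁻¹ * u i) + normSq (U′ i))
        ≈⟨ ∑-distrib-+ (λ i → l ⁻¹ * u i * (l ⁻¹ * u i)) (λ i → normSq (U′ i)) ⟩
      normSq (λ i → l ⁻¹ * u i) + frobSq U′
        ≈⟨ +-congʳ (normSq-scale (l ⁻¹) u) ⟩
      l ⁻¹ * l ⁻¹ * normSq u + frobSq U′
        ≤⟨ +-mono-≤ (*-monoˡ-≤ (0≤x² _) (proj₂ (proj₂ (proj₂ unit)))) ≤-refl ⟩
      l ⁻¹ * l ⁻¹ * (σ k * σ k) + frobSq U′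
        ≈⟨ +-congʳ (*-congˡ (*-congʳ l²≈σ)) ⟨
      l ⁻¹ * l ⁻¹ * (l * l * σ k) + frobSq U′
        ≈⟨ +-congʳ (solve 3 (λ m l s → m :* m :* (l :* l :* s) := (l :* m) :* (l :* m) :* s) refl (l ⁻¹) l (σ k)) ⟩
      l * l ⁻¹ * (l * l ⁻¹) * σ k + frobSq U′
        ≈⟨ +-congʳ (trans (*-congʳ (trans (*-cong (*-inverse 0<l) (*-inverse 0<l)) (*-identityˡ 1#))) (*-identityˡ _)) ⟩
      σ k + frobSq U′ ∎
      where open ≤R
    frobV : frobSq V ≈ σ k + frobSq V′
    frobV = begin
      frobSq V
        ≈⟨ sum-cong (λ i → trans (normSq-cong λ j → sum-cong λ a → *-comm (T i a) (H a j)) (orthonormal-isometry {Z = H ᵀ} Hᵀ-orthonormal (T i))) ⟩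
      frobSq T
        ≈⟨ +-cong (trans (+-congˡ (sum-zero {k} λ j → zeroˡ 0#)) (trans (+-identityʳ _) l²≈σ))
             (sum-cong {k} λ i → trans (+-congʳ (zeroˡ 0#)) (+-identityˡ (normSq (V′ i)))) ⟩
      σ k + frobSq V′ ∎
      where open ≈R
    cost : frobSq U + frobSq V ≤ total σ k + 2# * σ k
    cost = begin
      frobSq U + frobSq V                          ≤⟨ +-mono-≤ frobU (≤-reflexive frobV) ⟩
      (σ k + frobSq U′) + (σ k + frobSq V′)        ≈⟨ solve 3 (λ s a b → (s :+ a) :+ (s :+ b) := (a :+ b) :+ :2 :* s) refl (σ k) (frobSq U′) (frobSq V′) ⟩
      (frobSq U′ + frobSq V′) + 2# * σ k           ≤⟨ +-mono-≤ (proj₂ (proj₂ (proj₂ rec))) ≤-refl ⟩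
      total σ k + 2# * σ k                         ∎
      where open ≤R

  -- Factorials, the exponential and the logarithm

  ½ : Carrier
  ½ = 2# ⁻¹

  2*½≈1 : 2# * ½ ≈ 1#
  2*½≈1 = *-inverse 0<2

  0<½ : 0# < ½
  0<½ = ⁻¹-pos 0<2

  -- The mean value bound for a power, with the derivative taken at the right end point.
  power-increment : ∀ {x h} k → 0# ≤ x → 0# ≤ h → (x + h) ^ suc k ≤ x ^ suc k + h * (fromℕ (suc k) * (x + h) ^ k)
  power-increment {x} {h} zero p q = ≤-reflexive
    (solve 2 (λ x h → (x :+ h) :* :1 := x :* :1 :+ h :* ((:1 :+ :0) :* :1)) refl x h)
  power-increment {x} {h} (suc k) p q = begin
    (x + h) * z
      ≈⟨ distribʳ z x h ⟩
    x * z + h * z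
      ≤⟨ +-mono-≤ (*-monoˡ-≤ p (power-increment k p q)) ≤-refl ⟩
    x * (x ^ suc k + h * (n * y)) + h * z
      ≈⟨ solve 6 (λ x u h n y z → x :* (u :+ h :* (n :* y)) :+ h :* z := x :* u :+ h :* (n :* (x :* y) :+ z)) refl x (x ^ suc k) h n y z ⟩
    x * x ^ suc k + h * (n * (x * y) + z)
      ≤⟨ +-mono-≤ ≤-refl (*-monoˡ-≤ q (+-mono-≤ (*-monoˡ-≤ (fromℕ-nonneg (suc k))
           (*-monoʳ-≤ (^-nonneg k (+-nonneg p q)) (x≤x+y q))) ≤-refl)) ⟩
    x * x ^ suc k + h * (n * z + z)
      ≈⟨ +-congˡ (*-congˡ (solve 2 (λ n z → n :* z :+ z := (:1 :+ n) :* z) refl n z)) ⟩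
    x * x ^ suc k + h * (fromℕ (suc (suc k)) * z) ∎
    where
    open ≤R
    n = fromℕ (suc k)
    y = (x + h) ^ k
    z = (x + h) ^ suc k

  -- The coefficients of (1 - x/2)^(-t), which dominate those of exp(tx/2) and sum to 2^t.
  private
    coeff : ℕ → ℕ → Carrier
    coeff zero    t       = 1#
    coeff (suc k) zero    = 0#
    coeff (suc k) (suc t) = coeff (suc k) t + ½ * coeff k (suc t)

    coeff-nonneg : ∀ k t → 0# ≤ coeff k t
    coeff-nonneg zero    t       = 0≤1
    coeff-nonneg (suc k) zero    = ≤-refl
    coeff-nonneg (suc k) (suc t) = +-nonneg (coeff-nonneg (suc k) t) (*-nonneg (<⇒≤ 0<½) (coeff-nonneg k (suc t)))

    -- The recursion of `coeff` compares coefficients in (1 - x/2) F(t+1) = F(t), where F(t) = (1 -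
    -- x/2)^(-t). At x = 1 a partial sum for t + 1 is one for t plus half a shorter one for t + 1,
    -- and 2^t + 2^(t+1)/2 = 2^(t+1).
    coeff-sum : ∀ t n → sum {n} (λ k → coeff (toℕ k) t) ≤ 2# ^ t
    coeff-sum zero    zero    = 0≤1
    coeff-sum zero    (suc n) = ≤-reflexive (trans (+-congˡ (sum-zero {n} λ _ → refl)) (+-identityʳ 1#))
    coeff-sum (suc t) zero    = ^-nonneg (suc t) (<⇒≤ 0<2)
    coeff-sum (suc t) (suc n) = begin
      1# + sum {n} (λ k → coeff (suc (toℕ k)) t + ½ * coeff (toℕ k) (suc t))
        ≈⟨ +-congˡ (trans (∑-distrib-+ {n} (λ k → coeff (suc (toℕ k)) t) (λ k → ½ * coeff (toℕ k) (suc t)))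
             (+-congˡ (sym (*-distribˡ-sum {n} ½ λ k → coeff (toℕ k) (suc t))))) ⟩
      1# + (sum {n} (λ k → coeff (suc (toℕ k)) t) + ½ * sum {n} (λ k → coeff (toℕ k) (suc t)))
        ≈⟨ +-assoc _ _ _ ⟨
      sum {suc n} (λ k → coeff (toℕ k) t) + ½ * sum {n} (λ k → coeff (toℕ k) (suc t))
        ≤⟨ +-mono-≤ (coeff-sum t (suc n)) (*-monoˡ-≤ (<⇒≤ 0<½) (coeff-sum (suc t) n)) ⟩
      2# ^ t + ½ * (2# * 2# ^ t)
        ≈⟨ solve 3 (λ h u z → z :+ h :* (u :* z) := z :+ (u :* h) :* z) refl ½ 2# (2# ^ t) ⟩
      2# ^ t + 2# * ½ * 2# ^ t
        ≈⟨ +-congˡ (*-congʳ 2*½≈1) ⟩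
      2# ^ t + 1# * 2# ^ t
        ≈⟨ solve 1 (λ z → z :+ :1 :* z := :2 :* z) refl (2# ^ t) ⟩
      2# * 2# ^ t ∎
      where open ≤R

    -- Passing from t to t + 1 raises the power by at most half of (k + 1) ((t + 1)/2)^k, and the
    -- recursion of `coeff` provides exactly this increment.
    power≤coeff : ∀ k t → (fromℕ t * ½) ^ k ≤ fromℕ (k !) * coeff k t
    power≤coeff zero t = ≤-reflexive (solve 0 (:1 := (:1 :+ :0) :* :1) refl)
    power≤coeff (suc k) zero = ≤-reflexive (trans (*-congʳ (zeroˡ ½)) (trans (zeroˡ _) (sym (zeroʳ _))))
    power≤coeff (suc k) (suc t) = begin
      ((1# + n) * ½) ^ suc k
        ≈⟨ ^-congˡ (suc k) (solve 2 (λ n h → (:1 :+ n) :* h := n :* h :+ h) refl n ½) ⟩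
      (n * ½ + ½) ^ suc k
        ≤⟨ power-increment k (*-nonneg (fromℕ-nonneg t) (<⇒≤ 0<½)) (<⇒≤ 0<½) ⟩
      (n * ½) ^ suc k + ½ * (fromℕ (suc k) * (n * ½ + ½) ^ k)
        ≤⟨ +-mono-≤ (power≤coeff (suc k) t) (*-monoˡ-≤ (<⇒≤ 0<½) (*-monoˡ-≤ (fromℕ-nonneg (suc k))
             (≤-respˡ-≈ (^-congˡ k (solve 2 (λ n h → (:1 :+ n) :* h := n :* h :+ h) refl n ½)) (power≤coeff k (suc t))))) ⟩
      fromℕ (suc k !) * coeff (suc k) t + ½ * (fromℕ (suc k) * (fromℕ (k !) * coeff k (suc t)))
        ≈⟨ +-congˡ (*-congˡ (trans (sym (*-assoc _ _ _)) (*-congʳ (sym (fromℕ-* (suc k) (k !)))))) ⟩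
      fromℕ (suc k !) * coeff (suc k) t + ½ * (fromℕ (suc k !) * coeff k (suc t))
        ≈⟨ solve 4 (λ f a h b → f :* a :+ h :* (f :* b) := f :* (a :+ h :* b)) refl (fromℕ (suc k !)) (coeff (suc k) t) ½ (coeff k (suc t)) ⟩
      fromℕ (suc k !) * (coeff (suc k) t + ½ * coeff k (suc t)) ∎
      where
      open ≤R
      n = fromℕ t

  exp-half-≤ : ∀ t n → expPartialSum (fromℕ t * ½) n ≤ 2# ^ t
  exp-half-≤ t n = ≤-trans (sum-mono-≤ {n} λ k → *-cancelˡ-≤ (fromℕ!-pos (toℕ k))
      (≤-respˡ-≈ (sym (x*y*x⁻¹≈y _ (fromℕ!-pos (toℕ k)))) (power≤coeff (toℕ k) t)))
    (coeff-sum t n)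

  -- A crude Stirling bound. One factor 2^k undoes the halving in (k/2)^k ≤ k! `coeff k k`, the
  -- other bounds the coefficient by the sum of all of them.
  k^k≤4^k*k! : ∀ k → fromℕ k ^ k ≤ (2# * 2#) ^ k * fromℕ (k !)
  k^k≤4^k*k! k = begin
    fromℕ k ^ k
      ≈⟨ ^-congˡ k (trans (solve 3 (λ n u h → u :* (n :* h) := n :* (u :* h)) refl (fromℕ k) 2# ½) (trans (*-congˡ 2*½≈1) (*-identityʳ _))) ⟨
    (2# * (fromℕ k * ½)) ^ k
      ≈⟨ ^-distrib-* 2# (fromℕ k * ½) k ⟩
    2# ^ k * (fromℕ k * ½) ^ k
      ≤⟨ *-monoˡ-≤ (^-nonneg k (<⇒≤ 0<2)) (power≤coeff k k) ⟩
    2# ^ k * (fromℕ (k !) * coeff k k)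
      ≤⟨ *-monoˡ-≤ (^-nonneg k (<⇒≤ 0<2)) (*-monoˡ-≤ (fromℕ-nonneg (k !)) (≤-trans last (coeff-sum k (suc k)))) ⟩
    2# ^ k * (fromℕ (k !) * 2# ^ k)
      ≈⟨ solve 2 (λ z f → z :* (f :* z) := z :* z :* f) refl (2# ^ k) (fromℕ (k !)) ⟩
    2# ^ k * 2# ^ k * fromℕ (k !)
      ≈⟨ *-congʳ (^-distrib-* 2# 2# k) ⟨
    (2# * 2#) ^ k * fromℕ (k !) ∎
    where
    open ≤R
    last : coeff k k ≤ sum {suc k} λ i → coeff (toℕ i) k
    last = ≤-respˡ-≈ (reflexive (≡.cong (λ i → coeff i k) (Finₚ.toℕ-fromℕ k)))
      (term≤sum {suc k} (λ i → coeff-nonneg (toℕ i) k) (Fin.fromℕ k))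

  private
    sum-suc : ∀ n (g : ℕ → Carrier) → sum {suc n} (g ∘ toℕ) ≈ sum {n} (g ∘ toℕ) + g n
    sum-suc zero    g = trans (+-identityʳ _) (sym (+-identityˡ _))
    sum-suc (suc n) g = trans (+-congˡ (sum-suc n (g ∘ suc))) (sym (+-assoc _ _ _))

    increasing : ∀ (a : ℕ → Carrier) → (∀ n → a n ≤ a (suc n)) → ∀ {m n} → m ℕ.≤ n → a m ≤ a n
    increasing a h {m} {n} m≤n = go (ℕₚ.≤⇒≤′ m≤n)
      where
      go : ∀ {n} → m ℕ.≤′ n → a m ≤ a n
      go (ℕ.≤′-reflexive ≡.refl) = ≤-refl
      go (ℕ.≤′-step p) = ≤-trans (go p) (h _)

    exp-increasing : ∀ {y} → 0# ≤ y → ∀ {m n} → m ℕ.≤ n → expPartialSum y m ≤ expPartialSum y n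
    exp-increasing {y} 0≤y = increasing (expPartialSum y) λ n →
      ≤-respʳ-≈ (sym (sum-suc n λ k → y ^ k * fromℕ (k !) ⁻¹))
        (x≤x+y (*-nonneg (^-nonneg n 0≤y) (<⇒≤ (⁻¹-pos (fromℕ!-pos n)))))

  increasing-bounded-converges : ∀ (a : ℕ → Carrier) → (∀ {m n} → m ℕ.≤ n → a m ≤ a n) → ∀ {b} → (∀ n → a n ≤ b) →
    ∃ λ l → (a ⟶ l) × l ≤ b
  increasing-bounded-converges a incr {b} bd = ⨆ a , conv , ⨆-least 0 bd
    where
    conv : a ⟶ ⨆ a
    conv ε 0<ε =
      let isSup = sup-isSup (λ x → ∃ λ i → x ≈ a i) (a 0 , 0 , refl) (b , λ { x (j , e) → ≤-respˡ-≈ (sym e) (bd j) })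
          (x , (N , x≈aN) , l-ε<x) = proj₂ isSup (⨆ a - ε) (<-by (solve 2 (λ l e → l :- (l :- e) := e) refl (⨆ a) ε) 0<ε)
      in N , λ n N≤n →
        let l-ε<an = <-≤-trans l-ε<x (≤-respˡ-≈ (sym x≈aN) (incr N≤n))
            an≤l = ⨆-upper {f = a} bd n
        in ∣x∣<ε
          (<-by (solve 3 (λ e x l → e :- (x :- l) := e :+ (l :- x)) refl ε (a n) (⨆ a)) (+-pos-nonneg 0<ε (0≤y-x an≤l)))
          (<-by (solve 3 (λ e x l → e :- :- (x :- l) := x :- (l :- e)) refl ε (a n) (⨆ a)) (0<y-x l-ε<an))

  -- Already the partial sum 1 + y is at least y. This bounds the set that defines `log`.
  IsExp⇒≤ : ∀ {y e} → 0# ≤ y → IsExp y e → y ≤ e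
  IsExp⇒≤ {y} {e} 0≤y conv = ≮⇒≥ λ e<y →
    let (N , close) = conv (y - e) (0<y-x e<y)
        n = N ℕ.+ 2
        a = expPartialSum y n
        a-e<y-e = ≤-<-trans (x≤∣x∣ (a - e)) (close n (ℕₚ.m≤m+n N 2))
    in ≤⇒≯ (≤-trans y≤a₂ (exp-increasing 0≤y (ℕₚ.m≤n+m 2 N)))
         (<-by (solve 3 (λ y a e → y :- a := (y :- e) :- (a :- e)) refl y a e) (0<y-x a-e<y-e))
    where
    y≤a₂ : y ≤ expPartialSum y 2
    y≤a₂ = ≤-respʳ-≈ (+-congˡ (sym (+-identityʳ _))) (≤-trans
      (≤-reflexive (sym (trans (*-congˡ {x = y * 1#} 1⁻¹) (solve 1 (λ y → y :* :1 :* :1 := y) refl y))))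
      (y≤x+y (*-nonneg 0≤1 (<⇒≤ (⁻¹-pos (fromℕ!-pos 0))))))
      where
      1⁻¹ : fromℕ (1 !) ⁻¹ ≈ 1#
      1⁻¹ = trans (sym (trans (*-congʳ (+-identityʳ 1#)) (*-identityˡ _))) (*-inverse (fromℕ!-pos 1))

  -- From exp (t/2) ≤ 2^t ≤ r, the number t/2 belongs to the set whose supremum is log r. The ½
  -- stands in for log 2.
  log-lower : ∀ t r → 2 ℕ.^ t ℕ.≤ r → fromℕ t * ½ ≤ log (fromℕ r)
  log-lower t r 2^t≤r =
    let (e , isExp , e≤2^t) = increasing-bounded-converges (expPartialSum y) (exp-increasing 0≤y) (exp-half-≤ t)
        member = e , isExp , ≤-trans e≤2^t (≤-respˡ-≈ 2^ (fromℕ-mono-≤ 2^t≤r))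
    in proj₁ (sup-isSup (λ y → ∃ λ e → IsExp y e × e ≤ fromℕ r) (y , member) (fromℕ r , ub)) y member
    where
    y = fromℕ t * ½
    0≤y : 0# ≤ y
    0≤y = *-nonneg (fromℕ-nonneg t) (<⇒≤ 0<½)
    2^ : fromℕ (2 ℕ.^ t) ≈ 2# ^ t
    2^ = trans (fromℕ-^ 2 t) (^-congˡ t (+-congˡ (+-identityʳ 1#)))
    ub : UpperBound (λ y → ∃ λ e → IsExp y e × e ≤ fromℕ r) (fromℕ r)
    ub z (e , isExp , e≤r) with ≤-total z 0#
    ... | inj₁ z≤0 = ≤-trans z≤0 (fromℕ-nonneg r)
    ... | inj₂ 0≤z = ≤-trans (IsExp⇒≤ 0≤z isExp) e≤r

  -- Harmonic numbers

  harmonic : ℕ → Carrier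
  harmonic zero    = 0#
  harmonic (suc n) = harmonic n + fromℕ (suc n) ⁻¹

  harmonic-mono-≤ : ∀ {m n} → m ℕ.≤ n → harmonic m ≤ harmonic n
  harmonic-mono-≤ = increasing harmonic λ n → x≤x+y (<⇒≤ (⁻¹-pos (fromℕ-pos n)))

  ⁻¹-antitone : ∀ {x y} → 0# < x → x ≤ y → y ⁻¹ ≤ x ⁻¹
  ⁻¹-antitone {x} {y} 0<x x≤y = *-cancelˡ-≤ (*-pos 0<x 0<y) (begin
    x * y * y ⁻¹     ≈⟨ trans (*-assoc _ _ _) (trans (*-congˡ (*-inverse 0<y)) (*-identityʳ x)) ⟩
    x                ≤⟨ x≤y ⟩
    y                ≈⟨ x*y*x⁻¹≈y y 0<x ⟨
    x * (y * x ⁻¹)   ≈⟨ *-assoc _ _ _ ⟨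
    x * y * x ⁻¹     ∎)
    where
    open ≤R
    0<y = <-≤-trans 0<x x≤y

  -- After the leading 1 the terms pair up as 1/(2j) + 1/(2j + 1) ≤ 1/j.
  harmonic-double : ∀ n → harmonic (suc (n ℕ.+ n)) ≤ 1# + harmonic n
  harmonic-double zero = ≤-reflexive (trans (+-identityˡ _) (trans (sym (trans (*-congʳ (+-identityʳ 1#)) (*-identityˡ _)))
    (trans (*-inverse (fromℕ-pos 0)) (sym (+-identityʳ 1#)))))
  harmonic-double (suc n) rewrite ℕₚ.+-suc n n = begin
    harmonic (suc (n ℕ.+ n)) + fromℕ (suc (suc m)) ⁻¹ + fromℕ (suc (suc (suc m))) ⁻¹
      ≤⟨ +-mono-≤ (+-mono-≤ (harmonic-double n) a≤) (≤-trans (⁻¹-antitone (fromℕ-pos (suc m)) (y≤x+y 0≤1)) a≤) ⟩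
    1# + harmonic n + ½ * z + ½ * z
      ≈⟨ solve 3 (λ u h z → u :+ h :* z :+ h :* z := u :+ (:2 :* h) :* z) refl (1# + harmonic n) ½ z ⟩
    1# + harmonic n + 2# * ½ * z
      ≈⟨ trans (+-congˡ (trans (*-congʳ 2*½≈1) (*-identityˡ z))) (+-assoc _ _ _) ⟩
    1# + (harmonic n + z) ∎
    where
    open ≤R
    m = n ℕ.+ n
    z = fromℕ (suc n) ⁻¹
    2n : fromℕ (suc (suc m)) ≈ 2# * fromℕ (suc n)
    2n = trans (+-congˡ (+-congˡ (fromℕ-+ n n))) (solve 1 (λ n → :1 :+ (:1 :+ (n :+ n)) := :2 :* (:1 :+ n)) refl (fromℕ n))
    a≤ : fromℕ (suc (suc m)) ⁻¹ ≤ ½ * z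
    a≤ = *-cancelˡ-≤ (fromℕ-pos (suc m)) (≤-reflexive (begin-equality
      fromℕ (suc (suc m)) * fromℕ (suc (suc m)) ⁻¹   ≈⟨ *-inverse (fromℕ-pos (suc m)) ⟩
      1#                                             ≈⟨ *-identityˡ 1# ⟨
      1# * 1#                                        ≈⟨ *-cong 2*½≈1 (*-inverse (fromℕ-pos n)) ⟨
      2# * ½ * (fromℕ (suc n) * z)                   ≈⟨ solve 4 (λ u h n z → u :* h :* (n :* z) := u :* n :* (h :* z)) refl 2# ½ (fromℕ (suc n)) z ⟩
      2# * fromℕ (suc n) * (½ * z)                   ≈⟨ *-congʳ 2n ⟨
      fromℕ (suc (suc m)) * (½ * z)                  ∎))

  private
    -- The number 2^(t+1) - 1, generated by n ↦ 2n + 1 so as to match `harmonic-double`.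
    2^suc-1 : ℕ → ℕ
    2^suc-1 zero    = 1
    2^suc-1 (suc t) = suc (2^suc-1 t ℕ.+ 2^suc-1 t)

    2^suc-1-correct : ∀ t → suc (2^suc-1 t) ≡ 2 ℕ.^ suc t
    2^suc-1-correct zero    = ≡.refl
    2^suc-1-correct (suc t) rewrite ≡.sym (2^suc-1-correct t) | ℕₚ.+-identityʳ (2^suc-1 t) =
      ≡.cong suc (≡.sym (ℕₚ.+-suc (2^suc-1 t) (2^suc-1 t)))

    harmonic-2^suc-1 : ∀ t → harmonic (2^suc-1 t) ≤ 1# + fromℕ t
    harmonic-2^suc-1 zero    = harmonic-double 0
    harmonic-2^suc-1 (suc t) = ≤-trans (harmonic-double (2^suc-1 t)) (+-mono-≤ ≤-refl (harmonic-2^suc-1 t))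

    dyadic : ∀ r → ∃ λ t → 2 ℕ.^ t ℕ.≤ suc r × suc r ℕ.≤ 2^suc-1 t
    dyadic zero = 0 , ℕₚ.≤-refl , ℕₚ.≤-refl
    dyadic (suc r) with dyadic r
    ... | t , lo , hi with ℕₚ.m≤n⇒m<n∨m≡n hi
    ...   | inj₁ hi′ = t , ℕₚ.m≤n⇒m≤1+n lo , hi′
    ...   | inj₂ e = suc t , ℕₚ.≤-reflexive (≡.trans (≡.sym (2^suc-1-correct t)) (≡.cong suc (≡.sym e))) ,
              ℕ.s≤s (≡.subst (ℕ._≤ 2^suc-1 t ℕ.+ 2^suc-1 t) (≡.sym e) (ℕₚ.m≤m+n _ _))

  -- If 2^t ≤ r < 2^(t+1), then H_r ≤ 1 + t ≤ 2t and t ≤ 2 log r. The middle inequality requires t ≥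
  -- 1, that is, r ≥ 2.
  harmonic≤4log : ∀ r → 2 ℕ.≤ r → harmonic r ≤ (2# * 2#) * log (fromℕ r)
  harmonic≤4log (suc r) 2≤r with dyadic r
  ... | zero  , lo , hi = ⊥-elim (ℕₚ.<⇒≱ 2≤r hi)
  ... | suc t , lo , hi = begin
    harmonic (suc r)                    ≤⟨ harmonic-mono-≤ hi ⟩
    harmonic (2^suc-1 (suc t))          ≤⟨ harmonic-2^suc-1 (suc t) ⟩
    1# + (1# + fromℕ t)                 ≤⟨ ≤-by (solve 1 (λ n → :2 :* (:1 :+ n) :- (:1 :+ (:1 :+ n)) := n) refl (fromℕ t)) (fromℕ-nonneg t) ⟩
    2# * fromℕ (suc t)                  ≈⟨ *-congʳ (trans (*-congˡ 2*½≈1) (*-identityʳ 2#)) ⟨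
    2# * (2# * ½) * fromℕ (suc t)       ≈⟨ solve 3 (λ u h n → u :* (u :* h) :* n := u :* u :* (n :* h)) refl 2# ½ (fromℕ (suc t)) ⟩
    2# * 2# * (fromℕ (suc t) * ½)       ≤⟨ *-monoˡ-≤ (<⇒≤ (*-pos 0<2 0<2)) (log-lower (suc t) (suc r) lo) ⟩
    2# * 2# * log (fromℕ (suc r))       ∎
    where open ≤R

  -- Minimax by descent on a squared distance

  infix 8 _⁺
  _⁺ : Carrier → Carrier
  x ⁺ with ≤-total x 0#
  ... | inj₁ _ = 0#
  ... | inj₂ _ = x

  ⁺-nonneg : ∀ x → 0# ≤ x ⁺
  ⁺-nonneg x with ≤-total x 0#
  ... | inj₁ _ = ≤-refl
  ... | inj₂ p = p

  x≤x⁺ : ∀ x → x ≤ x ⁺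
  x≤x⁺ x with ≤-total x 0#
  ... | inj₁ p = p
  ... | inj₂ _ = ≤-refl

  x⁺*x : ∀ x → x ⁺ * x ≈ x ⁺ * x ⁺
  x⁺*x x with ≤-total x 0#
  ... | inj₁ _ = trans (zeroˡ x) (sym (zeroˡ 0#))
  ... | inj₂ _ = refl

  ⁺²-mono : ∀ {x y} → x ≤ y → x ⁺ * x ⁺ ≤ y * y
  ⁺²-mono {x} {y} p with ≤-total x 0#
  ... | inj₁ _ = ≤-respˡ-≈ (sym (zeroˡ 0#)) (0≤x² y)
  ... | inj₂ q = *-mono-≤ q p q p

  infimum : ∀ {I : Set} → I → (f : I → Carrier) → (∀ i → 0# ≤ f i) →
    ∃ λ d → (∀ i → d ≤ f i) × (∀ ε → 0# < ε → ∃ λ i → f i < d + ε)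
  infimum i₀ f 0≤f = - ⨆ (λ i → - f i) ,
    (λ i → ≤-respʳ-≈ (neg-neg (f i)) (neg-mono-≤ (⨆-upper {b = - 0#} (neg-mono-≤ ∘ 0≤f) i))) ,
    λ ε 0<ε →
      let s = ⨆ (λ i → - f i)
          (x , (i , x≈) , p) = proj₂ (sup-isSup (λ x → ∃ λ i → x ≈ - f i) (- f i₀ , i₀ , refl)
            (- 0# , λ { x (j , e) → ≤-respˡ-≈ (sym e) (neg-mono-≤ (0≤f j)) })) (s - ε)
            (<-by (solve 2 (λ s e → s :- (s :- e) := e) refl s ε) 0<ε)
      in i , <-by (solve 3 (λ s e y → (:- s :+ e) :- y := :- y :- (s :- e)) refl s ε (f i)) (0<y-x (<-respʳ-≈ x≈ p))
    where
    neg-neg : ∀ x → - - x ≈ x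
    neg-neg = solve 1 (λ x → :- :- x := x) refl

  -- Minimise the squared distance g from a point of S to the orthant below K.  If the infimum d were positive,
  -- moving a near-minimiser v towards the point u supplied by the weights w = (v - K)⁺ would bring g below d;
  -- adding η to the weights bounds u independently of v.
  minimax : ∀ {N} (S : Vec N → Set) {K} → 0# < K → (∀ {v} → S v → ∀ i → 0# ≤ v i) →
    (∀ {u v} t → S u → S v → 0# < t → t < 1# → S λ i → v i + t * (u i - v i)) →
    (∀ w → (∀ i → 0# < w i) → ∃ λ v → S v × sum (λ i → w i * v i) ≤ K * sum w) →
    ∀ ε → 0# < ε → ∃ λ v → S v × (∀ i → v i ≤ K + ε)
  minimax {N} S {K} 0<K nonneg convex weighted ε 0<ε = v₁ , proj₂ (proj₁ near) , bound
    where
    open ≤R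
    g : Vec N → Carrier
    g v = sum λ i → (v i - K) ⁺ * (v i - K) ⁺
    base = weighted (λ _ → 1#) (λ _ → 0<1)
    inf = infimum {Σ (Vec N) S} (proj₁ base , proj₁ (proj₂ base)) (g ∘ proj₁) (λ v → sum-nonneg λ i → 0≤x² ((proj₁ v i - K) ⁺))
    d = proj₁ inf

    positive-absurd : 0# < d → ⊥
    positive-absurd 0<d = ≤⇒≯ (proj₁ (proj₂ inf) (x , Sx)) gx<d
      where
      e = d * ½
      0<e = *-pos 0<d 0<½
      d≈e+e : d ≈ e + e
      d≈e+e = trans (sym (*-identityʳ d)) (trans (*-congˡ (sym 2*½≈1)) (solve 2 (λ d h → d :* (:2 :* h) := d :* h :+ d :* h) refl d ½))
      KN = K * fromℕ N
      0≤KN = *-nonneg (<⇒≤ 0<K) (fromℕ-nonneg N)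
      -- Adding η to every weight makes the weights positive and costs at most K N η ≤ e in the
      -- weighted bound.
      choose-η = small-multiplier 0<e 0≤KN
      η = proj₁ choose-η
      0<η = proj₁ (proj₂ choose-η)
      W = 1# + (d + d)
      0≤W : 0# ≤ W
      0≤W = +-nonneg 0≤1 (<⇒≤ (+-pos 0<d 0<d))
      -- W bounds the excess of a near-minimiser over K and U bounds every coordinate of the
      -- answering point. Hence R bounds their distance in each coordinate, and the step t can be
      -- fixed before v is chosen.
      U = KN * (W + η) * η ⁻¹
      0≤U : 0# ≤ U
      0≤U = *-nonneg (*-nonneg 0≤KN (+-nonneg 0≤W (<⇒≤ 0<η))) (<⇒≤ (⁻¹-pos 0<η))
      R = U + (K + W)
      Q = fromℕ N * (R * R)
      choose-h = small-multiplier 0<e (*-nonneg (fromℕ-nonneg N) (0≤x² R))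
      h = proj₁ choose-h
      0<h = proj₁ (proj₂ choose-h)
      t = h * ½
      0<t = *-pos 0<h 0<½
      h≈t+t : h ≈ t + t
      h≈t+t = trans (sym (*-identityʳ h)) (trans (*-congˡ (sym 2*½≈1)) (solve 2 (λ d h → d :* (:2 :* h) := d :* h :+ d :* h) refl h ½))
      t<1 : t < 1#
      t<1 = <-≤-trans (<-respʳ-≈ (sym h≈t+t) (<-by (solve 1 (λ t → (t :+ t) :- t := t) refl t) 0<t)) (proj₁ (proj₂ (proj₂ choose-h)))
      tQ≤e : t * Q ≤ e
      tQ≤e = ≤-trans (*-monoʳ-≤ (*-nonneg (fromℕ-nonneg N) (0≤x² R)) (≤-respʳ-≈ (sym h≈t+t) (x≤x+y (<⇒≤ 0<t))))
        (proj₂ (proj₂ (proj₂ choose-h)))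

      -- The precision t e equals the guaranteed decrease: the first-order term is at most -2te and
      -- the second-order term at most te.
      near-min = proj₂ (proj₂ inf) (t * e) (*-pos 0<t 0<e)
      v = proj₁ (proj₁ near-min)
      Sv = proj₂ (proj₁ near-min)
      gv<d+te = proj₂ near-min
      w : Vec N
      w i = (v i - K) ⁺
      0≤w : ∀ i → 0# ≤ w i
      0≤w i = ⁺-nonneg (v i - K)
      gv≤2d : g v ≤ d + d
      gv≤2d = begin
        g v         ≤⟨ <⇒≤ gv<d+te ⟩
        d + t * e   ≤⟨ +-mono-≤ ≤-refl (*-monoʳ-≤ (<⇒≤ 0<e) (<⇒≤ t<1)) ⟩
        d + 1# * e  ≤⟨ +-mono-≤ ≤-refl (≤-respʳ-≈ (sym d≈e+e) (≤-respˡ-≈ (sym (*-identityˡ e)) (x≤x+y (<⇒≤ 0<e)))) ⟩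
        d + d       ∎
      w≤W : ∀ i → w i ≤ W
      w≤W i = begin
        w i                 ≤⟨ x²≤y²⇒x≤y (+-nonneg 0≤1 (0≤x² (w i))) (≤-by
                                 (solve 1 (λ w → (:1 :+ w :* w) :* (:1 :+ w :* w) :- w :* w
                                   := :1 :+ w :* w :+ (w :* w) :* (w :* w)) refl (w i))
                                 (+-nonneg (+-nonneg 0≤1 (0≤x² _)) (0≤x² _))) ⟩
        1# + w i * w i      ≤⟨ +-mono-≤ ≤-refl (≤-trans (term≤sum (λ i → 0≤x² (w i)) i) gv≤2d) ⟩
        W                   ∎
      v≤K+w : ∀ i → v i ≤ K + w i
      v≤K+w i = ≤-by (solve 3 (λ k w v → (k :+ w) :- v := w :- (v :- k)) refl K (w i) (v i)) (0≤y-x (x≤x⁺ (v i - K)))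

      answer = weighted (λ i → w i + η) (λ i → <-respʳ-≈ (+-comm η (w i)) (+-pos-nonneg 0<η (0≤w i)))
      u = proj₁ answer
      Su = proj₁ (proj₂ answer)
      0≤u = nonneg Su
      sum-w+η : sum (λ i → w i + η) ≈ sum w + fromℕ N * η
      sum-w+η = trans (∑-distrib-+ w (λ _ → η)) (+-congˡ (sum-const N η))
      0≤[w+η]u : ∀ i → 0# ≤ (w i + η) * u i
      0≤[w+η]u i = *-nonneg (+-nonneg (0≤w i) (<⇒≤ 0<η)) (0≤u i)
      u≤U : ∀ i → u i ≤ U
      u≤U i = *-cancelˡ-≤ 0<η (begin
        η * u i                           ≤⟨ *-monoʳ-≤ (0≤u i) (y≤x+y (0≤w i)) ⟩
        (w i + η) * u i                   ≤⟨ term≤sum 0≤[w+η]u i ⟩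
        sum (λ i → (w i + η) * u i)       ≤⟨ proj₂ (proj₂ answer) ⟩
        K * sum (λ i → w i + η)           ≤⟨ *-monoˡ-≤ (<⇒≤ 0<K) (sum-mono-≤ λ i → +-mono-≤ (w≤W i) ≤-refl) ⟩
        K * sum {N} (λ i → W + η)         ≈⟨ trans (*-congˡ (sum-const N (W + η))) (sym (*-assoc _ _ _)) ⟩
        KN * (W + η)                      ≈⟨ x*y*x⁻¹≈y _ 0<η ⟨
        η * U                             ∎)
      [u-v]²≤R² : ∀ i → (u i - v i) * (u i - v i) ≤ R * R
      [u-v]²≤R² i = ≤-by (solve 2 (λ r y → r :* r :- y :* y := (r :- y) :* (r :+ y)) refl R (u i - v i))
        (*-nonneg
          (≤-respʳ-≈ (solve 5 (λ U k W u v → (U :- u) :+ (k :+ W) :+ v := (U :+ (k :+ W)) :- (u :- v)) refl U K W (u i) (v i))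
            (+-nonneg (+-nonneg (0≤y-x (u≤U i)) (+-nonneg (<⇒≤ 0<K) 0≤W)) (nonneg Sv i)))
          (≤-respʳ-≈ (solve 5 (λ U k W u v → U :+ (k :+ W :- v) :+ u := (U :+ (k :+ W)) :+ (u :- v)) refl U K W (u i) (v i))
            (+-nonneg (+-nonneg 0≤U (0≤y-x (≤-trans (v≤K+w i) (+-mono-≤ ≤-refl (w≤W i))))) (0≤u i))))

      x : Vec N
      x i = v i + t * (u i - v i)
      Sx : S x
      Sx = convex t Su Sv 0<t t<1
      -- Half of the derivative of g at v in the direction u - v, as the gradient of g is twice the
      -- positive part w.
      L = sum λ i → w i * (u i - v i)

      wu : sum (λ i → w i * u i) ≤ K * sum w + e
      wu = begin
        sum (λ i → w i * u i)              ≤⟨ sum-mono-≤ (λ i → *-monoʳ-≤ (0≤u i) (x≤x+y (<⇒≤ 0<η))) ⟩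
        sum (λ i → (w i + η) * u i)        ≤⟨ proj₂ (proj₂ answer) ⟩
        K * sum (λ i → w i + η)            ≈⟨ *-congˡ sum-w+η ⟩
        K * (sum w + fromℕ N * η)          ≈⟨ solve 4 (λ k s n h → k :* (s :+ n :* h) := k :* s :+ h :* (k :* n)) refl K (sum w) (fromℕ N) η ⟩
        K * sum w + η * KN                 ≤⟨ +-mono-≤ ≤-refl (proj₂ (proj₂ (proj₂ choose-η))) ⟩
        K * sum w + e                      ∎
      wv : K * sum w + g v ≈ sum (λ i → w i * v i)
      wv = begin-equality
        K * sum w + g v                              ≈⟨ +-congʳ (*-distribˡ-sum K w) ⟩
        sum (λ i → K * w i) + g v                    ≈⟨ ∑-distrib-+ (λ i → K * w i) (λ i → w i * w i) ⟨
        sum (λ i → K * w i + w i * w i)              ≈⟨ sum-cong (λ i → trans (+-congˡ (sym (x⁺*x (v i - K))))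
                                                          (solve 3 (λ k w v → k :* w :+ w :* (v :- k) := w :* v) refl K (w i) (v i))) ⟩
        sum (λ i → w i * v i)                        ∎
      L≤ : L ≤ e - g v
      L≤ = ≤-by (begin-equality
          (e - g v) - L
            ≈⟨ +-congˡ (-‿cong (trans (sum-cong λ i → solve 3 (λ w u v → w :* (u :- v) := w :* u :+ :- :1 :* (w :* v)) refl (w i) (u i) (v i))
                 (trans (∑-distrib-+ (λ i → w i * u i) (λ i → - 1# * (w i * v i)))
                   (+-congˡ (sym (*-distribˡ-sum (- 1#) λ i → w i * v i)))))) ⟩
          (e - g v) - (sum (λ i → w i * u i) + - 1# * sum (λ i → w i * v i))
            ≈⟨ +-congˡ (-‿cong (+-congˡ (*-congˡ (sym wv)))) ⟩
          (e - g v) - (sum (λ i → w i * u i) + - 1# * (K * sum w + g v))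
            ≈⟨ solve 4 (λ e g a k → (e :- g) :- (a :+ :- :1 :* (k :+ g)) := (k :+ e) :- a) refl e (g v) (sum (λ i → w i * u i)) (K * sum w) ⟩
          (K * sum w + e) - sum (λ i → w i * u i) ∎)
        (0≤y-x wu)
      gx<d : g x < d
      gx<d = begin-strict
        g x
          ≤⟨ sum-mono-≤ (λ i → ⁺²-mono (≤-by
               (solve 5 (λ w t u v k → (w :+ t :* (u :- v)) :- (v :+ t :* (u :- v) :- k) := w :- (v :- k)) refl (w i) t (u i) (v i) K)
               (0≤y-x (x≤x⁺ (v i - K))))) ⟩
        sum (λ i → (w i + t * (u i - v i)) * (w i + t * (u i - v i)))
          ≈⟨ trans (sum-cong λ i → solve 3 (λ w t y → (w :+ t :* y) :* (w :+ t :* y) := (w :* w :+ :2 :* t :* (w :* y)) :+ t :* t :* (y :* y)) refl (w i) t (u i - v i))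
               (trans (∑-distrib-+ (λ i → w i * w i + 2# * t * (w i * (u i - v i))) (λ i → t * t * ((u i - v i) * (u i - v i))))
                 (+-cong (trans (∑-distrib-+ (λ i → w i * w i) (λ i → 2# * t * (w i * (u i - v i))))
                     (+-congˡ (sym (*-distribˡ-sum (2# * t) λ i → w i * (u i - v i)))))
                   (sym (*-distribˡ-sum (t * t) λ i → (u i - v i) * (u i - v i))))) ⟩
        (g v + 2# * t * L) + t * t * sum (λ i → (u i - v i) * (u i - v i))
          ≤⟨ +-mono-≤ (+-mono-≤ ≤-refl (*-monoˡ-≤ (<⇒≤ (*-pos 0<2 0<t))
                 (≤-trans L≤ (+-mono-≤ ≤-refl (neg-mono-≤ (proj₁ (proj₂ inf) (v , Sv)))))))
               (*-monoˡ-≤ (0≤x² t) (≤-respʳ-≈ (sum-const N (R * R)) (sum-mono-≤ [u-v]²≤R²))) ⟩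
        (g v + 2# * t * (e - d)) + t * t * Q
          ≈⟨ +-cong (+-congˡ (*-congˡ (+-congˡ (-‿cong d≈e+e)))) (*-assoc t t Q) ⟩
        (g v + 2# * t * (e - (e + e))) + t * (t * Q)
          ≤⟨ +-mono-≤ ≤-refl (*-monoˡ-≤ (<⇒≤ 0<t) tQ≤e) ⟩
        (g v + 2# * t * (e - (e + e))) + t * e
          ≈⟨ solve 3 (λ g t e → (g :+ :2 :* t :* (e :- (e :+ e))) :+ t :* e := g :- t :* e) refl (g v) t e ⟩
        g v - t * e
          <⟨ <-by (solve 3 (λ d te g → d :- (g :- te) := (d :+ te) :- g) refl d (t * e) (g v)) (0<y-x gv<d+te) ⟩
        d ∎

    near = proj₂ (proj₂ inf) (ε * ε) (*-pos 0<ε 0<ε)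
    v₁ = proj₁ (proj₁ near)
    bound : ∀ i → v₁ i ≤ K + ε
    bound i = begin
      v₁ i                   ≤⟨ ≤-by (solve 3 (λ k w v → (k :+ w) :- v := w :- (v :- k)) refl K ((v₁ i - K) ⁺) (v₁ i)) (0≤y-x (x≤x⁺ (v₁ i - K))) ⟩
      K + (v₁ i - K) ⁺       ≤⟨ +-mono-≤ ≤-refl (x²≤y²⇒x≤y (<⇒≤ 0<ε) (begin
        (v₁ i - K) ⁺ * (v₁ i - K) ⁺   ≤⟨ term≤sum (λ i → 0≤x² ((v₁ i - K) ⁺)) i ⟩
        g v₁                          ≤⟨ <⇒≤ (proj₂ near) ⟩
        d + ε * ε                     ≤⟨ +-mono-≤ (≮⇒≥ positive-absurd) ≤-refl ⟩
        0# + ε * ε                    ≈⟨ +-identityˡ _ ⟩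
        ε * ε                         ∎)) ⟩
      K + ε                  ∎

  -- Norms

  private
    normSq≈sum^2 : ∀ {n} (v : Vec n) → normSq v ≈ sum λ i → v i ^ 2
    normSq≈sum^2 v = sum-cong λ i → sym (^2≈* (v i))

    sum^2-nonneg : ∀ {n} (v : Vec n) → 0# ≤ sum λ i → v i ^ 2
    sum^2-nonneg v = ≤-respʳ-≈ (normSq≈sum^2 v) (normSq-nonneg v)

    square≤ : ∀ {a x y} → 0# ≤ x → x ≤ y → a ≤ x ^ 2 → a ≤ y * y
    square≤ {a} {x} {y} 0≤x x≤y p = ≤-trans p (≤-respˡ-≈ (sym (^2≈* x)) (*-mono-≤ 0≤x x≤y 0≤x x≤y))

  ‖‖₂-nonneg : ∀ {n} (v : Vec n) → 0# ≤ ‖ v ‖₂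
  ‖‖₂-nonneg v = root-nonneg 1 (sum^2-nonneg v)

  normSq≤‖‖₂^2 : ∀ {n} (v : Vec n) → normSq v ≤ ‖ v ‖₂ ^ 2
  normSq≤‖‖₂^2 v = ≤-respˡ-≈ (sym (normSq≈sum^2 v)) (a≤root^ 1 (sum^2-nonneg v))

  ‖‖₂-least : ∀ {n} (v : Vec n) {s} → 0# ≤ s → normSq v ≤ s * s → ‖ v ‖₂ ≤ s
  ‖‖₂-least v {s} 0≤s h = root-least 1 {z = s} (sum^2-nonneg v) 0≤s
    (≤-respˡ-≈ (normSq≈sum^2 v) (≤-respʳ-≈ (sym (^2≈* s)) h))

  -- Both matrix norms are instances: the rows B themselves, and `column C`.
  module MaxNorm {m n} (v : Fin m → Vec n) where

    maxNorm : Carrier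
    maxNorm = ⨆ λ i → ‖ v i ‖₂

    private
      bounded : ∀ i → ‖ v i ‖₂ ≤ sum λ i → ‖ v i ‖₂
      bounded = term≤sum {f = λ i → ‖ v i ‖₂} λ i → ‖‖₂-nonneg (v i)

    maxNorm-nonneg : 0# ≤ maxNorm
    maxNorm-nonneg = ⨆-nonneg {f = λ i → ‖ v i ‖₂} {b = sum λ i → ‖ v i ‖₂} (λ i → ‖‖₂-nonneg (v i)) bounded

    normSq≤maxNorm² : ∀ i → normSq (v i) ≤ maxNorm * maxNorm
    normSq≤maxNorm² i = square≤ {x = ‖ v i ‖₂} {y = maxNorm} (‖‖₂-nonneg (v i))
      (⨆-upper {f = λ i → ‖ v i ‖₂} {b = sum λ i → ‖ v i ‖₂} bounded i) (normSq≤‖‖₂^2 (v i))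

    maxNorm-least : ∀ {s} → 0# ≤ s → (∀ i → normSq (v i) ≤ s * s) → maxNorm ≤ s
    maxNorm-least {s} 0≤s h = ⨆-least-nonneg {f = λ i → ‖ v i ‖₂} {b = s} 0≤s λ i → ‖‖₂-least (v i) {s} 0≤s (h i)

  -- The lower bound

  root-det≤ : ∀ {m n p} (A : Matrix m n) (B : Matrix m p) (C : Matrix p n) → A ≋ (B ⊗ C) → ∀ b c → 0# ≤ b → 0# ≤ c →
    (∀ i → normSq (B i) ≤ b * b) → (∀ j → normSq (column C j) ≤ c * c) →
    ∀ k (rows : Choice (suc k) m) (cols : Choice (suc k) n) →
    root (suc k) ∣ det (submatrix A rows cols) ∣ ≤ b * c
  root-det≤ {p = p} A B C A≋BC b c 0≤b 0≤c B≤b C≤c k rows@(f , _) cols@(g , _) =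
    root-least k {∣ d ∣} {b * c} (∣∣-nonneg d) 0≤bc
      (x²≤y²⇒x≤y {∣ d ∣} {(b * c) ^ suc k} (^-nonneg (suc k) 0≤bc) (≤-respˡ-≈ (sym (∣∣² d)) det²≤))
    where
    open ≤R
    d = det (submatrix A rows cols)
    B′ : Matrix (suc k) p
    B′ i = B (f i)
    C′ : Matrix p (suc k)
    C′ l j = C l (g j)
    0≤bc : 0# ≤ b * c
    0≤bc = *-nonneg 0≤b 0≤c
    det²≤ : d * d ≤ (b * c) ^ suc k * (b * c) ^ suc k
    det²≤ = begin
      d * d                                          ≈⟨ *-cong (det-cong λ i j → A≋BC (f i) (g j)) (det-cong λ i j → A≋BC (f i) (g j)) ⟩
      det (B′ ⊗ C′) * det (B′ ⊗ C′)                  ≤⟨ det-⊗-hadamard B′ C′ ⟩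
      product (λ i → normSq (B′ i)) * product (λ j → normSq (column C′ j))
        ≤⟨ *-mono-≤ (product-nonneg λ i → normSq-nonneg (B′ i)) (product-≤-^ (λ i → normSq-nonneg (B′ i)) λ i → B≤b (f i))
             (product-nonneg λ j → normSq-nonneg (column C′ j)) (product-≤-^ (λ j → normSq-nonneg (column C′ j)) λ j → C≤c (g j)) ⟩
      (b * b) ^ suc k * (c * c) ^ suc k              ≈⟨ ^-distrib-* (b * b) (c * c) (suc k) ⟨
      (b * b * (c * c)) ^ suc k                      ≈⟨ ^-congˡ (suc k) (solve 2 (λ b c → b :* b :* (c :* c) := (b :* c) :* (b :* c)) refl b c) ⟩
      (b * c * (b * c)) ^ suc k                      ≈⟨ ^-distrib-* (b * c) (b * c) (suc k) ⟩
      (b * c) ^ suc k * (b * c) ^ suc k              ∎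

  root-det≤norms : ∀ {m n} (A : Matrix m n) ((_ , B , C , _) : Factorization A) →
    ∀ k (rows : Choice (suc k) m) (cols : Choice (suc k) n) →
    root (suc k) ∣ det (submatrix A rows cols) ∣ ≤ ‖ B ‖₂→∞ * ‖ C ‖₁→₂
  root-det≤norms A (_ , B , C , A≋BC) = root-det≤ A B C A≋BC ‖ B ‖₂→∞ ‖ C ‖₁→₂
    (maxNorm-nonneg B) (maxNorm-nonneg (column C)) (normSq≤maxNorm² B) (normSq≤maxNorm² (column C))
    where open MaxNorm

  -- It makes the family under the infimum of `γ₂` inhabited and, through `root-det≤norms`, the
  -- family under the supremum of `detlb` bounded.
  trivialFactorization : ∀ {m n} (A : Matrix m n) → Factorization A
  trivialFactorization {n = n} A = n , A , δ , λ i j → sym (⊗-identityʳ A i j)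

  private
    detlb-bounded : ∀ {m n} (A : Matrix m n) → Factorization A → ∃ λ b →
      ∀ k (rows : Choice (suc k) m) (cols : Choice (suc k) n) → root (suc k) ∣ det (submatrix A rows cols) ∣ ≤ b
    detlb-bounded A (p , B , C , e) = ‖ B ‖₂→∞ * ‖ C ‖₁→₂ , root-det≤norms A (p , B , C , e)

    detlb-upper : ∀ {m n} (A : Matrix m n) b →
      (∀ k (rows : Choice (suc k) m) (cols : Choice (suc k) n) → root (suc k) ∣ det (submatrix A rows cols) ∣ ≤ b) →
      0# ≤ detlb A ×
      (∀ k (rows : Choice (suc k) m) (cols : Choice (suc k) n) → root (suc k) ∣ det (submatrix A rows cols) ∣ ≤ detlb A)
    detlb-upper {m} {n} A b h =
      ⨆-nonneg {Σ ℕ λ k′ → Choice (suc k′) m × Choice (suc k′) n}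
        {f = λ (k′ , rows , cols) → root (suc k′) ∣ det (submatrix A rows cols) ∣} {b = b}
        (λ (k , rows , cols) → root-nonneg k (∣∣-nonneg (det (submatrix A rows cols))))
        (λ (k , rows , cols) → h k rows cols) ,
      λ k rows cols → ⨆-upper {Σ ℕ λ k′ → Choice (suc k′) m × Choice (suc k′) n}
        {f = λ (k′ , rows , cols) → root (suc k′) ∣ det (submatrix A rows cols) ∣} {b = b}
        (λ (k , rows , cols) → h k rows cols) (k , rows , cols)

    detlb-facts : ∀ {m n} (A : Matrix m n) → 0# ≤ detlb A ×
      (∀ k (rows : Choice (suc k) m) (cols : Choice (suc k) n) → root (suc k) ∣ det (submatrix A rows cols) ∣ ≤ detlb A)
    detlb-facts A = let (b , h) = detlb-bounded A (trivialFactorization A) in detlb-upper A b h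

  detlb-nonneg : ∀ {m n} (A : Matrix m n) → 0# ≤ detlb A
  detlb-nonneg A = proj₁ (detlb-facts A)

  root-det≤detlb : ∀ {m n} (A : Matrix m n) k (rows : Choice (suc k) m) (cols : Choice (suc k) n) →
    root (suc k) ∣ det (submatrix A rows cols) ∣ ≤ detlb A
  root-det≤detlb A = proj₂ (detlb-facts A)

  detlb-least : ∀ {m n} (A : Matrix m n) {b} → 0# ≤ b →
    (∀ k (rows : Choice (suc k) m) (cols : Choice (suc k) n) → root (suc k) ∣ det (submatrix A rows cols) ∣ ≤ b) →
    detlb A ≤ b
  detlb-least {m} {n} A {b} 0≤b h = ⨆-least-nonneg {Σ ℕ λ k′ → Choice (suc k′) m × Choice (suc k′) n}
    {f = λ (k′ , rows , cols) → root (suc k′) ∣ det (submatrix A rows cols) ∣} {b = b} 0≤b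
    (λ (k , rows , cols) → h k rows cols)

  norms-nonneg : ∀ {m n p} (B : Matrix m p) (C : Matrix p n) → 0# ≤ ‖ B ‖₂→∞ * ‖ C ‖₁→₂
  norms-nonneg B C = *-nonneg {‖ B ‖₂→∞} {‖ C ‖₁→₂} (maxNorm-nonneg B) (maxNorm-nonneg (column C))
    where open MaxNorm

  γ₂-greatest : ∀ {m n} (A : Matrix m n) {b} →
    (((_ , B , C , _) : Factorization A) → b ≤ ‖ B ‖₂→∞ * ‖ C ‖₁→₂) → b ≤ γ₂ A
  γ₂-greatest A {b} h = ⨅-greatest {Factorization A} {f = λ (_ , B , C , _) → ‖ B ‖₂→∞ * ‖ C ‖₁→₂} {b = b}
    (trivialFactorization A) h

  γ₂-lower : ∀ {m n} (A : Matrix m n) ((_ , B , C , _) : Factorization A) → γ₂ A ≤ ‖ B ‖₂→∞ * ‖ C ‖₁→₂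
  γ₂-lower A F = ⨅-lower {Factorization A} {f = λ (_ , B , C , _) → ‖ B ‖₂→∞ * ‖ C ‖₁→₂} {b = 0#}
    (λ (_ , B , C , _) → norms-nonneg B C) F

  detlb≤γ₂ : ∀ {m n} (A : Matrix m n) → detlb A ≤ γ₂ A
  detlb≤γ₂ A = γ₂-greatest A {detlb A} λ (p , B , C , e) →
    detlb-least A {‖ B ‖₂→∞ * ‖ C ‖₁→₂} (norms-nonneg B C) (root-det≤norms A (p , B , C , e))

  -- Minors with arbitrary, not necessarily increasing, rows and columns

  minor : ∀ {m n k} → Matrix m n → (Fin k → Fin m) → (Fin k → Fin n) → Carrier
  minor A f g = det λ i j → A (f i) (g j)

  sort-rows : ∀ {m n k} (A : Matrix m n) f g →
    minor {k = k} A f g ≈ 0# ⊎ ∃ λ f′ → StrictlyIncreasing f′ × minor A f′ g * minor A f′ g ≈ minor A f g * minor A f g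
  sort-rows {k = k} A f g = alternating-sort k (det-rows-ext C) (det-rows-alternating k C) f
    where
    C : Fin _ → Fin k → Carrier
    C x j = A x (g j)

  sort-columns : ∀ {m n k} (A : Matrix m n) f g →
    minor {k = k} A f g ≈ 0# ⊎ ∃ λ g′ → StrictlyIncreasing g′ × minor A f g′ * minor A f g′ ≈ minor A f g * minor A f g
  sort-columns A f g = Sum.map (trans (sym (t g)))
    (λ (g′ , inc , e) → g′ , inc , trans (*-cong (sym (t g′)) (sym (t g′))) (trans e (*-cong (t g) (t g))))
    (sort-rows (A ᵀ) g f)
    where
    t : ∀ g → minor (A ᵀ) g f ≈ minor A f g
    t g = det-ᵀ λ i j → A (f i) (g j)

  -- Sorting the rows and then the columns either shows the minor to be 0 or preserves its square,
  -- and a sorted minor is one of those in `detlb`.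
  minor²-≤ : ∀ {m n} (A : Matrix m n) k (f : Fin k → Fin m) g → minor A f g * minor A f g ≤ (detlb A * detlb A) ^ k
  minor²-≤ A zero    f g = ≤-reflexive (*-identityˡ 1#)
  minor²-≤ A (suc k) f g = [ square≈0 , (λ (f′ , inc-f , e) → ≤-respˡ-≈ e (by-columns inc-f)) ]′ (sort-rows A f g)
    where
    open ≤R
    D = detlb A
    0≤bound : 0# ≤ (D * D) ^ suc k
    0≤bound = ^-nonneg (suc k) (0≤x² D)
    square≈0 : ∀ {x} → x ≈ 0# → x * x ≤ (D * D) ^ suc k
    square≈0 e = ≤-respˡ-≈ (sym (trans (*-congʳ e) (zeroˡ _))) 0≤bound
    sorted : ∀ {f g} → StrictlyIncreasing f → StrictlyIncreasing g → minor A f g * minor A f g ≤ (D * D) ^ suc k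
    sorted {f} {g} inc-f inc-g = begin
      d * d                       ≈⟨ ∣∣² d ⟨
      ∣ d ∣ * ∣ d ∣               ≤⟨ *-mono-≤ (∣∣-nonneg d) ∣d∣≤ (∣∣-nonneg d) ∣d∣≤ ⟩
      D ^ suc k * D ^ suc k       ≈⟨ ^-distrib-* D D (suc k) ⟨
      (D * D) ^ suc k             ∎
      where
      d = minor A f g
      ∣d∣≤ : ∣ d ∣ ≤ D ^ suc k
      ∣d∣≤ = ≤-trans (a≤root^ k (∣∣-nonneg d))
        (^-mono-≤ (suc k) (root-nonneg k (∣∣-nonneg d)) (root-det≤detlb A k (f , inc-f) (g , inc-g)))
    by-columns : ∀ {f} → StrictlyIncreasing f → minor A f g * minor A f g ≤ (D * D) ^ suc k
    by-columns {f} inc-f = [ square≈0 , (λ (g′ , inc-g , e) → ≤-respˡ-≈ e (sorted inc-f inc-g)) ]′ (sort-columns A f g)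

  -- Columns that are independent on the chosen rows are independent in A, so a nonzero minor
  -- contradicts maximality of r. Only the columns are sorted, since the rank is counted by
  -- increasing choices of columns.
  minor-above-rank : ∀ {m n} (A : Matrix m n) {r} → HasRank A r → ∀ {k} → r ℕ.< k → ∀ f g → minor {k = k} A f g ≈ 0#
  minor-above-rank A (_ , maximal) {k} r<k f g = decidable-stable (minor A f g ≈? 0#) λ d≉0 →
    [ d≉0
    , (λ (g′ , inc , e) → ℕₚ.<⇒≱ r<k (maximal k ((g′ , inc) , λ c h →
        det≉0⇒independent (λ i j → A (f i) (g′ j))
          (λ e′ → d≉0 (x²≤0⇒x≈0 (≤-reflexive (trans (sym e) (trans (*-congʳ e′) (zeroˡ _)))))) c (h ∘ f))))
    ]′ (sort-columns A f g)

  -- Weighted factorizations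

  *-cancelˡ-< : ∀ {c x y} → 0# < c → c * x < c * y → x < y
  *-cancelˡ-< {c} {x} {y} p q with compare x y
  ... | tri< r _ _ = r
  ... | tri≈ _ e _ = ⊥-elim (irrefl (*-congˡ e) q)
  ... | tri> _ _ r = ⊥-elim (<-asym q (*-monoˡ-< p r))

  -- The shape of the bounds σ: index k belongs to dimension k + 1, and from k = r on the minors of
  -- size k + 1 vanish.
  truncated : ℕ → ℕ → Carrier
  truncated r k with k ℕₚ.<? r
  ... | yes _ = fromℕ (suc k) ⁻¹
  ... | no  _ = 0#

  truncated-nonneg : ∀ r k → 0# ≤ truncated r k
  truncated-nonneg r k with k ℕₚ.<? r
  ... | yes _ = <⇒≤ (⁻¹-pos (fromℕ-pos k))
  ... | no  _ = ≤-refl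

  truncated-< : ∀ {r k} → k ℕ.< r → truncated r k ≈ fromℕ (suc k) ⁻¹
  truncated-< {r} {k} p with k ℕₚ.<? r
  ... | yes _ = refl
  ... | no n  = ⊥-elim (n p)

  -- Truncation at r is what produces H_r instead of H_n; the ε terms are n in number.
  total-truncated : ∀ r n E ε → 0# ≤ E →
    total (λ k → truncated r k * E + ε) n ≤ 2# * E * harmonic r + fromℕ n * (2# * ε)
  total-truncated r n E ε 0≤E = ≤-trans (≤-reflexive (split n)) (+-mono-≤ (*-monoˡ-≤ 0≤2E (partial≤ n)) ≤-refl)
    where
    0≤2E = *-nonneg (<⇒≤ 0<2) 0≤E
    partial : ℕ → Carrier
    partial zero    = 0#
    partial (suc n) = partial n + truncated r n
    split : ∀ n → total (λ k → truncated r k * E + ε) n ≈ 2# * E * partial n + fromℕ n * (2# * ε)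
    split zero    = solve 2 (λ E ε → :0 := :2 :* E :* :0 :+ :0 :* (:2 :* ε)) refl E ε
    split (suc n) = trans (+-congʳ (split n))
      (solve 5 (λ E p n ε t → :2 :* E :* p :+ n :* (:2 :* ε) :+ :2 :* (t :* E :+ ε)
        := :2 :* E :* (p :+ t) :+ (:1 :+ n) :* (:2 :* ε)) refl E (partial n) (fromℕ n) ε (truncated r n))
    partial≤harmonic : ∀ n → partial n ≤ harmonic n
    partial≤harmonic zero    = ≤-refl
    partial≤harmonic (suc n) = +-mono-≤ (partial≤harmonic n) step
      where
      step : truncated r n ≤ fromℕ (suc n) ⁻¹
      step with n ℕₚ.<? r
      ... | yes _ = ≤-refl
      ... | no  _ = <⇒≤ (⁻¹-pos (fromℕ-pos n))
    partial≤ : ∀ n → partial n ≤ harmonic r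
    partial≤ zero    = harmonic-mono-≤ {0} {r} ℕ.z≤n
    partial≤ (suc n) with ℕₚ.<-≤-connex n r
    ... | inj₁ n<r = ≤-trans (partial≤harmonic (suc n)) (harmonic-mono-≤ n<r)
    ... | inj₂ r≤n = ≤-trans (≤-reflexive (trans (+-congˡ zero-term) (+-identityʳ _))) (partial≤ n)
      where
      zero-term : truncated r n ≈ 0#
      zero-term with n ℕₚ.<? r
      ... | yes n<r = ⊥-elim (ℕₚ.<⇒≱ n<r r≤n)
      ... | no  _   = refl

  module Weighted {m n} (A : Matrix m n) (r : ℕ) (D : Carrier) (0≤D : 0# ≤ D)
    (minor≤ : ∀ k (f : Fin k → Fin m) g → minor A f g * minor A f g ≤ (D * D) ^ k)
    (minor≈0 : ∀ {k} → r ℕ.< k → ∀ f g → minor {k = k} A f g ≈ 0#)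
    (p : Vec m) (q : Vec n) (0<p : ∀ i → 0# < p i) (0<q : ∀ j → 0# < q j) where

    private
      α = sum p
      β = sum q
      0≤α : 0# ≤ α
      0≤α = sum-nonneg λ i → <⇒≤ (0<p i)
      0≤β : 0# ≤ β
      0≤β = sum-nonneg λ j → <⇒≤ (0<q j)
      a : Vec m
      a i = proj₁ (sqrt-exists (0<p i))
      0<a : ∀ i → 0# < a i
      0<a i = proj₁ (proj₂ (sqrt-exists (0<p i)))
      a² : ∀ i → a i * a i ≈ p i
      a² i = proj₂ (proj₂ (sqrt-exists (0<p i)))
      b : Vec n
      b j = proj₁ (sqrt-exists (0<q j))
      0<b : ∀ j → 0# < b j
      0<b j = proj₁ (proj₂ (sqrt-exists (0<q j)))
      b² : ∀ j → b j * b j ≈ q j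
      b² j = proj₂ (proj₂ (sqrt-exists (0<q j)))

      M : Matrix m n
      M i j = a i * A i j * b j

      minor-M : ∀ {k} (f : Fin k → Fin m) g → minor M f g * minor M f g ≈
        product (p ∘ f) * product (q ∘ g) * (minor A f g * minor A f g)
      minor-M f g = begin
        minor M f g * minor M f g
          ≈⟨ *-cong scaled scaled ⟩
        product (b ∘ g) * (product (a ∘ f) * d) * (product (b ∘ g) * (product (a ∘ f) * d))
          ≈⟨ solve 3 (λ x y d → x :* (y :* d) :* (x :* (y :* d)) := (y :* y) :* (x :* x) :* (d :* d)) refl (product (b ∘ g)) (product (a ∘ f)) d ⟩
        product (a ∘ f) * product (a ∘ f) * (product (b ∘ g) * product (b ∘ g)) * (d * d)
          ≈⟨ *-congʳ (*-cong (trans (sym (product-distrib-* (a ∘ f) (a ∘ f))) (product-cong (a² ∘ f)))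
               (trans (sym (product-distrib-* (b ∘ g) (b ∘ g))) (product-cong (b² ∘ g)))) ⟩
        product (p ∘ f) * product (q ∘ g) * (d * d) ∎
        where
        open ≈R
        d = minor A f g
        scaled : minor M f g ≈ product (b ∘ g) * (product (a ∘ f) * d)
        scaled = trans (det-scale-columns (b ∘ g) λ i j → a (f i) * A (f i) (g j))
          (*-congˡ (det-scale-rows (a ∘ f) λ i j → A (f i) (g j)))

      -- The squared minors of A are bounded uniformly, and the remaining products of weights sum
      -- over all f and g to α^k and β^k by `∑→-product`.
      minorSqSum-≤ : ∀ k → minorSqSum k M ≤ (D * D * α * β) ^ k
      minorSqSum-≤ k = begin
        minorSqSum k M
          ≤⟨ ∑→-mono-≤ k (λ f → ∑→-mono-≤ k λ g → ≤-respˡ-≈ (sym (minor-M f g))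
               (≤-trans (*-monoˡ-≤ (*-nonneg (product-nonneg λ i → <⇒≤ (0<p (f i))) (product-nonneg λ j → <⇒≤ (0<q (g j)))) (minor≤ k f g))
                 (≤-reflexive (solve 3 (λ x y d → x :* y :* d := (d :* x) :* y) refl (product (p ∘ f)) (product (q ∘ g)) Δ)))) ⟩
        ∑→ k (λ f → ∑→ k λ g → Δ * product (p ∘ f) * product (q ∘ g))
          ≈⟨ ∑→-cong k (λ f → trans (sym (*-distribˡ-∑→ k (Δ * product (p ∘ f)) λ g → product (q ∘ g)))
               (trans (*-congˡ (∑→-product k q)) (solve 3 (λ d x y → d :* x :* y := (d :* y) :* x) refl Δ (product (p ∘ f)) (β ^ k)))) ⟩
        ∑→ k (λ f → Δ * β ^ k * product (p ∘ f))
          ≈⟨ trans (sym (*-distribˡ-∑→ k (Δ * β ^ k) λ f → product (p ∘ f))) (*-congˡ (∑→-product k p)) ⟩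
        Δ * β ^ k * α ^ k
          ≈⟨ solve 3 (λ d x y → d :* y :* x := d :* x :* y) refl Δ (α ^ k) (β ^ k) ⟩
        Δ * α ^ k * β ^ k
          ≈⟨ trans (^-distrib-* (D * D * α) β k) (*-congʳ (^-distrib-* (D * D) α k)) ⟨
        (D * D * α * β) ^ k ∎
        where
        open ≤R
        Δ = (D * D) ^ k

      -- It takes the place of 2 D √(αβ): 4 D² α β ≤ T² by the inequality of the means.
      T = D * (α + β)
      0≤T : 0# ≤ T
      0≤T = *-nonneg 0≤D (+-nonneg 0≤α 0≤β)
      4# = 2# * 2#
      0<4 : 0# < 4#
      0<4 = *-pos 0<2 0<2

    module _ {ε} (0<ε : 0# < ε) where
      private
        -- Below the rank this is 4 D √(αβ) / (k + 1) with 2 √(αβ) relaxed to α + β, enlarged by ε.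
        -- The enlargement provides strict inequalities and a positive square root at every index.
        σ : ℕ → Carrier
        σ k = truncated r k * (2# * T) + ε

        0≤2T = *-nonneg (<⇒≤ 0<2) 0≤T

        0<σ : ∀ k → 0# < σ k
        0<σ k = <-respʳ-≈ (+-comm _ _) (+-pos-nonneg 0<ε (*-nonneg (truncated-nonneg r k) 0≤2T))

        -- With K = k + 1, 2 T < K σ and K^K ≤ 4^K K! give T^K < 2^K K! σ^K. Its square is compared
        -- with (4 D² α β)^K ≤ (T²)^K, so the claim appears multiplied by 4^K.
        small-below-rank : ∀ k → k ℕ.< r → minorSqSum (suc k) M < fromℕ (suc k !) * fromℕ (suc k !) * (σ k * σ k) ^ suc k
        small-below-rank k k<r = *-cancelˡ-< (^-pos K 0<4) (begin-strict
          4# ^ K * minorSqSum K M              ≤⟨ *-monoˡ-≤ (^-nonneg K (<⇒≤ 0<4)) (minorSqSum-≤ K) ⟩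
          4# ^ K * (D * D * α * β) ^ K         ≈⟨ ^-distrib-* 4# (D * D * α * β) K ⟨
          (4# * (D * D * α * β)) ^ K           ≤⟨ ^-mono-≤ K (*-nonneg (<⇒≤ 0<4) (*-nonneg (*-nonneg (0≤x² D) 0≤α) 0≤β))
            (≤-by (solve 3 (λ d x y → (d :* (x :+ y)) :* (d :* (x :+ y)) :- :2 :* :2 :* (d :* d :* x :* y)
               := (d :* (x :- y)) :* (d :* (x :- y))) refl D α β) (0≤x² _)) ⟩
          (T * T) ^ K                          ≈⟨ ^-distrib-* T T K ⟩
          T ^ K * T ^ K                        <⟨ ≤-<-trans (*-monoˡ-≤ (^-nonneg K 0≤T) (<⇒≤ T^K<))
                                                    (<-respˡ-≈ (*-comm _ _) (*-monoˡ-< (≤-<-trans (^-nonneg K 0≤T) T^K<) T^K<)) ⟩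
          2# ^ K * X * (2# ^ K * X)            ≈⟨ solve 2 (λ z x → z :* x :* (z :* x) := z :* z :* (x :* x)) refl (2# ^ K) X ⟩
          2# ^ K * 2# ^ K * (X * X)            ≈⟨ *-cong (sym (^-distrib-* 2# 2# K)) X² ⟩
          4# ^ K * (K! * K! * (σ k * σ k) ^ K) ∎)
          where
          open ≤R
          K = suc k
          K! = fromℕ (K !)
          X = K! * σ k ^ K
          X² : X * X ≈ K! * K! * (σ k * σ k) ^ K
          X² = trans (solve 2 (λ f s → f :* s :* (f :* s) := f :* f :* (s :* s)) refl K! (σ k ^ K)) (*-congˡ (sym (^-distrib-* (σ k) (σ k) K)))
          2T<Kσ : 2# * T < fromℕ K * σ k
          2T<Kσ = <-by (begin-equality
              fromℕ K * (truncated r k * (2# * T) + ε) - 2# * T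
                ≈⟨ +-congʳ (*-congˡ (+-congʳ (*-congʳ (truncated-< k<r)))) ⟩
              fromℕ K * (fromℕ K ⁻¹ * (2# * T) + ε) - 2# * T
                ≈⟨ solve 4 (λ n m t e → n :* (m :* t :+ e) :- t := (n :* m) :* t :- t :+ n :* e) refl (fromℕ K) (fromℕ K ⁻¹) (2# * T) ε ⟩
              fromℕ K * fromℕ K ⁻¹ * (2# * T) - 2# * T + fromℕ K * ε
                ≈⟨ +-congʳ (+-congʳ (trans (*-congʳ (*-inverse (fromℕ-pos k))) (*-identityˡ _))) ⟩
              2# * T - 2# * T + fromℕ K * ε
                ≈⟨ trans (+-congʳ (-‿inverseʳ _)) (+-identityˡ _) ⟩
              fromℕ K * ε ∎)
            (*-pos (fromℕ-pos k) 0<ε)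
          T^K< : T ^ K < 2# ^ K * X
          T^K< = *-cancelˡ-< (^-pos K 0<2) (begin-strict
            2# ^ K * T ^ K                        ≈⟨ ^-distrib-* 2# T K ⟨
            (2# * T) ^ K                          <⟨ ^-mono-< k 0≤2T 2T<Kσ ⟩
            (fromℕ K * σ k) ^ K                   ≈⟨ ^-distrib-* (fromℕ K) (σ k) K ⟩
            fromℕ K ^ K * σ k ^ K                 ≤⟨ *-monoʳ-≤ (^-nonneg K (<⇒≤ (0<σ k))) (k^k≤4^k*k! K) ⟩
            4# ^ K * K! * σ k ^ K                 ≈⟨ *-congʳ (*-congʳ (^-distrib-* 2# 2# K)) ⟩
            2# ^ K * 2# ^ K * K! * σ k ^ K        ≈⟨ solve 3 (λ z f s → z :* z :* f :* s := z :* (z :* (f :* s))) refl (2# ^ K) K! (σ k ^ K) ⟩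
            2# ^ K * (2# ^ K * X)                 ∎)

        small : ∀ k → minorSqSum (suc k) M < fromℕ (suc k !) * fromℕ (suc k !) * (σ k * σ k) ^ suc k
        small k with ℕₚ.<-≤-connex k r
        ... | inj₁ k<r = small-below-rank k k<r
        ... | inj₂ r≤k = <-respˡ-≈ (sym (∑→-zero (suc k) λ f → ∑→-zero (suc k) λ g →
                trans (minor-M f g) (trans (*-congˡ (trans (*-congʳ (minor≈0 (ℕ.s≤s r≤k) f g)) (zeroˡ _))) (zeroʳ _))))
              (*-pos (*-pos (fromℕ!-pos (suc k)) (fromℕ!-pos (suc k))) (^-pos (suc k) (*-pos (0<σ k) (0<σ k))))

        UV = low-cost-factorization M σ 0<σ small n δ λ i j → trans (sum-cong λ l → *-congʳ (δ-sym l i)) (trans (sum-δ i (column δ j)) refl)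
        U = proj₁ UV
        V = proj₁ (proj₂ UV)

        -- Undoing the scaling of M turns the squared Frobenius norms of U and V into the weighted
        -- sums of squared row and column norms.
        B : Matrix m n
        B i l = a i ⁻¹ * U i l
        C : Matrix n n
        C l j = b j ⁻¹ * V l j

        A≋BC : A ≋ (B ⊗ C)
        A≋BC i j = *-cancelˡ (*-pos (0<a i) (0<b j)) (begin
          a i * b j * A i j
            ≈⟨ solve 3 (λ a b x → a :* b :* x := a :* x :* b) refl (a i) (b j) (A i j) ⟩
          M i j
            ≈⟨ ⊗-identityʳ M i j ⟨
          (M ⊗ δ) i j
            ≈⟨ proj₁ (proj₂ (proj₂ UV)) i j ⟩
          sum (λ l → U i l * V l j)
            ≈⟨ sum-cong (λ l → sym (trans
                 (solve 6 (λ a b a′ b′ u v → a :* b :* (a′ :* u :* (b′ :* v)) := (a :* a′) :* ((b :* b′) :* (u :* v))) refl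
                   (a i) (b j) (a i ⁻¹) (b j ⁻¹) (U i l) (V l j))
                 (trans (*-cong (*-inverse (0<a i)) (trans (*-congʳ (*-inverse (0<b j))) (*-identityˡ _))) (*-identityˡ _)))) ⟩
          sum (λ l → a i * b j * (B i l * C l j))
            ≈⟨ *-distribˡ-sum (a i * b j) (λ l → B i l * C l j) ⟨
          a i * b j * (B ⊗ C) i j ∎)
          where open ≈R

        unscale : ∀ {k x w} (v : Vec k) → 0# < x → x * x ≈ w → w * normSq (λ l → x ⁻¹ * v l) ≈ normSq v
        unscale {x = x} {w} v 0<x x²≈w = begin
          w * normSq (λ l → x ⁻¹ * v l)        ≈⟨ *-cong (sym x²≈w) (normSq-scale (x ⁻¹) v) ⟩
          x * x * (x ⁻¹ * x ⁻¹ * normSq v)     ≈⟨ solve 3 (λ x y n → x :* x :* (y :* y :* n) := (x :* y) :* ((x :* y) :* n)) refl x (x ⁻¹) (normSq v) ⟩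
          x * x ⁻¹ * (x * x ⁻¹ * normSq v)     ≈⟨ trans (*-cong (*-inverse 0<x) (trans (*-congʳ (*-inverse 0<x)) (*-identityˡ _))) (*-identityˡ _) ⟩
          normSq v                             ∎
          where open ≈R

      factorization : Factorization A
      factorization = n , B , C , A≋BC

      cost : sum (λ i → p i * normSq (B i)) + sum (λ j → q j * normSq (column C j))
        ≤ 4# * D * harmonic r * (α + β) + fromℕ n * (2# * ε)
      cost = begin
        sum (λ i → p i * normSq (B i)) + sum (λ j → q j * normSq (column C j))
          ≈⟨ +-cong (sum-cong λ i → unscale (U i) (0<a i) (a² i)) (sum-cong λ j → unscale (column V j) (0<b j) (b² j)) ⟩
        frobSq U + sum (λ j → normSq (column V j))
          ≈⟨ +-congˡ (∑-comm λ j l → V l j * V l j) ⟩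
        frobSq U + frobSq V
          ≤⟨ proj₂ (proj₂ (proj₂ UV)) ⟩
        total σ n
          ≤⟨ total-truncated r n (2# * T) ε 0≤2T ⟩
        2# * (2# * T) * harmonic r + fromℕ n * (2# * ε)
          ≈⟨ +-congʳ (solve 4 (λ t d s h → t :* (t :* (d :* s)) :* h := t :* t :* d :* h :* s) refl 2# D (α + β) (harmonic r)) ⟩
        4# * D * harmonic r * (α + β) + fromℕ n * (2# * ε) ∎
        where open ≤R

  -- Convexity of the achievable norms

  -- Row data first, column data after. Squared norms are recorded because concatenating two scaled
  -- factorizations averages them exactly.
  profile : ∀ {m n} {A : Matrix m n} → Factorization A → Vec (m ℕ.+ n)
  profile {m} (_ , B , C , _) i = [ (λ i → normSq (B i)) , (λ j → normSq (column C j)) ]′ (splitAt m i)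

  Achieved : ∀ {m n} → Matrix m n → Vec (m ℕ.+ n) → Set
  Achieved A v = ∃ λ (F : Factorization A) → ∀ i → v i ≈ profile F i

  private
    [,]-map₂ : ∀ {X Y : Set} (_∙_ : Carrier → Carrier → Carrier) {f f′ : X → Carrier} {g g′ : Y → Carrier} s →
      [ f , g ]′ s ∙ [ f′ , g′ ]′ s ≈ [ (λ x → f x ∙ f′ x) , (λ y → g y ∙ g′ y) ]′ s
    [,]-map₂ _∙_ (inj₁ _) = refl
    [,]-map₂ _∙_ (inj₂ _) = refl

    [,]-cong : ∀ {X Y : Set} {f f′ : X → Carrier} {g g′ : Y → Carrier} →
      (∀ x → f x ≈ f′ x) → (∀ y → g y ≈ g′ y) → ∀ s → [ f , g ]′ s ≈ [ f′ , g′ ]′ s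
    [,]-cong h k (inj₁ x) = h x
    [,]-cong h k (inj₂ y) = k y

    sum-++-* : ∀ p {q} (f f′ : Vec p) (g g′ : Vec q) →
      sum (λ l → [ f , g ]′ (splitAt p l) * [ f′ , g′ ]′ (splitAt p l)) ≈ sum (λ l → f l * f′ l) + sum (λ l → g l * g′ l)
    sum-++-* p f f′ g g′ = trans (sum-cong λ l → [,]-map₂ _*_ {f} {f′} {g} {g′} (splitAt p l))
      (sum-++ p (λ l → f l * f′ l) (λ l → g l * g′ l))

  -- Concatenating the two factorizations, scaled by a and b, averages the squared norms.
  module Mix {m n} {A : Matrix m n} {a b} (a²+b²≈1 : a * a + b * b ≈ 1#) (F G : Factorization A) where

    private
      p₁ = proj₁ F
      B₁ = proj₁ (proj₂ F)
      C₁ = proj₁ (proj₂ (proj₂ F))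
      p₂ = proj₁ G
      B₂ = proj₁ (proj₂ G)
      C₂ = proj₁ (proj₂ (proj₂ G))

      B : Matrix m (p₁ ℕ.+ p₂)
      B i l = [ (λ l → a * B₁ i l) , (λ l → b * B₂ i l) ]′ (splitAt p₁ l)

      C : Matrix (p₁ ℕ.+ p₂) n
      C l j = [ (λ l → a * C₁ l j) , (λ l → b * C₂ l j) ]′ (splitAt p₁ l)

      scaled : ∀ {k} x (u v : Vec k) → sum (λ l → x * u l * (x * v l)) ≈ x * x * sum (λ l → u l * v l)
      scaled x u v = trans (sum-cong λ l → solve 3 (λ x u v → x :* u :* (x :* v) := x :* x :* (u :* v)) refl x (u l) (v l))
        (sym (*-distribˡ-sum (x * x) λ l → u l * v l))

      mixed : ∀ (u v : Vec p₁) (u′ v′ : Vec p₂) →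
        sum (λ l → [ (λ l → a * u l) , (λ l → b * u′ l) ]′ (splitAt p₁ l) * [ (λ l → a * v l) , (λ l → b * v′ l) ]′ (splitAt p₁ l))
        ≈ a * a * sum (λ l → u l * v l) + b * b * sum (λ l → u′ l * v′ l)
      mixed u v u′ v′ = trans (sum-++-* p₁ (λ l → a * u l) (λ l → a * v l) (λ l → b * u′ l) (λ l → b * v′ l))
        (+-cong (scaled a u v) (scaled b u′ v′))

    mix : Factorization A
    mix = p₁ ℕ.+ p₂ , B , C , λ i j → begin
      A i j                                      ≈⟨ *-identityˡ _ ⟨
      1# * A i j                                 ≈⟨ *-congʳ a²+b²≈1 ⟨
      (a * a + b * b) * A i j                    ≈⟨ distribʳ (A i j) (a * a) (b * b) ⟩
      a * a * A i j + b * b * A i j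
        ≈⟨ +-cong (*-congˡ (proj₂ (proj₂ (proj₂ F)) i j)) (*-congˡ (proj₂ (proj₂ (proj₂ G)) i j)) ⟩
      a * a * (B₁ ⊗ C₁) i j + b * b * (B₂ ⊗ C₂) i j
        ≈⟨ mixed (B₁ i) (column C₁ j) (B₂ i) (column C₂ j) ⟨
      (B ⊗ C) i j                                ∎
      where open ≈R

    profile-mix : ∀ i → profile mix i ≈ a * a * profile F i + b * b * profile G i
    profile-mix i = trans
      ([,]-cong (λ i → mixed (B₁ i) (B₁ i) (B₂ i) (B₂ i)) (λ j → mixed (column C₁ j) (column C₁ j) (column C₂ j) (column C₂ j)) (splitAt m i))
      (sym ([,]-map₂ (λ x y → a * a * x + b * b * y) (splitAt m i)))

  achieved-convex : ∀ {m n} (A : Matrix m n) {u v} t → Achieved A u → Achieved A v → 0# < t → t < 1# →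
    Achieved A λ i → v i + t * (u i - v i)
  achieved-convex A {u} {v} t (F , u≈) (G , v≈) 0<t t<1 =
    Mix.mix {a = a} {b} e F G , λ i → begin
      v i + t * (u i - v i)
        ≈⟨ solve 3 (λ v t u → v :+ t :* (u :- v) := t :* u :+ (:1 :- t) :* v) refl (v i) t (u i) ⟩
      t * u i + (1# - t) * v i
        ≈⟨ +-cong (*-cong (sym (proj₂ (proj₂ √t))) (u≈ i)) (*-cong (sym (proj₂ (proj₂ √1-t))) (v≈ i)) ⟩
      a * a * profile F i + b * b * profile G i
        ≈⟨ Mix.profile-mix {a = a} {b} e F G i ⟨
      profile (Mix.mix {a = a} {b} e F G) i ∎
    where
    open ≈R
    √t = sqrt-exists 0<t
    √1-t = sqrt-exists (0<y-x t<1)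
    a = proj₁ √t
    b = proj₁ √1-t
    e : a * a + b * b ≈ 1#
    e = trans (+-cong (proj₂ (proj₂ √t)) (proj₂ (proj₂ √1-t))) (solve 1 (λ t → t :+ (:1 :- t) := :1) refl t)

  profile-nonneg : ∀ {m n} {A : Matrix m n} (F : Factorization A) i → 0# ≤ profile F i
  profile-nonneg {m} (_ , B , C , _) i with splitAt m i
  ... | inj₁ i′ = normSq-nonneg (B i′)
  ... | inj₂ j′ = normSq-nonneg (column C j′)

  -- One bound K serves rows and columns alike, so each of the two norms is at most the square root
  -- of K.
  bounded-profile⇒norms≤ : ∀ {m n} {A : Matrix m n} ((p , B , C , e) : Factorization A) {K} → 0# < K →
    (∀ i → profile {A = A} (p , B , C , e) i ≤ K) → ‖ B ‖₂→∞ * ‖ C ‖₁→₂ ≤ K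
  bounded-profile⇒norms≤ {m} {n} (p , B , C , e) {K} 0<K h = ≤-respʳ-≈ s²≈K
    (*-mono-≤ {‖ B ‖₂→∞} {s} {‖ C ‖₁→₂} {s} (maxNorm-nonneg B) (maxNorm-least B {s} 0≤s B≤)
      (maxNorm-nonneg (column C)) (maxNorm-least (column C) {s} 0≤s C≤))
    where
    open MaxNorm
    s = proj₁ (sqrt-exists 0<K)
    0≤s = <⇒≤ (proj₁ (proj₂ (sqrt-exists 0<K)))
    s²≈K = proj₂ (proj₂ (sqrt-exists 0<K))
    at : ∀ {i} z → splitAt m i ≡ z → [ (λ i → normSq (B i)) , (λ j → normSq (column C j)) ]′ z ≤ K
    at {i} z eq = ≡.subst (λ z → [ (λ i → normSq (B i)) , (λ j → normSq (column C j)) ]′ z ≤ K) eq (h i)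
    B≤ : ∀ i → normSq (B i) ≤ s * s
    B≤ i = ≤-respʳ-≈ (sym s²≈K) (at (inj₁ i) (Finₚ.splitAt-↑ˡ m i n))
    C≤ : ∀ j → normSq (column C j) ≤ s * s
    C≤ j = ≤-respʳ-≈ (sym s²≈K) (at (inj₂ j) (Finₚ.splitAt-↑ʳ m n j))

  -- The upper bound

  γ₂-upper : ∀ {m n} (A : Matrix m n) (r : ℕ) (D : Carrier) → 0# ≤ D →
    (∀ k (f : Fin k → Fin m) g → minor A f g * minor A f g ≤ (D * D) ^ k) →
    (∀ {k} → r ℕ.< k → ∀ f g → minor {k = k} A f g ≈ 0#) → Fin n →
    γ₂ A ≤ 2# * 2# * D * harmonic r
  γ₂-upper {m} {n} A r D 0≤D minor≤ minor≈0 j₀ = ≤-by-ε {γ₂ A} λ ε 0<ε →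
    -- One half of ε makes K positive even when K₀ = 0, the other half is the error left by
    -- `minimax`.
    let κ = ε * ½
        0<κ = *-pos 0<ε 0<½
        0<K = <-respʳ-≈ (+-comm κ K₀) (+-pos-nonneg 0<κ 0≤K₀)
        (v , (F , v≈) , v≤) = minimax (Achieved A) {K₀ + κ} 0<K
          (λ (F , v≈) i → ≤-respʳ-≈ (sym (v≈ i)) (profile-nonneg F i)) (achieved-convex A) (weighted κ 0<κ) κ 0<κ
    in ≤-trans {γ₂ A} (γ₂-lower A F) (bounded-profile⇒norms≤ F
         (<-respʳ-≈ (+-comm ε K₀) (+-pos-nonneg 0<ε 0≤K₀))
         (λ i → ≤-respˡ-≈ (v≈ i) (≤-respʳ-≈ (halves ε) (v≤ i))))
    where
    K₀ = 2# * 2# * D * harmonic r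
    0≤K₀ : 0# ≤ K₀
    0≤K₀ = *-nonneg (*-nonneg (<⇒≤ (*-pos 0<2 0<2)) 0≤D) (harmonic-mono-≤ {0} {r} ℕ.z≤n)
    halves : ∀ ε → K₀ + ε * ½ + ε * ½ ≈ K₀ + ε
    halves ε = trans (solve 3 (λ k e h → k :+ e :* h :+ e :* h := k :+ (:2 :* h) :* e) refl K₀ ε ½)
      (+-congˡ (trans (*-congʳ 2*½≈1) (*-identityˡ ε)))
    weighted : ∀ κ → 0# < κ → ∀ w → (∀ i → 0# < w i) →
      ∃ λ v → Achieved A v × sum (λ i → w i * v i) ≤ (K₀ + κ) * sum w
    weighted κ 0<κ w 0<w = profile F , (F , λ _ → refl) , (begin
      sum (λ i → w i * profile F i)
        ≈⟨ sum-cong (λ i → *-congʳ {x = profile F i} (w≈ i)) ⟩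
      sum (λ i → [ p , q ]′ (splitAt m i) * [ (λ i → normSq (B i)) , (λ j → normSq (column C j)) ]′ (splitAt m i))
        ≈⟨ sum-++-* m p (λ i → normSq (B i)) q (λ j → normSq (column C j)) ⟩
      sum (λ i → p i * normSq (B i)) + sum (λ j → q j * normSq (column C j))
        ≤⟨ W.cost 0<ε ⟩
      K₀ * (sum p + sum q) + fromℕ n * (2# * ε)
        ≈⟨ +-cong (*-congˡ sum-w) (solve 2 (λ n e → n :* (:2 :* e) := e :* (n :* :2)) refl (fromℕ n) ε) ⟩
      K₀ * sum w + ε * (fromℕ n * 2#)
        ≤⟨ +-mono-≤ ≤-refl (proj₂ (proj₂ (proj₂ choose-ε))) ⟩
      K₀ * sum w + κ * sum w
        ≈⟨ distribʳ (sum w) K₀ κ ⟨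
      (K₀ + κ) * sum w ∎)
      where
      open ≤R
      p : Vec m
      p i = w (i ↑ˡ n)
      q : Vec n
      q j = w (m ↑ʳ j)
      w≈ : ∀ i → w i ≈ [ p , q ]′ (splitAt m i)
      w≈ i = trans (reflexive (≡.cong w (≡.sym (Finₚ.join-splitAt m n i)))) (go (splitAt m i))
        where
        go : ∀ z → w (join m n z) ≈ [ p , q ]′ z
        go (inj₁ _) = refl
        go (inj₂ _) = refl
      sum-w : sum p + sum q ≈ sum w
      sum-w = sym (trans (sum-cong w≈) (sum-++ m p q))
      0<sum-w : 0# < sum w
      0<sum-w = <-≤-trans (0<w (m ↑ʳ j₀)) (term≤sum (<⇒≤ ∘ 0<w) (m ↑ʳ j₀))
      -- The error 2 n ε of the factorization has to fit into κ times the total weight, which is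
      -- positive because there is a column.
      choose-ε = small-multiplier (*-pos 0<κ 0<sum-w) (*-nonneg (fromℕ-nonneg n) (<⇒≤ 0<2))
      ε = proj₁ choose-ε
      0<ε = proj₁ (proj₂ choose-ε)
      module W = Weighted A r D 0≤D minor≤ minor≈0 p q (λ i → 0<w (i ↑ˡ n)) (λ j → 0<w (m ↑ʳ j))
      F : Factorization A
      F = W.factorization 0<ε
      B = proj₁ (proj₂ F)
      C = proj₁ (proj₂ (proj₂ F))

  -- A factor 4 from the cost of the weighted factorization and a factor 4 from `harmonic≤4log`.
  16# : Carrier
  16# = 2# * 2# * (2# * 2#)

  0<16 : 0# < 16#
  0<16 = *-pos (*-pos 0<2 0<2) (*-pos 0<2 0<2)

  -- The harmonic bound with D = `detlb A` is combined with `harmonic≤4log`; the independent columns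
  -- witnessing the rank supply the column that `γ₂-upper` asks for.
  γ₂≤log*detlb : ∀ {m n} (A : Matrix m n) r → HasRank A r → 2 ℕ.≤ r →
    γ₂ A ≤ 16# * log (fromℕ r) * detlb A
  γ₂≤log*detlb {m} {n} A (suc r) rank@(((cols , _) , _) , _) 2≤r = finish (γ₂ A) (detlb A) (log (fromℕ (suc r)))
    (detlb-nonneg A)
    (γ₂-upper A (suc r) (detlb A) (detlb-nonneg A) (minor²-≤ A) (minor-above-rank A rank) (cols zero))
    (harmonic≤4log (suc r) 2≤r)
    where
    finish : ∀ γ D l → 0# ≤ D → γ ≤ 2# * 2# * D * harmonic (suc r) → harmonic (suc r) ≤ 2# * 2# * l →
      γ ≤ 16# * l * D
    finish γ D l 0≤D p h = ≤-trans p (≤-trans (*-monoˡ-≤ (*-nonneg (<⇒≤ (*-pos 0<2 0<2)) 0≤D) h)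
      (≤-reflexive (solve 3 (λ t d l → t :* t :* d :* (t :* t :* l) := (t :* t :* (t :* t)) :* l :* d) refl 2# D l)))

theorem3p1 : (ℝ : CompleteOrderedField) → let open RealMatrices ℝ in
    ∃ λ (C : Carrier) → 0# < C ×
    (∀ (m n : ℕ) (A : Matrix m n) (r : ℕ) → HasRank A r →
    detlb A ≤ γ₂ A ×
    (2 ℕ.≤ r → γ₂ A ≤ C * log (fromℕ r) * detlb A))
theorem3p1 ℝ = 16# ℝ , 0<16 ℝ , λ m n A r rank → detlb≤γ₂ ℝ A , γ₂≤log*detlb ℝ A r rank
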